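{- Let $m\in\mathbb{Z}$ and let $\mathbb{L}_m$ be the simplest cubic field generated over $\mathbb{Q}$ by a root of the polynomial $l_m(x)=x^3-mx^2-(m+3)x-1$. Then $$I(\mathbb{L}_m)=1$$ and $$i(\mathbb{L}_m)=\begin{cases}3&\text{if } m\equiv 39,120,201\pmod{243},\\ 1&\text{otherwise.}\end{cases}$$
   Context: For a number field $\mathbb{K}$ of degree $n$ over $\mathbb{Q}$ with ring of integers $\mathbb{A}$, let $\widehat{\mathbb{A}}$ be the set of $\theta\in\mathbb{A}$ that are primitive over $\mathbb{Q}$, i.e. $\mathbb{K}=\mathbb{Q}(\theta)$. For $\theta\in\widehat{\mathbb{A}}$ let $I(\theta)=[\mathbb{A}:\mathbb{Z}[\theta]]$ and define $I(\mathbb{K})=\gcd_{\theta\in\widehat{\mathbb{A}}} I(\theta)$. For $\theta\in\mathbb{A}$ let $F_\theta(x)\in\mathbb{Z}[x]$ be the (degree $n$) characteristic polynomial of $\theta$ over $\mathbb{Q}$ and set $i(\theta)=\gcd_{x\in\mathbb{Z}}F_\theta(x)$. Define $i(\mathbb{K})=\operatorname{lcm}_{\theta\in\widehat{\mathbb{A}}}\, i(\theta)$. -}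

module Defs where

open import Algebra.Bundles using (CommutativeRing)
open import Algebra.Morphism.Structures using (module RingMorphisms)
import Algebra.Properties.Monoid.Sum as MonoidSum
import Algebra.Properties.Semiring.Exp as SemiringExp
open import Data.Bool.Base using (if_then_else_)
open import Data.Fin.Base using (Fin; zero; suc; toℕ; punchIn)
open import Data.Fin.Patterns using (0F; 1F; 2F)
import Data.Fin.Properties as Fin
open import Data.Integer.Base as ℤ using (ℤ; +_; -[1+_])
import Data.Integer.Divisibility as ℤ using (_∣_)
import Data.Integer.Divisibility.Signed as ℤ using (divides; ∣⇒∣ᵤ)
import Data.Integer.DivMod as ℤ
import Data.Integer.Properties as ℤ
import Data.Integer.Solver as ℤSolver
open import Data.List.Base using (List; []; _∷_; _∷ʳ_; foldr; map)
open import Data.Nat.Base as ℕ using (ℕ; suc)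
import Data.Nat.Coprimality as ℕ
open import Data.Nat.Divisibility as ℕ using (divides)
import Data.Nat.Properties as ℕ
open import Data.Product.Base using (∃; ∃₂; _×_; _,_)
open import Data.Rational.Base as ℚ using (ℚ; 0ℚ; 1ℚ)
import Data.Rational.Properties as ℚ
import Data.Rational.Solver as ℚSolver
import Data.Rational.Unnormalised.Base as ℚᵘ
import Data.Rational.Unnormalised.Properties as ℚᵘ
open import Data.Sum.Base using (_⊎_; inj₁; inj₂)
open import Data.Vec.Functional using (Vector)
open import Level using (0ℓ)
open import Relation.Binary.PropositionalEquality
open import Relation.Nullary using (¬_; yes; no; does; contradiction)

record IsGcd (S : ℕ → Set) (d : ℕ) : Set where
  field
    divides-all : ∀ n → S n → d ℕ.∣ n
    greatest    : ∀ c → (∀ n → S n → c ℕ.∣ n) → c ℕ.∣ d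

record IsLcm (S : ℕ → Set) (l : ℕ) : Set where
  field
    multiple-of-all : ∀ n → S n → n ℕ.∣ l
    least           : ∀ c → (∀ n → S n → n ℕ.∣ c) → l ℕ.∣ c

infix 4 _≡_[mod_]
_≡_[mod_] : ℤ → ℤ → ℕ → Set
a ≡ b [mod n ] = + n ℤ.∣ a ℤ.- b

fromℤ : ℤ → ℚ
fromℤ z = z ℚ./ 1

Matrix : ℕ → Set
Matrix n = Fin n → Fin n → ℚ

module ℚΣ = MonoidSum ℚ.+-0-monoid
open SemiringExp (CommutativeRing.semiring ℚ.+-*-commutativeRing) using (_^_)

-- Laplace expansion along the first row.
det : ∀ n → Matrix n → ℚ
det ℕ.zero  M = 1ℚ
det (suc n) M = ℚΣ.sum λ j →
  (ℚ.- 1ℚ) ^ toℕ j ℚ.* M 0F j ℚ.* det n (λ i k → M (suc i) (punchIn j k))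

scalar : ∀ {n} → ℚ → Matrix n
scalar x i j = if does (i Fin.≟ j) then x else 0ℚ

-- A field extension of ℚ of finite degree; the degree is witnessed by a
-- ℚ-basis.  The basis is only used for the characteristic polynomial, which
-- does not depend on it.
record NumberField : Set₁ where
  field
    commutativeRing : CommutativeRing 0ℓ 0ℓ
  open CommutativeRing commutativeRing public
  field
    0≉1     : ¬ 0# ≈ 1#
    inverse : ∀ x → ¬ x ≈ 0# → ∃ λ y → x * y ≈ 1#
    ι       : ℚ → Carrier
    ι-hom   : RingMorphisms.IsRingHomomorphism ℚ.+-*-rawRing rawRing ι
    degree  : ℕ
    basis   : Vector Carrier degree

  open MonoidSum +-monoid public using (sum)

  combination : Vector ℚ degree → Carrier
  combination c = sum λ i → ι (c i) * basis i

  field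
    coord       : Carrier → Vector ℚ degree
    spanning    : ∀ x → x ≈ combination (coord x)
    independent : ∀ c → combination c ≈ 0# → ∀ i → c i ≡ 0ℚ

module _ (K : NumberField) where
  open NumberField K

  -- Polynomials are lists of coefficients, constant term first.
  evalℚ : List ℚ → Carrier → Carrier
  evalℚ p x = foldr (λ c v → ι c + x * v) 0# p

  evalℤ : List ℤ → Carrier → Carrier
  evalℤ p = evalℚ (map fromℤ p)

  -- p ++ [ 1 ] is the monic polynomial with lower coefficients p.
  Integral : Carrier → Set
  Integral θ = ∃ λ (p : List ℤ) → evalℤ (p ∷ʳ + 1) θ ≈ 0#

  -- K = ℚ(θ): every x is a quotient p(θ)/q(θ).
  Primitive : Carrier → Set
  Primitive θ = ∀ x → ∃₂ λ (p q : List ℚ) →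
    ¬ evalℚ q θ ≈ 0# × x * evalℚ q θ ≈ evalℚ p θ

  Â : Carrier → Set
  Â θ = Integral θ × Primitive θ

  ℤ[_] : Carrier → Carrier → Set
  ℤ[ θ ] x = ∃ λ (p : List ℤ) → x ≈ evalℤ p θ

  -- [ A : B ] = n for additive subgroups B ⊆ A of K: there is a system of
  -- coset representatives indexed by Fin n.
  record Index (A B : Carrier → Set) (n : ℕ) : Set where
    field
      rep      : Fin n → Carrier
      rep∈A    : ∀ i → A (rep i)
      covers   : ∀ x → A x → ∃ λ i → B (x - rep i)
      distinct : ∀ i j → B (rep i - rep j) → i ≡ j

  -- I(K) = d
  FieldIndex : ℕ → Set
  FieldIndex = IsGcd λ n → ∃ λ θ → Â θ × Index Integral ℤ[ θ ] n

  -- The matrix of multiplication by θ; column j holds θ · basis j.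
  mulMatrix : Carrier → Matrix degree
  mulMatrix θ i j = coord (θ * basis j) i

  -- The value at x of the characteristic polynomial F_θ = det (X·I − M_θ).
  F : Carrier → ℚ → ℚ
  F θ x = det degree λ i j → scalar x i j ℚ.- mulMatrix θ i j

  -- i(θ) = d.  For integral θ all values F_θ(x), x ∈ ℤ, are integers.
  ValueGcd : Carrier → ℕ → Set
  ValueGcd θ = IsGcd λ n →
    ∃₂ λ (x z : ℤ) → F θ (fromℤ x) ≡ fromℤ z × n ≡ ℤ.∣ z ∣

  -- i(K) = l
  FieldValueLcm : ℕ → Set
  FieldValueLcm = IsLcm λ n → ∃ λ θ → Â θ × ValueGcd θ n

-- x³ − m x² − (m+3) x − 1
l : ℤ → List ℤ
l m = -[1+ 0 ] ∷ ℤ.- (m ℤ.+ + 3) ∷ ℤ.- m ∷ + 1 ∷ []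

-- ⟨ a , b , c ⟩ is the class of a + b x + c x² in ℚ[x]/(l m).
record Cubic : Set where
  constructor ⟨_,_,_⟩
  field c₀ c₁ c₂ : ℚ

cong₃ : ∀ {a b c a′ b′ c′} → a ≡ a′ → b ≡ b′ → c ≡ c′ → ⟨ a , b , c ⟩ ≡ ⟨ a′ , b′ , c′ ⟩
cong₃ refl refl refl = refl

3ℚ : ℚ
3ℚ = + 3 ℚ./ 1

module CubicRing (μ : ℚ) where
  open import Data.Rational.Base using (_+_; _*_; -_)

  infixl 6 _⊕_
  infixl 7 _⊗_ _·_

  _⊕_ : Cubic → Cubic → Cubic
  ⟨ a , b , c ⟩ ⊕ ⟨ a′ , b′ , c′ ⟩ = ⟨ a + a′ , b + b′ , c + c′ ⟩

  ⊖_ : Cubic → Cubic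
  ⊖ ⟨ a , b , c ⟩ = ⟨ - a , - b , - c ⟩

  _·_ : ℚ → Cubic → Cubic
  k · ⟨ a , b , c ⟩ = ⟨ k * a , k * b , k * c ⟩

  -- Multiplication by x, reduced with x³ = μ x² + (μ+3) x + 1.
  x·_ : Cubic → Cubic
  x· ⟨ a , b , c ⟩ = ⟨ c , a + (μ + 3ℚ) * c , b + μ * c ⟩

  _⊗_ : Cubic → Cubic → Cubic
  ⟨ a , b , c ⟩ ⊗ y = a · y ⊕ (b · (x· y) ⊕ c · (x· (x· y)))

  const : ℚ → Cubic
  const a = ⟨ a , 0ℚ , 0ℚ ⟩

  -- The same operations on solver syntax.
  private
    open ℚSolver.+-*-Solver

    record Cubicᴾ (n : ℕ) : Set where
      constructor ⟪_,_,_⟫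
      field p₀ p₁ p₂ : Polynomial n
    open Cubicᴾ

    infixl 6 _⊕ᴾ_
    infixl 7 _·ᴾ_

    _⊕ᴾ_ : ∀ {n} → Cubicᴾ n → Cubicᴾ n → Cubicᴾ n
    ⟪ a , b , c ⟫ ⊕ᴾ ⟪ a′ , b′ , c′ ⟫ = ⟪ a :+ a′ , b :+ b′ , c :+ c′ ⟫

    _·ᴾ_ : ∀ {n} → Polynomial n → Cubicᴾ n → Cubicᴾ n
    k ·ᴾ ⟪ a , b , c ⟫ = ⟪ k :* a , k :* b , k :* c ⟫

    mul : ∀ {n} → Polynomial n → Cubicᴾ n → Cubicᴾ n → Cubicᴾ n
    mul {n} m ⟪ a , b , c ⟫ y = a ·ᴾ y ⊕ᴾ (b ·ᴾ x·ᴾ y ⊕ᴾ c ·ᴾ x·ᴾ (x·ᴾ y))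
      where
      infixr 8 x·ᴾ_
      x·ᴾ_ : Cubicᴾ n → Cubicᴾ n
      x·ᴾ ⟪ a , b , c ⟫ = ⟪ c , a :+ (m :+ con 3ℚ) :* c , b :+ m :* c ⟫

    0ᴾ : ∀ {n} → Polynomial n
    0ᴾ = con 0ℚ

    norm : ∀ {n} → Polynomial n → Polynomial n → Polynomial n → Polynomial n
    norm m a b = a :* a :* a :+ m :* a :* a :* b
      :+ :- ((m :+ con 3ℚ) :* a :* b :* b) :+ b :* b :* b

  ⊗-comm : ∀ u v → u ⊗ v ≡ v ⊗ u
  ⊗-comm ⟨ a , b , c ⟩ ⟨ d , e , f ⟩ = cong₃
    (solve 7 (λ m a b c d e f → p₀ (mul m ⟪ a , b , c ⟫ ⟪ d , e , f ⟫) := p₀ (mul m ⟪ d , e , f ⟫ ⟪ a , b , c ⟫)) refl μ a b c d e f)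
    (solve 7 (λ m a b c d e f → p₁ (mul m ⟪ a , b , c ⟫ ⟪ d , e , f ⟫) := p₁ (mul m ⟪ d , e , f ⟫ ⟪ a , b , c ⟫)) refl μ a b c d e f)
    (solve 7 (λ m a b c d e f → p₂ (mul m ⟪ a , b , c ⟫ ⟪ d , e , f ⟫) := p₂ (mul m ⟪ d , e , f ⟫ ⟪ a , b , c ⟫)) refl μ a b c d e f)

  ⊗-assoc : ∀ u v w → (u ⊗ v) ⊗ w ≡ u ⊗ (v ⊗ w)
  ⊗-assoc ⟨ a , b , c ⟩ ⟨ d , e , f ⟩ ⟨ g , h , i ⟩ = cong₃
    (solve 10 (λ m a b c d e f g h i → p₀ (mul m (mul m ⟪ a , b , c ⟫ ⟪ d , e , f ⟫) ⟪ g , h , i ⟫) := p₀ (mul m ⟪ a , b , c ⟫ (mul m ⟪ d , e , f ⟫ ⟪ g , h , i ⟫))) refl μ a b c d e f g h i)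
    (solve 10 (λ m a b c d e f g h i → p₁ (mul m (mul m ⟪ a , b , c ⟫ ⟪ d , e , f ⟫) ⟪ g , h , i ⟫) := p₁ (mul m ⟪ a , b , c ⟫ (mul m ⟪ d , e , f ⟫ ⟪ g , h , i ⟫))) refl μ a b c d e f g h i)
    (solve 10 (λ m a b c d e f g h i → p₂ (mul m (mul m ⟪ a , b , c ⟫ ⟪ d , e , f ⟫) ⟪ g , h , i ⟫) := p₂ (mul m ⟪ a , b , c ⟫ (mul m ⟪ d , e , f ⟫ ⟪ g , h , i ⟫))) refl μ a b c d e f g h i)

  ⊗-distribˡ-⊕ : ∀ u v w → u ⊗ (v ⊕ w) ≡ u ⊗ v ⊕ u ⊗ w
  ⊗-distribˡ-⊕ ⟨ a , b , c ⟩ ⟨ d , e , f ⟩ ⟨ g , h , i ⟩ = cong₃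
    (solve 10 (λ m a b c d e f g h i → p₀ (mul m ⟪ a , b , c ⟫ (⟪ d , e , f ⟫ ⊕ᴾ ⟪ g , h , i ⟫)) := p₀ (mul m ⟪ a , b , c ⟫ ⟪ d , e , f ⟫ ⊕ᴾ mul m ⟪ a , b , c ⟫ ⟪ g , h , i ⟫)) refl μ a b c d e f g h i)
    (solve 10 (λ m a b c d e f g h i → p₁ (mul m ⟪ a , b , c ⟫ (⟪ d , e , f ⟫ ⊕ᴾ ⟪ g , h , i ⟫)) := p₁ (mul m ⟪ a , b , c ⟫ ⟪ d , e , f ⟫ ⊕ᴾ mul m ⟪ a , b , c ⟫ ⟪ g , h , i ⟫)) refl μ a b c d e f g h i)
    (solve 10 (λ m a b c d e f g h i → p₂ (mul m ⟪ a , b , c ⟫ (⟪ d , e , f ⟫ ⊕ᴾ ⟪ g , h , i ⟫)) := p₂ (mul m ⟪ a , b , c ⟫ ⟪ d , e , f ⟫ ⊕ᴾ mul m ⟪ a , b , c ⟫ ⟪ g , h , i ⟫)) refl μ a b c d e f g h i)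

  ⊗-identityˡ : ∀ u → const 1ℚ ⊗ u ≡ u
  ⊗-identityˡ ⟨ a , b , c ⟩ = cong₃
    (solve 4 (λ m a b c → p₀ (mul m ⟪ con 1ℚ , 0ᴾ , 0ᴾ ⟫ ⟪ a , b , c ⟫) := p₀ (⟪ a , b , c ⟫)) refl μ a b c)
    (solve 4 (λ m a b c → p₁ (mul m ⟪ con 1ℚ , 0ᴾ , 0ᴾ ⟫ ⟪ a , b , c ⟫) := p₁ (⟪ a , b , c ⟫)) refl μ a b c)
    (solve 4 (λ m a b c → p₂ (mul m ⟪ con 1ℚ , 0ᴾ , 0ᴾ ⟫ ⟪ a , b , c ⟫) := p₂ (⟪ a , b , c ⟫)) refl μ a b c)

  commutativeRing : CommutativeRing 0ℓ 0ℓ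
  commutativeRing = record
    { Carrier = Cubic ; _≈_ = _≡_ ; _+_ = _⊕_ ; _*_ = _⊗_ ; -_ = ⊖_
    ; 0# = const 0ℚ ; 1# = const 1ℚ
    ; isCommutativeRing = record
      { isRing = record
        { +-isAbelianGroup = record
          { isGroup = record
            { isMonoid = record
              { isSemigroup = record
                { isMagma = record
                  { isEquivalence = isEquivalence
                  ; ∙-cong = cong₂ _⊕_
                  }
                ; assoc = λ (⟨ a , b , c ⟩) (⟨ d , e , f ⟩) (⟨ g , h , i ⟩) →
                    cong₃ (ℚ.+-assoc a d g) (ℚ.+-assoc b e h) (ℚ.+-assoc c f i)
                }
              ; identity =
                  (λ (⟨ a , b , c ⟩) → cong₃ (ℚ.+-identityˡ a) (ℚ.+-identityˡ b) (ℚ.+-identityˡ c))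
                , (λ (⟨ a , b , c ⟩) → cong₃ (ℚ.+-identityʳ a) (ℚ.+-identityʳ b) (ℚ.+-identityʳ c))
              }
            ; inverse =
                (λ (⟨ a , b , c ⟩) → cong₃ (ℚ.+-inverseˡ a) (ℚ.+-inverseˡ b) (ℚ.+-inverseˡ c))
              , (λ (⟨ a , b , c ⟩) → cong₃ (ℚ.+-inverseʳ a) (ℚ.+-inverseʳ b) (ℚ.+-inverseʳ c))
            ; ⁻¹-cong = cong ⊖_
            }
          ; comm = λ (⟨ a , b , c ⟩) (⟨ d , e , f ⟩) →
              cong₃ (ℚ.+-comm a d) (ℚ.+-comm b e) (ℚ.+-comm c f)
          }
        ; *-cong = cong₂ _⊗_
        ; *-assoc = ⊗-assoc
        ; *-identity = ⊗-identityˡ , λ u → trans (⊗-comm u (const 1ℚ)) (⊗-identityˡ u)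
        ; distrib = ⊗-distribˡ-⊕ , λ u v w → trans (⊗-comm (v ⊕ w) u)
            (trans (⊗-distribˡ-⊕ u v w) (cong₂ _⊕_ (⊗-comm u v) (⊗-comm u w)))
        }
      ; *-comm = ⊗-comm
      }
    }

  const-⊗ : ∀ a d → const a ⊗ const d ≡ const (a * d)
  const-⊗ a d = cong₃
    (solve 3 (λ m a d → p₀ (mul m ⟪ a , 0ᴾ , 0ᴾ ⟫ ⟪ d , 0ᴾ , 0ᴾ ⟫) := p₀ (⟪ a :* d , 0ᴾ , 0ᴾ ⟫)) refl μ a d)
    (solve 3 (λ m a d → p₁ (mul m ⟪ a , 0ᴾ , 0ᴾ ⟫ ⟪ d , 0ᴾ , 0ᴾ ⟫) := p₁ (⟪ a :* d , 0ᴾ , 0ᴾ ⟫)) refl μ a d)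
    (solve 3 (λ m a d → p₂ (mul m ⟪ a , 0ᴾ , 0ᴾ ⟫ ⟪ d , 0ᴾ , 0ᴾ ⟫) := p₂ (⟪ a :* d , 0ᴾ , 0ᴾ ⟫)) refl μ a d)

  const-hom : RingMorphisms.IsRingHomomorphism ℚ.+-*-rawRing
                (CommutativeRing.rawRing commutativeRing) const
  const-hom = record
    { isSemiringHomomorphism = record
      { isNearSemiringHomomorphism = record
        { +-isMonoidHomomorphism = record
          { isMagmaHomomorphism = record
            { isRelHomomorphism = record { cong = cong const }
            ; homo = λ _ _ → refl
            }
          ; ε-homo = refl
          }
        ; *-homo = λ a d → sym (const-⊗ a d)
        }
      ; 1#-homo = refl
      }
    ; -‿homo = λ _ → refl
    }

  powers : Vector Cubic 3
  powers 0F = ⟨ 1ℚ , 0ℚ , 0ℚ ⟩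
  powers 1F = ⟨ 0ℚ , 1ℚ , 0ℚ ⟩
  powers 2F = ⟨ 0ℚ , 0ℚ , 1ℚ ⟩

  coordinates : Cubic → Vector ℚ 3
  coordinates u 0F = Cubic.c₀ u
  coordinates u 1F = Cubic.c₁ u
  coordinates u 2F = Cubic.c₂ u

  private
    sumᴾ : ∀ {n} (m a b c : Polynomial n) → Cubicᴾ n
    sumᴾ m a b c =
         mul m ⟪ a , 0ᴾ , 0ᴾ ⟫ ⟪ con 1ℚ , 0ᴾ , 0ᴾ ⟫
      ⊕ᴾ (mul m ⟪ b , 0ᴾ , 0ᴾ ⟫ ⟪ 0ᴾ , con 1ℚ , 0ᴾ ⟫
      ⊕ᴾ (mul m ⟪ c , 0ᴾ , 0ᴾ ⟫ ⟪ 0ᴾ , 0ᴾ , con 1ℚ ⟫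
      ⊕ᴾ ⟪ 0ᴾ , 0ᴾ , 0ᴾ ⟫))

  expand : ∀ a b c →
    const a ⊗ powers 0F ⊕ (const b ⊗ powers 1F ⊕ (const c ⊗ powers 2F ⊕ const 0ℚ))
    ≡ ⟨ a , b , c ⟩
  expand a b c = cong₃
    (solve 4 (λ m a b c → p₀ (sumᴾ m a b c) := p₀ (⟪ a , b , c ⟫)) refl μ a b c)
    (solve 4 (λ m a b c → p₁ (sumᴾ m a b c) := p₁ (⟪ a , b , c ⟫)) refl μ a b c)
    (solve 4 (λ m a b c → p₂ (sumᴾ m a b c) := p₂ (⟪ a , b , c ⟫)) refl μ a b c)

  ρ : Cubic
  ρ = ⟨ 0ℚ , 1ℚ , 0ℚ ⟩

  private
    horner : ∀ {n} → Polynomial n → Polynomial n → Cubicᴾ n → Cubicᴾ n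
    horner m a v = ⟪ a , 0ᴾ , 0ᴾ ⟫ ⊕ᴾ mul m ⟪ 0ᴾ , con 1ℚ , 0ᴾ ⟫ v

    h₂ h₃ : ∀ {n} (m a b c : Polynomial n) → Cubicᴾ n
    h₂ m a b c = horner m a (horner m b (horner m c ⟪ 0ᴾ , 0ᴾ , 0ᴾ ⟫))
    h₃ m a b c = horner m a (horner m b (horner m c (horner m (con 1ℚ) ⟪ 0ᴾ , 0ᴾ , 0ᴾ ⟫)))

  horner-quadratic : ∀ a b c →
    const a ⊕ ρ ⊗ (const b ⊕ ρ ⊗ (const c ⊕ ρ ⊗ const 0ℚ)) ≡ ⟨ a , b , c ⟩
  horner-quadratic a b c = cong₃
    (solve 4 (λ m a b c → p₀ (h₂ m a b c) := p₀ ⟪ a , b , c ⟫) refl μ a b c)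
    (solve 4 (λ m a b c → p₁ (h₂ m a b c) := p₁ ⟪ a , b , c ⟫) refl μ a b c)
    (solve 4 (λ m a b c → p₂ (h₂ m a b c) := p₂ ⟪ a , b , c ⟫) refl μ a b c)

  horner-cubic : const (- 1ℚ) ⊕ ρ ⊗ (const (- (μ + 3ℚ)) ⊕ ρ ⊗ (const (- μ) ⊕ ρ ⊗
    (const 1ℚ ⊕ ρ ⊗ const 0ℚ))) ≡ const 0ℚ
  horner-cubic = cong₃
    (solve 1 (λ m → p₀ (h₃ m (con (- 1ℚ)) (:- (m :+ con 3ℚ)) (:- m)) := p₀ ⟪ 0ᴾ , 0ᴾ , 0ᴾ ⟫) refl μ)
    (solve 1 (λ m → p₁ (h₃ m (con (- 1ℚ)) (:- (m :+ con 3ℚ)) (:- m)) := p₁ ⟪ 0ᴾ , 0ᴾ , 0ᴾ ⟫) refl μ)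
    (solve 1 (λ m → p₂ (h₃ m (con (- 1ℚ)) (:- (m :+ con 3ℚ)) (:- m)) := p₂ ⟪ 0ᴾ , 0ᴾ , 0ᴾ ⟫) refl μ)

  -- b³ times the value of the defining cubic at −a/b, up to sign.
  G : ℚ → ℚ → ℚ
  G a b = a * a * a + μ * a * a * b + - ((μ + 3ℚ) * a * b * b) + b * b * b

  G-homogeneous : ∀ a b k → G (a * k) (b * k) ≡ k * k * k * G a b
  G-homogeneous = solve 4 (λ m a b k →
    norm m (a :* k) (b :* k) := k :* k :* k :* norm m a b) refl μ

  -- Euclidean algorithm in ℚ[x]: division with remainder of the defining cubic
  -- by a polynomial of degree one or two.
  module Inverse (noRoot : ∀ a b → b ≢ 0ℚ → G a b ≢ 0ℚ) where

    Unit : Cubic → Set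
    Unit u = ∃ λ v → u ⊗ v ≡ const 1ℚ

    factor-unit : ∀ u v {w} → u ⊗ v ≡ w → Unit w → Unit u
    factor-unit u v refl (t , eq) = v ⊗ t , trans (sym (⊗-assoc u v t)) eq

    const-unit : ∀ a → a ≢ 0ℚ → Unit (const a)
    const-unit a a≢0 = const (ℚ.1/ a) , trans (const-⊗ a (ℚ.1/ a)) (cong const (ℚ.*-inverseʳ a))
      where instance _ = ℚ.≢-nonZero a≢0

    cofactor : ℚ → ℚ → Cubic
    cofactor a b =
      ⟨ a * a + μ * a * b + - ((μ + 3ℚ) * b * b) , - (a * b) + - (μ * b * b) , b * b ⟩

    private
      cofactorᴾ : ∀ {n} → (m a b : Polynomial n) → Cubicᴾ n
      cofactorᴾ m a b = ⟪ a :* a :+ m :* a :* b :+ :- ((m :+ con 3ℚ) :* b :* b)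
                        , :- (a :* b) :+ :- (m :* b :* b) , b :* b ⟫

    linear-⊗ : ∀ a b → ⟨ a , b , 0ℚ ⟩ ⊗ cofactor a b ≡ const (G a b)
    linear-⊗ a b = cong₃
      (solve 3 (λ m a b → p₀ (mul m ⟪ a , b , 0ᴾ ⟫ (cofactorᴾ m a b)) := p₀ (⟪ norm m a b , 0ᴾ , 0ᴾ ⟫)) refl μ a b)
      (solve 3 (λ m a b → p₁ (mul m ⟪ a , b , 0ᴾ ⟫ (cofactorᴾ m a b)) := p₁ (⟪ norm m a b , 0ᴾ , 0ᴾ ⟫)) refl μ a b)
      (solve 3 (λ m a b → p₂ (mul m ⟪ a , b , 0ᴾ ⟫ (cofactorᴾ m a b)) := p₂ (⟪ norm m a b , 0ᴾ , 0ᴾ ⟫)) refl μ a b)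

    linear-unit : ∀ a b → b ≢ 0ℚ → Unit ⟨ a , b , 0ℚ ⟩
    linear-unit a b b≢0 = factor-unit ⟨ a , b , 0ℚ ⟩ (cofactor a b) (linear-⊗ a b) (const-unit (G a b) (noRoot a b b≢0))

    -- (c x + u) (a + b x + c x²) ≡ e₀ + e₁ x
    module _ (a b c : ℚ) where
      u e₀ e₁ : ℚ
      u  = - (c * μ + b)
      e₀ = c * c + u * a
      e₁ = c * c * (μ + 3ℚ) + a * c + u * b

      private
        uᴾ e₀ᴾ e₁ᴾ : ∀ {n} → (m a b c : Polynomial n) → Polynomial n
        uᴾ m a b c  = :- (c :* m :+ b)
        e₀ᴾ m a b c = c :* c :+ uᴾ m a b c :* a
        e₁ᴾ m a b c = c :* c :* (m :+ con 3ℚ) :+ a :* c :+ uᴾ m a b c :* b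

      quadratic-⊗ : ⟨ a , b , c ⟩ ⊗ ⟨ u , c , 0ℚ ⟩ ≡ ⟨ e₀ , e₁ , 0ℚ ⟩
      quadratic-⊗  = cong₃
        (solve 4 (λ m a b c → p₀ (mul m ⟪ a , b , c ⟫ ⟪ uᴾ m a b c , c , 0ᴾ ⟫) := p₀ (⟪ e₀ᴾ m a b c , e₁ᴾ m a b c , 0ᴾ ⟫)) refl μ a b c)
        (solve 4 (λ m a b c → p₁ (mul m ⟪ a , b , c ⟫ ⟪ uᴾ m a b c , c , 0ᴾ ⟫) := p₁ (⟪ e₀ᴾ m a b c , e₁ᴾ m a b c , 0ᴾ ⟫)) refl μ a b c)
        (solve 4 (λ m a b c → p₂ (mul m ⟪ a , b , c ⟫ ⟪ uᴾ m a b c , c , 0ᴾ ⟫) := p₂ (⟪ e₀ᴾ m a b c , e₁ᴾ m a b c , 0ᴾ ⟫)) refl μ a b c)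

      remainder : G u c ≡ c * e₀ + - (u * e₁)
      remainder = solve 4 (λ m a b c → norm m (uᴾ m a b c) c
        := c :* e₀ᴾ m a b c :+ :- (uᴾ m a b c :* e₁ᴾ m a b c)) refl μ a b c

      quadratic-unit : c ≢ 0ℚ → Unit ⟨ a , b , c ⟩
      quadratic-unit c≢0 with e₁ ℚ.≟ 0ℚ | e₀ ℚ.≟ 0ℚ
      ... | no e₁≢0 | _        = factor-unit ⟨ a , b , c ⟩ ⟨ u , c , 0ℚ ⟩ quadratic-⊗ (linear-unit e₀ e₁ e₁≢0)
      ... | yes e₁≡0 | no e₀≢0 = factor-unit ⟨ a , b , c ⟩ ⟨ u , c , 0ℚ ⟩
        (trans quadratic-⊗ (cong ⟨ e₀ ,_, 0ℚ ⟩ e₁≡0)) (const-unit e₀ e₀≢0)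
      ... | yes e₁≡0 | yes e₀≡0 = contradiction
        (trans remainder (trans (cong₂ (λ s t → c * s + - (u * t)) e₀≡0 e₁≡0)
          (solve 2 (λ c u → c :* 0ᴾ :+ :- (u :* 0ᴾ) := 0ᴾ) refl c u)))
        (noRoot u c c≢0)

    inverse : ∀ x → x ≢ const 0ℚ → Unit x
    inverse ⟨ a , b , c ⟩ x≢0 with c ℚ.≟ 0ℚ
    ... | no c≢0 = quadratic-unit a b c c≢0
    ... | yes refl with b ℚ.≟ 0ℚ
    ...   | no b≢0 = linear-unit a b b≢0
    ...   | yes refl = const-unit a λ { refl → x≢0 refl }

toℚᵘ-fromℤ : ∀ z → ℚ.toℚᵘ (fromℤ z) ℚᵘ.≃ ℚᵘ.mkℚᵘ z 0
toℚᵘ-fromℤ z = ℚ.toℚᵘ-fromℚᵘ (ℚᵘ.mkℚᵘ z 0)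

fromℤ-injective : ∀ {a b} → fromℤ a ≡ fromℤ b → a ≡ b
fromℤ-injective {a} {b} eq = ℤ.*-cancelʳ-≡ a b (+ 1) (ℚᵘ.drop-*≡*
  (ℚᵘ.≃-trans (ℚᵘ.≃-sym (toℚᵘ-fromℤ a)) (ℚᵘ.≃-trans (ℚᵘ.≃-reflexive (cong ℚ.toℚᵘ eq)) (toℚᵘ-fromℤ b))))

fromℤ-+ : ∀ a b → fromℤ (a ℤ.+ b) ≡ fromℤ a ℚ.+ fromℤ b
fromℤ-+ a b = ℚ.toℚᵘ-injective (begin
  ℚ.toℚᵘ (fromℤ (a ℤ.+ b))                    ≈⟨ toℚᵘ-fromℤ (a ℤ.+ b) ⟩
  ℚᵘ.mkℚᵘ (a ℤ.+ b) 0                         ≈⟨ ℚᵘ.*≡* (solve 2 (λ a b →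
    (a :+ b) :* con (+ 1) := (a :* con (+ 1) :+ b :* con (+ 1)) :* con (+ 1)) refl a b) ⟩
  ℚᵘ.mkℚᵘ a 0 ℚᵘ.+ ℚᵘ.mkℚᵘ b 0                ≈⟨ ℚᵘ.+-cong (toℚᵘ-fromℤ a) (toℚᵘ-fromℤ b) ⟨
  ℚ.toℚᵘ (fromℤ a) ℚᵘ.+ ℚ.toℚᵘ (fromℤ b)      ≈⟨ ℚ.toℚᵘ-homo-+ (fromℤ a) (fromℤ b) ⟨
  ℚ.toℚᵘ (fromℤ a ℚ.+ fromℤ b)                ∎)
  where
  open import Relation.Binary.Reasoning.Setoid ℚᵘ.≃-setoid
  open ℤSolver.+-*-Solver

fromℤ-* : ∀ a b → fromℤ (a ℤ.* b) ≡ fromℤ a ℚ.* fromℤ b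
fromℤ-* a b = ℚ.toℚᵘ-injective (begin
  ℚ.toℚᵘ (fromℤ (a ℤ.* b))                    ≈⟨ toℚᵘ-fromℤ (a ℤ.* b) ⟩
  ℚᵘ.mkℚᵘ a 0 ℚᵘ.* ℚᵘ.mkℚᵘ b 0                ≈⟨ ℚᵘ.*-cong (toℚᵘ-fromℤ a) (toℚᵘ-fromℤ b) ⟨
  ℚ.toℚᵘ (fromℤ a) ℚᵘ.* ℚ.toℚᵘ (fromℤ b)      ≈⟨ ℚ.toℚᵘ-homo-* (fromℤ a) (fromℤ b) ⟨
  ℚ.toℚᵘ (fromℤ a ℚ.* fromℤ b)                ∎)
  where open import Relation.Binary.Reasoning.Setoid ℚᵘ.≃-setoid

fromℤ-neg : ∀ a → fromℤ (ℤ.- a) ≡ ℚ.- fromℤ a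
fromℤ-neg a = ℚ.toℚᵘ-injective (begin
  ℚ.toℚᵘ (fromℤ (ℤ.- a))     ≈⟨ toℚᵘ-fromℤ (ℤ.- a) ⟩
  ℚᵘ.- ℚᵘ.mkℚᵘ a 0           ≈⟨ ℚᵘ.-‿cong (toℚᵘ-fromℤ a) ⟨
  ℚᵘ.- ℚ.toℚᵘ (fromℤ a)      ≈⟨ ℚ.toℚᵘ-homo‿- (fromℤ a) ⟨
  ℚ.toℚᵘ (ℚ.- fromℤ a)       ∎)
  where open import Relation.Binary.Reasoning.Setoid ℚᵘ.≃-setoid

-- The cubic has no rational root, because it has none modulo 2.

module _ (m : ℤ) where
  open import Data.Integer.Base using (_+_; _*_; -_)
  open ℤSolver.+-*-Solver

  Gℤ : ℤ → ℤ → ℤ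
  Gℤ p q = p * p * p + m * p * p * q + - ((m + + 3) * p * q * q) + q * q * q

  private
    Gᴾ : ∀ {n} → Polynomial n → Polynomial n → Polynomial n → Polynomial n
    Gᴾ m p q = p :* p :* p :+ m :* p :* p :* q
      :+ :- ((m :+ con (+ 3)) :* p :* q :* q) :+ q :* q :* q

    even odd : ∀ {n} → Polynomial n → Polynomial n
    even s = s :* con (+ 2)
    odd s = con (+ 1) :+ s :* con (+ 2)

    cube : ∀ {n} → Polynomial n → Polynomial n
    cube s = con (+ 4) :* s :* s :* s :+ con (+ 6) :* s :* s :+ con (+ 3) :* s

  -- (1 + 2 s)³ = 1 + 2 cubeℤ s
  cubeℤ : ℤ → ℤ
  cubeℤ s = + 4 * s * s * s + + 6 * s * s + + 3 * s

  parity : ∀ z → ∃ λ s → z ≡ s * + 2 ⊎ z ≡ + 1 + s * + 2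
  parity z with z ℤ.%ℕ 2 | ℤ.n%ℕd<d z 2 | ℤ.a≡a%ℕn+[a/ℕn]*n z 2
  ... | 0 | _ | eq = z ℤ./ℕ 2 , inj₁ (trans eq (ℤ.+-identityˡ _))
  ... | 1 | _ | eq = z ℤ./ℕ 2 , inj₂ eq
  ... | suc (suc _) | ℕ.s≤s (ℕ.s≤s ()) | _

  odd≢0 : ∀ {z} k → z ≡ + 1 + k * + 2 → z ≢ + 0
  odd≢0 k refl eq with ℕ.∣1⇒≡1 (ℤ.∣⇒∣ᵤ (ℤ.divides {+ 2} {+ 1} (- k) (trans
    (solve 1 (λ k → con (+ 1) := (con (+ 1) :+ k :* con (+ 2)) :+ (:- k) :* con (+ 2)) refl k)
    (trans (cong (_+ - k * + 2) eq) (ℤ.+-identityˡ _)))))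
  ... | ()

  even-abs : ∀ s → 2 ℕ.∣ ℤ.∣ s * + 2 ∣
  even-abs s = divides ℤ.∣ s ∣ (ℤ.abs-* s (+ 2))

  Gℤ≢0 : ∀ p q → ℕ.Coprime ℤ.∣ p ∣ ℤ.∣ q ∣ → Gℤ p q ≢ + 0
  Gℤ≢0 p q cop with parity p | parity q
  ... | s , inj₁ refl | t , inj₁ refl = λ _ → contradiction (cop (even-abs s , even-abs t)) λ ()
  ... | s , inj₁ refl | t , inj₂ refl = odd≢0
    (let q = + 1 + t * + 2 in
     + 4 * s * s * s + + 2 * m * s * s * q + - ((m + + 3) * s * q * q) + cubeℤ t)
    (solve 3 (λ m s t → Gᴾ m (even s) (odd t) := odd
      (con (+ 4) :* s :* s :* s :+ con (+ 2) :* m :* s :* s :* odd t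
       :+ :- ((m :+ con (+ 3)) :* s :* odd t :* odd t) :+ cube t)) refl m s t)
  ... | s , inj₂ refl | t , inj₁ refl = odd≢0
    (let p = + 1 + s * + 2 in
     cubeℤ s + m * p * p * t + - (+ 2 * (m + + 3) * p * t * t) + + 4 * t * t * t)
    (solve 3 (λ m s t → Gᴾ m (odd s) (even t) := odd
      (cube s :+ m :* odd s :* odd s :* t
       :+ :- (con (+ 2) :* (m :+ con (+ 3)) :* odd s :* t :* t)
       :+ con (+ 4) :* t :* t :* t)) refl m s t)
  ... | s , inj₂ refl | t , inj₂ refl = odd≢0
    (let p = + 1 + s * + 2; q = + 1 + t * + 2 in
     -[1+ 0 ] + cubeℤ s + cubeℤ t + m * p * q * (s + - t)
     + - (+ 3 * (s + p * (+ 2 * t * t + + 2 * t))))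
    (solve 3 (λ m s t → Gᴾ m (odd s) (odd t) := odd
      (con (-[1+ 0 ]) :+ cube s :+ cube t :+ m :* odd s :* odd t :* (s :+ :- t)
       :+ :- (con (+ 3) :* (s :+ odd s :* (con (+ 2) :* t :* t :+ con (+ 2) :* t)))))
      refl m s t)

  open CubicRing (fromℤ m) using (G; G-homogeneous)

  fromℤ-G : ∀ p q → fromℤ (Gℤ p q) ≡ G (fromℤ p) (fromℤ q)
  fromℤ-G p q
    rewrite fromℤ-+ (p * p * p + m * p * p * q + - ((m + + 3) * p * q * q)) (q * q * q)
          | fromℤ-+ (p * p * p + m * p * p * q) (- ((m + + 3) * p * q * q))
          | fromℤ-+ (p * p * p) (m * p * p * q)
          | fromℤ-neg ((m + + 3) * p * q * q)
          | fromℤ-* (p * p) p | fromℤ-* p p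
          | fromℤ-* (q * q) q | fromℤ-* q q
          | fromℤ-* (m * p * p) q | fromℤ-* (m * p) p | fromℤ-* m p
          | fromℤ-* ((m + + 3) * p * q) q | fromℤ-* ((m + + 3) * p) q | fromℤ-* (m + + 3) p
          | fromℤ-+ m (+ 3)
          = refl

  numerator-denominator : ∀ r → fromℤ (ℚ.↥ r) ≡ r ℚ.* fromℤ (ℚ.↧ r)
  numerator-denominator r@record{} = ℚ.toℚᵘ-injective (begin
    ℚ.toℚᵘ (fromℤ (ℚ.↥ r))                    ≈⟨ toℚᵘ-fromℤ (ℚ.↥ r) ⟩
    ℚᵘ.mkℚᵘ (ℚ.↥ r) 0                         ≈⟨ ℚᵘ.*≡* (trans
      (cong (λ k → ℚ.↥ r * + k) (ℕ.*-identityʳ (ℚ.↧ₙ r)))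
      (sym (ℤ.*-identityʳ (ℚ.↥ r * ℚ.↧ r)))) ⟩
    ℚ.toℚᵘ r ℚᵘ.* ℚᵘ.mkℚᵘ (ℚ.↧ r) 0           ≈⟨ ℚᵘ.*-congˡ {ℚ.toℚᵘ r} (toℚᵘ-fromℤ (ℚ.↧ r)) ⟨
    ℚ.toℚᵘ r ℚᵘ.* ℚ.toℚᵘ (fromℤ (ℚ.↧ r))      ≈⟨ ℚ.toℚᵘ-homo-* r (fromℤ (ℚ.↧ r)) ⟨
    ℚ.toℚᵘ (r ℚ.* fromℤ (ℚ.↧ r))              ∎)
    where open import Relation.Binary.Reasoning.Setoid ℚᵘ.≃-setoid

  noRoot : ∀ a b → b ≢ 0ℚ → G a b ≢ 0ℚ
  noRoot a b b≢0 Gab≡0 = Gℤ≢0 (ℚ.↥ r) (ℚ.↧ r) (coprime r) (fromℤ-injective (begin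
    fromℤ (Gℤ (ℚ.↥ r) (ℚ.↧ r))        ≡⟨ fromℤ-G (ℚ.↥ r) (ℚ.↧ r) ⟩
    G (fromℤ (ℚ.↥ r)) d               ≡⟨ cong₂ G num den ⟩
    G (a ℚ.* k) (b ℚ.* k)             ≡⟨ G-homogeneous a b k ⟩
    k ℚ.* k ℚ.* k ℚ.* G a b           ≡⟨ cong (k ℚ.* k ℚ.* k ℚ.*_) Gab≡0 ⟩
    k ℚ.* k ℚ.* k ℚ.* 0ℚ              ≡⟨ ℚ.*-zeroʳ (k ℚ.* k ℚ.* k) ⟩
    0ℚ                                ∎))
    where
    open ≡-Reasoning
    instance _ = ℚ.≢-nonZero b≢0
    r d k : ℚ
    r = a ℚ.÷ b
    d = fromℤ (ℚ.↧ r)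
    k = ℚ.1/ b ℚ.* d
    num : fromℤ (ℚ.↥ r) ≡ a ℚ.* k
    num = trans (numerator-denominator r) (ℚ.*-assoc a (ℚ.1/ b) d)
    den : d ≡ b ℚ.* k
    den = sym (trans (sym (ℚ.*-assoc b (ℚ.1/ b) d))
      (trans (cong (ℚ._* d) (ℚ.*-inverseʳ b)) (ℚ.*-identityˡ d)))
    coprime : ∀ r → ℕ.Coprime ℤ.∣ ℚ.↥ r ∣ ℤ.∣ ℚ.↧ r ∣
    coprime (ℚ.mkℚ _ _ cop) = ℕ.recompute cop

-- The field ℚ[x]/(l m), with ℚ-basis 1, ρ, ρ², where ρ is the class of x.
L : ℤ → NumberField
L m = record
  { commutativeRing = commutativeRing
  ; 0≉1             = λ ()
  ; inverse         = Inverse.inverse (noRoot m)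
  ; ι               = const
  ; ι-hom           = const-hom
  ; degree          = 3
  ; basis           = powers
  ; coord           = coordinates
  ; spanning        = λ u → sym (expand (c₀ u) (c₁ u) (c₂ u))
  ; independent     = λ c eq → λ
      { 0F → cong c₀ (trans (sym (expand (c 0F) (c 1F) (c 2F))) eq)
      ; 1F → cong c₁ (trans (sym (expand (c 0F) (c 1F) (c 2F))) eq)
      ; 2F → cong c₂ (trans (sym (expand (c 0F) (c 1F) (c 2F))) eq)
      }
  }
  where
  open CubicRing (fromℤ m)
  open Cubic

ρ-root : ∀ m → evalℤ (L m) (l m) (CubicRing.ρ (fromℤ m)) ≡ CubicRing.const (fromℤ m) 0ℚ
ρ-root m = trans
  (cong₂ (λ b c → const (ℚ.- 1ℚ) ⊕ ρ ⊗ (const b ⊕ ρ ⊗ (const c ⊕ ρ ⊗ (const 1ℚ ⊕ ρ ⊗ const 0ℚ))))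
    (trans (fromℤ-neg (m ℤ.+ + 3)) (cong ℚ.-_ (fromℤ-+ m (+ 3)))) (fromℤ-neg m))
  horner-cubic
  where open CubicRing (fromℤ m)

eval-constant : ∀ m a → evalℚ (L m) (a ∷ []) (CubicRing.ρ (fromℤ m)) ≡ CubicRing.const (fromℤ m) a
eval-constant m a = trans
  (cong (const a ⊕_) (CommutativeRing.zeroʳ commutativeRing ρ))
  (CommutativeRing.+-identityʳ commutativeRing (const a))
  where open CubicRing (fromℤ m)

eval-quadratic : ∀ m a b c →
  evalℚ (L m) (a ∷ b ∷ c ∷ []) (CubicRing.ρ (fromℤ m)) ≡ ⟨ a , b , c ⟩
eval-quadratic m = CubicRing.horner-quadratic (fromℤ m)

ρ-primitive : ∀ m → Primitive (L m) (CubicRing.ρ (fromℤ m))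
ρ-primitive m u@(⟨ a , b , c ⟩) = (a ∷ b ∷ c ∷ []) , (1ℚ ∷ [])
  , (λ eq → 0≢1 (trans (sym eq) (eval-constant m 1ℚ)))
  , trans (cong (u ⊗_) (eval-constant m 1ℚ))
      (trans (CommutativeRing.*-identityʳ commutativeRing u) (sym (eval-quadratic m a b c)))
  where
  open CubicRing (fromℤ m)
  0≢1 : const 0ℚ ≢ const 1ℚ
  0≢1 ()

{-# OPTIONS --safe #-}

-- Write 𝔸 for the ring of integers of L m and σ for the automorphism of order three.
--
-- If x ∈ 𝔸 has norm n and e = σx·σ²x, then e·σe ≡ 0 modulo n, so e is up to a factor an
-- idempotent modulo n, and the eigenvalue of ρ on it is a root of l m modulo n.  As l m
-- has no root modulo 2, the values F_θ(0) and F_θ(1) are never both even; with the third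
-- difference 3! = 6 of F_θ this gives i(θ) ∣ 3.  If 3 divides all values of F_θ, then
-- applying the same to x = θ⁴ gives a root of l m modulo 81, and this forces
-- m ≡ 39 modulo 81.  Conversely, for such m the integer θ = (ρ − m/3)/3 has
-- F_θ ≡ X³ − X modulo 3.
--
-- For the indices, choose a ℤ-basis 1, α, β of 𝔸 with αβ ∈ ℤ.  The index of xα + yβ is
-- the absolute value of a binary cubic form.  Its values at primitive (x, y) are odd,
-- since an element of even norm lies in 2𝔸, and its coefficients have no common divisor
-- g > 1, since otherwise α/g would be integral.  So the indices of α, β and α ± β are
-- coprime.
module Submission where

open import Defs
open import Algebra.Bundles using (CommutativeRing; RawRing)
open import Algebra.Morphism.Structures using (module RingMorphisms)
import Algebra.Properties.Group as GroupProperties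
import Algebra.Properties.Semiring.Exp as SemiringExp
import Algebra.Solver.Ring as RingSolver
import Algebra.Solver.Ring.AlmostCommutativeRing as ACR
open import Algebra.Structures using (IsCommutativeRing)
open import Data.Bool.Base using (if_then_else_)
open import Data.Empty using (⊥)
open import Data.Fin.Base using (Fin; zero; suc; toℕ; fromℕ<; punchIn)
open import Data.Fin.Patterns using (0F; 1F; 2F; 3F; 4F; 5F)
import Data.Fin.Properties as Fin
open import Data.Integer.Base as ℤ using (ℤ; +_; -[1+_])
open import Data.Integer.Divisibility.Signed as ℤ using (_∣_; divides; _∣?_)
import Data.Integer.DivMod as ℤ
import Data.Integer.Properties as ℤ
import Data.Integer.Solver as ℤSolver
open import Data.List.Base using (List; []; _∷_; _∷ʳ_)
import Data.Maybe.Base as Maybe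
open import Data.Nat.Base as ℕ using (ℕ; zero; suc)
import Data.Nat.Coprimality as ℕ
import Data.Nat.Divisibility as ℕ
import Data.Nat.DivMod as ℕ
import Data.Nat.GCD as ℕ
import Data.Nat.Induction as ℕ
open import Data.Nat.Primality using (prime?; prime⇒irreducible)
import Data.Nat.Properties as ℕ
open import Data.Product.Base using (∃; ∃₂; _×_; _,_; proj₁; proj₂)
open import Data.Rational.Base as ℚ using (ℚ; 0ℚ; 1ℚ)
import Data.Rational.Properties as ℚ
import Data.Rational.Solver as ℚSolver
open import Data.Sum.Base as Sum using (_⊎_; inj₁; inj₂; [_,_]′)
open import Data.Unit.Base using (⊤; tt)
open import Data.Vec.Base using (Vec; []; _∷_; map; lookup)
open import Data.Vec.Properties using (lookup-map)
open import Data.Vec.Relation.Binary.Pointwise.Inductive as Pointwise using (Pointwise; []; _∷_)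
open import Function.Base using (_∘_; id)
open import Induction.WellFounded using (Acc; acc)
open import Level using (0ℓ)
open import Relation.Binary.PropositionalEquality
open import Relation.Nullary using (Dec; yes; no; ¬_; does; contradiction)
open import Relation.Nullary.Decidable
  using (True; toWitness; from-yes; dec⇒maybe; decidable-stable; map′; _→-dec_)

-- Integrality is handled through `AlmostIntegral`: one nonzero integer multiplies every power of x
-- into ℤ[ρ]. Unlike a monic equation this passes directly to sums, products and conjugates, so
-- traces, second symmetric functions and norms are rational and almost integral, hence integers.
-- Divisibility k ∣ n in ℤ is then proved by writing n = k x with x almost integral. Prime
-- decomposition is seen only through roots of `l m` modulo a norm.
--
-- A root modulo 3 would give only 3 ∣ m; the fourth power supplies the exponent for a condition
-- modulo 81. The residues 39, 120, 201 modulo 243 are the lifts of 39 modulo 81.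
--
-- The integral basis comes from elements with least leading coefficient; the inclusion δ𝔸 ⊆ ℤ[ρ]
-- with δ = m² + 3m + 9 makes these coefficients integers. Membership in 𝔸 is not decided, so the
-- basis exists only under a double negation, which is harmless because the final claim g ∣ 1 is
-- decidable. That δ is odd also lets even traces imply divisibility by 2 in 𝔸.

-- Congruences modulo n, decided on residues

module Modular (n : ℕ) .{{_ : ℕ.NonZero n}} where
  open ℤSolver.+-*-Solver
  open import Data.Integer.Base using (_+_; _*_; -_; _-_)

  infix 4 _≋_
  -- A record instead of the bare divisibility keeps both sides visible to unification.
  record _≋_ (a b : ℤ) : Set where
    constructor congruent
    field divisible : + n ∣ a - b
  open _≋_

  ≋-sym : ∀ {a b} → a ≋ b → b ≋ a
  ≋-sym {a} {b} (congruent p) = congruent (subst (+ n ∣_)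
    (ℤSolver.+-*-Solver.solve 2 (λ a b → :- (a :- b) := b :- a) refl a b) (ℤ.∣m⇒∣-m p))

  residue : ℤ → Fin n
  residue a = fromℕ< (ℤ.n%ℕd<d a n)

  residue-≋ : ∀ a → a ≋ + toℕ (residue a)
  residue-≋ a = congruent (divides (a ℤ./ℕ n) (begin
    a - + toℕ (residue a)
      ≡⟨ cong₂ (λ x y → x - + y) (ℤ.a≡a%ℕn+[a/ℕn]*n a n) (Fin.toℕ-fromℕ< (ℤ.n%ℕd<d a n)) ⟩
    + (a ℤ.%ℕ n) + (a ℤ./ℕ n) * + n - + (a ℤ.%ℕ n)
      ≡⟨ solve 2 (λ r q → r :+ q :- r := q) refl (+ (a ℤ.%ℕ n)) ((a ℤ./ℕ n) * + n) ⟩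
    (a ℤ./ℕ n) * + n ∎))
    where open ≡-Reasoning

  +-cong-≋ : ∀ {a b c d} → a ≋ b → c ≋ d → a + c ≋ b + d
  +-cong-≋ {a} {b} {c} {d} (congruent p) (congruent q) = congruent (subst (+ n ∣_)
    (solve 4 (λ a b c d → (a :- b) :+ (c :- d) := (a :+ c) :- (b :+ d)) refl a b c d)
    (ℤ.∣m∣n⇒∣m+n p q))

  *-cong-≋ : ∀ {a b c d} → a ≋ b → c ≋ d → a * c ≋ b * d
  *-cong-≋ {a} {b} {c} {d} (congruent p) (congruent q) = congruent (subst (+ n ∣_)
    (solve 4 (λ a b c d → (a :- b) :* c :+ b :* (c :- d) := a :* c :- b :* d) refl a b c d)
    (ℤ.∣m∣n⇒∣m+n (ℤ.∣m⇒∣m*n c p) (ℤ.∣n⇒∣m*n b q)))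

  neg-cong-≋ : ∀ {a b} → a ≋ b → - a ≋ - b
  neg-cong-≋ {a} {b} (congruent p) = congruent (subst (+ n ∣_)
    (solve 2 (λ a b → :- (a :- b) := (:- a) :- (:- b)) refl a b) (ℤ.∣m⇒∣-m p))

  ≋-refl : ∀ {a} → a ≋ a
  ≋-refl {a} = congruent (divides (+ 0) (ℤ.+-inverseʳ a))

  ∣-resp-≋ : ∀ {a b} → a ≋ b → + n ∣ a → + n ∣ b
  ∣-resp-≋ {a} {b} (congruent p) q = subst (+ n ∣_)
    (solve 2 (λ a b → a :- (a :- b) := b) refl a b) (ℤ.∣m∣n⇒∣m-n q p)

  ⟦⟧-cong : ∀ {k} (p : Polynomial k) {v w} → Pointwise _≋_ v w → ⟦ p ⟧ v ≋ ⟦ p ⟧ w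
  ⟦⟧-cong (op [+] p q) v≋w = +-cong-≋ (⟦⟧-cong p v≋w) (⟦⟧-cong q v≋w)
  ⟦⟧-cong (op [*] p q) v≋w = *-cong-≋ (⟦⟧-cong p v≋w) (⟦⟧-cong q v≋w)
  ⟦⟧-cong (con c) v≋w = ≋-refl
  ⟦⟧-cong (var x) v≋w = Pointwise.lookup v≋w x
  ⟦⟧-cong (p :^ zero) v≋w = ≋-refl
  ⟦⟧-cong (p :^ suc e) v≋w = *-cong-≋ (⟦⟧-cong p v≋w) (⟦⟧-cong (p :^ e) v≋w)
  ⟦⟧-cong (:- p) v≋w = neg-cong-≋ (⟦⟧-cong p v≋w)

  infix  6 n∣_
  infixr 5 _⇛_
  -- Implication and absurdity allow hypotheses, also negated or conditional ones, to be part of the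
  -- statement that is checked on residues.
  data Formula (k : ℕ) : Set where
    n∣_ : Polynomial k → Formula k
    _⇛_ : Formula k → Formula k → Formula k
    ⊥ᶠ  : Formula k

  _⊨_ : ∀ {k} → Vec ℤ k → Formula k → Set
  v ⊨ (n∣ p)  = + n ∣ ⟦ p ⟧ v
  v ⊨ (φ ⇛ ψ) = v ⊨ φ → v ⊨ ψ
  v ⊨ ⊥ᶠ      = ⊥

  -- The premise of an implication is transported backwards, which symmetry of the congruence
  -- permits.
  ⊨-resp-≋ : ∀ {k} (φ : Formula k) {v w} → Pointwise _≋_ v w → v ⊨ φ → w ⊨ φ
  ⊨-resp-≋ (n∣ p) v≋w p∣ = ∣-resp-≋ (⟦⟧-cong p v≋w) p∣
  ⊨-resp-≋ (φ ⇛ ψ) v≋w f x = ⊨-resp-≋ ψ v≋w (f (⊨-resp-≋ φ (Pointwise.sym ≋-sym v≋w) x))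

  _⊨?_ : ∀ {k} (v : Vec ℤ k) φ → Dec (v ⊨ φ)
  v ⊨? (n∣ p)  = + n ∣? ⟦ p ⟧ v
  v ⊨? (φ ⇛ ψ) = (v ⊨? φ) →-dec (v ⊨? ψ)
  v ⊨? ⊥ᶠ      = no id

  residues? : ∀ {k} {P : Vec ℤ k → Set} → (∀ v → Dec (P v)) →
              Dec (∀ (v : Vec (Fin n) k) → P (map (+_ ∘ toℕ) v))
  residues? {zero} P? = map′ (λ p → λ { [] → p }) (λ f → f []) (P? [])
  residues? {suc k} P? = map′ (λ f → λ { (i ∷ v) → f i v }) (λ f i v → f (i ∷ v))
    (Fin.all? λ i → residues? {k} (λ v → P? (+ toℕ i ∷ v)))

  -- Abstract, because unfolding the exhaustive check in later goals is prohibitively slow.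
  abstract
    valid : ∀ {k} (φ : Formula k) {_ : True (residues? (_⊨? φ))} → ∀ v → v ⊨ φ
    valid φ {t} v = ⊨-resp-≋ φ (close v) (toWitness t (map residue v))
      where
      close : ∀ {k} (v : Vec ℤ k) → Pointwise _≋_ (map (+_ ∘ toℕ) (map residue v)) v
      close [] = []
      close (a ∷ v) = ≋-sym (residue-≋ a) ∷ close v

-- Integer arithmetic

module Arithmetic where
  module _ where
    open import Data.Nat.Base using (_*_; _^_; _<_)

    coprime-divisor-^ : ∀ {a b} D i → ℕ.Coprime a b → a ℕ.∣ b ^ i * D → a ℕ.∣ D
    coprime-divisor-^ D zero    cop a∣ = subst (_ ℕ.∣_) (ℕ.*-identityˡ D) a∣
    coprime-divisor-^ {a} {b} D (suc i) cop a∣ = coprime-divisor-^ D i cop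
      (ℕ.coprime-divisor cop (subst (a ℕ.∣_) (ℕ.*-assoc b (b ^ i) D) a∣))

    -- Coprimality moves a factor a into D; it can then be cancelled from D and from every power, so
    -- a > 1 would give an infinite descent on D. The exponent of b is left free because the
    -- cancellation shifts j.
    coprime-powers-divide : ∀ {a b} D → Acc _<_ D → a ≢ 0 → D ≢ 0 → ℕ.Coprime a b →
      (∀ j → ∃ λ i → a ^ j ℕ.∣ b ^ i * D) → a ≡ 1
    coprime-powers-divide {0} D _ a≢0 _ _ _ = contradiction refl a≢0
    coprime-powers-divide {1} D _ _ _ _ _ = refl
    coprime-powers-divide {a@(suc (suc _))} {b} D (acc rec) a≢0 D≢0 cop powers
      with powers 1
    ... | i , a∣ with coprime-divisor-^ D i cop (subst (ℕ._∣ b ^ i * D) (ℕ.*-identityʳ a) a∣)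
    ... | ℕ.divides q refl = coprime-powers-divide q (rec (ℕ.m<m*n q a (ℕ.s≤s (ℕ.s≤s ℕ.z≤n)))) a≢0 q≢0 cop
          λ j → let i , h = powers (suc j) in i , ℕ.*-cancelˡ-∣ a (subst (a * a ^ j ℕ.∣_)
            (trans (sym (ℕ.*-assoc (b ^ i) q a)) (ℕ.*-comm (b ^ i * q) a)) h)
      where
      q≢0 : q ≢ 0
      q≢0 refl = D≢0 refl
      instance _ = ℕ.≢-nonZero q≢0

    ^-distribʳ-* : ∀ x y j → (x * y) ^ j ≡ x ^ j * y ^ j
    ^-distribʳ-* x y zero    = refl
    ^-distribʳ-* x y (suc j) = trans (cong (x * y *_) (^-distribʳ-* x y j))
      (ℕ.[m*n]*[o*p]≡[m*o]*[n*p] x y (x ^ j) (y ^ j))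

    -- If all powers of b/a have the common denominator D, then b/a is an integer. Division by the
    -- gcd reduces this to coprime a and b.
    powers-divide : ∀ a b D → a ≢ 0 → D ≢ 0 → (∀ j → a ^ j ℕ.∣ b ^ j * D) → a ℕ.∣ b
    powers-divide a b D a≢0 D≢0 powers = subst (ℕ._∣ b) (sym a≡g) (ℕ.gcd[m,n]∣n a b)
      where
      g = ℕ.gcd a b
      g≢0 : g ≢ 0
      g≢0 = ℕ.gcd[m,n]≢0 a b (inj₁ a≢0)
      instance _ = ℕ.≢-nonZero g≢0
      a′ = a ℕ./ g
      b′ = b ℕ./ g
      a≡ : a ≡ g * a′
      a≡ = sym (ℕ.m*[n/m]≡n (ℕ.gcd[m,n]∣m a b))
      b≡ : b ≡ g * b′
      b≡ = sym (ℕ.m*[n/m]≡n (ℕ.gcd[m,n]∣n a b))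
      a′≢0 : a′ ≢ 0
      a′≢0 eq = a≢0 (trans a≡ (trans (cong (g *_) eq) (ℕ.*-zeroʳ g)))
      reduced : ∀ j → a′ ^ j ℕ.∣ b′ ^ j * D
      reduced j = ℕ.*-cancelˡ-∣ (g ^ j) {{ℕ.m^n≢0 g j}} (subst₂ ℕ._∣_
        (trans (cong (_^ j) a≡) (^-distribʳ-* g a′ j))
        (trans (cong (λ t → t ^ j * D) b≡) (trans (cong (_* D) (^-distribʳ-* g b′ j)) (ℕ.*-assoc (g ^ j) (b′ ^ j) D)))
        (powers j))
      a≡g : a ≡ g
      a≡g = trans a≡ (trans (cong (g *_)
        (coprime-powers-divide D (ℕ.<-wellFounded D) a′≢0 D≢0 (ℕ.coprime-/gcd a b) λ j → j , reduced j))
        (ℕ.*-identityʳ g))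

  open import Data.Integer.Base using (_+_; _*_; -_; _-_; _^_)
  open ℤSolver.+-*-Solver

  *-≢0 : ∀ {i j} → i ≢ + 0 → j ≢ + 0 → i * j ≢ + 0
  *-≢0 {i} i≢0 j≢0 eq = [ i≢0 , j≢0 ]′ (ℤ.i*j≡0⇒i≡0∨j≡0 i eq)

  denominator≢0 : ∀ q → ℚ.↧ q ≢ + 0
  denominator≢0 (ℚ.mkℚ _ _ _) ()

  abs-^ : ∀ x j → ℤ.∣ x ^ j ∣ ≡ ℤ.∣ x ∣ ℕ.^ j
  abs-^ x zero    = refl
  abs-^ x (suc j) = trans (ℤ.abs-* x (x ^ j)) (cong (ℤ.∣ x ∣ ℕ.*_) (abs-^ x j))

  powers-divideℤ : ∀ k n D → k ≢ + 0 → D ≢ + 0 → (∀ j → k ^ j ∣ D * n ^ j) → k ∣ n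
  powers-divideℤ k n D k≢0 D≢0 powers = ℤ.∣ᵤ⇒∣ (powers-divide ℤ.∣ k ∣ ℤ.∣ n ∣ ℤ.∣ D ∣
    (k≢0 ∘ ℤ.∣i∣≡0⇒i≡0) (D≢0 ∘ ℤ.∣i∣≡0⇒i≡0)
    λ j → subst₂ ℕ._∣_ (abs-^ k j)
      (trans (ℤ.abs-* D (n ^ j)) (trans (cong (ℤ.∣ D ∣ ℕ.*_) (abs-^ n j)) (ℕ.*-comm ℤ.∣ D ∣ _)))
      (ℤ.∣⇒∣ᵤ (powers j)))

  -- Congruences modulo 2 and 3 for `l m` and for characteristic polynomials

  module Mod2 = Modular 2
  module Mod3 = Modular 3

  -- w³ l_m(r/w)
  H : ℤ → ℤ → ℤ → ℤ
  H m r w = r * r * r - m * r * r * w - (m + + 3) * r * w * w - w * w * w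

  module _ {k : ℕ} (m r w : Polynomial k) where
    Hᴾ : Polynomial k
    Hᴾ = r :* r :* r :- m :* r :* r :* w :- (m :+ con (+ 3)) :* r :* w :* w :- w :* w :* w

  -- l_m has no root modulo 2.
  even-form : ∀ m r w → + 2 ∣ H m r w * w → + 2 ∣ w
  even-form m r w = Mod2.valid (Mod2.n∣ Hᴾ (var 0F) (var 1F) (var 2F) :* var 2F Mod2.⇛ Mod2.n∣ var 2F)
    (m ∷ r ∷ w ∷ [])

  cancel-3 : ∀ x u → ¬ + 3 ∣ u → + 3 ∣ x * u → + 3 ∣ x
  cancel-3 x u = Mod3.valid ((Mod3.n∣ var 1F Mod3.⇛ Mod3.⊥ᶠ) Mod3.⇛ Mod3.n∣ var 0F :* var 1F Mod3.⇛ Mod3.n∣ var 0F)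
    (x ∷ u ∷ [])

  cancel-pow3 : ∀ e x u → ¬ + 3 ∣ u → (+ 3) ^ e ∣ x * u → (+ 3) ^ e ∣ x
  cancel-pow3 zero    x u 3∤u p = divides x (sym (ℤ.*-identityʳ x))
  cancel-pow3 (suc e) x u 3∤u p with cancel-3 x u 3∤u (ℤ.∣-trans (ℤ.∣m⇒∣m*n {+ 3} {+ 3} ((+ 3) ^ e) ℤ.∣-refl) p)
  ... | divides y refl = subst (+ 3 * (+ 3) ^ e ∣_) (ℤ.*-comm (+ 3) y) (ℤ.*-monoʳ-∣ (+ 3) {(+ 3) ^ e} {y}
    (cancel-pow3 e y u 3∤u (ℤ.*-cancelˡ-∣ (+ 3) {(+ 3) ^ e} {y * u} (subst (+ 3 * (+ 3) ^ e ∣_)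
      (solve 2 (λ y u → y :* con (+ 3) :* u := con (+ 3) :* (y :* u)) refl y u) p))))

  -- Modulo 3 the form H m r w is (r − w)³ − m r w (r + w), so r = w + 3s; then
  -- H 39 r w ≡ 27 s (s² − w²) ≡ 0 modulo 81, and H is affine in m.
  root-mod-81 : ∀ m r w → ¬ + 3 ∣ w → + 81 ∣ H m r w * w → + 81 ∣ m - + 39
  root-mod-81 m r w 3∤w 81∣Hw = cancel-pow3 4 (m - + 39) u 3∤u
    (divides (z - qH * (w * w)) (begin
      (m - + 39) * u ≡⟨ cong (λ r → (m - + 39) * (r * w * w * w * (r + w))) r≡ ⟩
      (m - + 39) * (r′ * w * w * w * (r′ + w))
        ≡⟨ solve 3 (λ m w s → let r = w :+ s :* con (+ 3) in
             (m :- con (+ 39)) :* (r :* w :* w :* w :* (r :+ w)) :=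
             con (+ 81) :* ((:- (w :* w :* w) :- con (+ 4) :* w :* w :* s :- con (+ 4) :* w :* s :* s) :* (w :* w))
             :+ con (+ 27) :* (w :* w :* (s :* s :* s) :- w :* w :* w :* w :* s)
             :- Hᴾ m r w :* (w :* w)) refl m w s ⟩
      + 81 * y + + 27 * (w * w * (s * s * s) - w * w * w * w * s) - H m r′ w * (w * w)
        ≡⟨ cong₂ (λ p q → + 81 * y + + 27 * p - q * (w * w)) (_∣_.equality 3∣f)
             (trans (cong (λ r → H m r w) (sym r≡)) (_∣_.equality 81∣H)) ⟩
      + 81 * y + + 27 * (f * + 3) - qH * + 81 * (w * w)
        ≡⟨ solve 4 (λ y f q w → con (+ 81) :* y :+ con (+ 27) :* (f :* con (+ 3)) :- q :* con (+ 81) :* (w :* w)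
             := (y :+ f :- q :* (w :* w)) :* con (+ 81)) refl y f qH w ⟩
      (z - qH * (w * w)) * + 81 ∎))
    where
    open ≡-Reasoning
    81∣H : + 81 ∣ H m r w
    81∣H = cancel-pow3 4 (H m r w) w 3∤w 81∣Hw
    3∣r-w : + 3 ∣ r - w
    3∣r-w = Mod3.valid (Mod3.n∣ Hᴾ (var 0F) (var 1F) (var 2F) Mod3.⇛ Mod3.n∣ var 1F :- var 2F)
      (m ∷ r ∷ w ∷ []) (ℤ.∣-trans (divides (+ 27) refl) 81∣H)
    s = _∣_.quotient 3∣r-w
    r′ = w + s * + 3
    r≡ : r ≡ r′
    r≡ = trans (solve 2 (λ r w → r := w :+ (r :- w)) refl r w) (cong (λ t → w + t) (_∣_.equality 3∣r-w))
    3∣f : + 3 ∣ w * w * (s * s * s) - w * w * w * w * s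
    3∣f = Mod3.valid (Mod3.n∣ var 0F :* var 0F :* (var 1F :* var 1F :* var 1F)
      :- var 0F :* var 0F :* var 0F :* var 0F :* var 1F) (w ∷ s ∷ [])
    f = _∣_.quotient 3∣f
    qH = _∣_.quotient 81∣H
    -- The coefficient of m in H is -r w (r + w). The further factor w² makes w² s (s² - w²)
    -- divisible by 3 for all w and s. As r ≡ w modulo 3, u ≡ 2 w⁵.
    u = r * w * w * w * (r + w)
    3∤u : ¬ + 3 ∣ u
    3∤u 3∣u = 3∤w (Mod3.valid
      (Mod3.n∣ var 0F :- var 1F Mod3.⇛ Mod3.n∣ var 0F :* var 1F :* var 1F :* var 1F :* (var 0F :+ var 1F) Mod3.⇛ Mod3.n∣ var 1F)
      (r ∷ w ∷ []) 3∣r-w 3∣u)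
    y = (- (w * w * w) - + 4 * w * w * s - + 4 * w * s * s) * (w * w)
    z = y + f

  module _ {k : ℕ} (t s n z : Polynomial k) where
    χᴾ : Polynomial k
    χᴾ = z :* z :* z :- t :* z :* z :+ s :* z :- n

  χ : ℤ → ℤ → ℤ → ℤ → ℤ
  χ t s n z = z * z * z - t * z * z + s * z - n

  private
    t₃ s₃ n₃ : Polynomial 3
    t₃ = var 0F
    s₃ = var 1F
    n₃ = var 2F

  -- The hypothesis on n − s + t − 1 and s − 2t + 3 concerns the same coefficients
  -- for the roots shifted by one.
  s-even⇒t-even : ∀ t s n → + 2 ∣ n → + 2 ∣ s → (+ 2 ∣ n - s + t - + 1 → + 2 ∣ s - + 2 * t + + 3) → + 2 ∣ t
  s-even⇒t-even t s n = Mod2.valid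
    (Mod2.n∣ n₃ Mod2.⇛ Mod2.n∣ s₃ Mod2.⇛
     (Mod2.n∣ n₃ :- s₃ :+ t₃ :- con (+ 1) Mod2.⇛ Mod2.n∣ s₃ :- con (+ 2) :* t₃ :+ con (+ 3)) Mod2.⇛ Mod2.n∣ t₃)
    (t ∷ s ∷ n ∷ [])

  -- If -n, the value at 0, is even, then s and t are even too, and the value 1 - t + s - n at 1 is
  -- odd.
  χ-even : ∀ t s n → (+ 2 ∣ n → + 2 ∣ s) → (+ 2 ∣ n → + 2 ∣ t) → + 2 ∣ χ t s n (+ 0) → ¬ + 2 ∣ χ t s n (+ 1)
  χ-even t s n = Mod2.valid
    ((Mod2.n∣ n₃ Mod2.⇛ Mod2.n∣ s₃) Mod2.⇛ (Mod2.n∣ n₃ Mod2.⇛ Mod2.n∣ t₃) Mod2.⇛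
     Mod2.n∣ χᴾ t₃ s₃ n₃ (con (+ 0)) Mod2.⇛ Mod2.n∣ χᴾ t₃ s₃ n₃ (con (+ 1)) Mod2.⇛ Mod2.⊥ᶠ)
    (t ∷ s ∷ n ∷ [])

  χ-three-n : ∀ t s n → + 3 ∣ χ t s n (+ 0) → + 3 ∣ n
  χ-three-n t s n = Mod3.valid (Mod3.n∣ χᴾ t₃ s₃ n₃ (con (+ 0)) Mod3.⇛ Mod3.n∣ n₃) (t ∷ s ∷ n ∷ [])

  -- A monic cubic that vanishes on all residues modulo 3 is X³ - X, so s ≡ -1.
  χ-three-s : ∀ t s n → + 3 ∣ χ t s n (+ 0) → + 3 ∣ χ t s n (+ 1) → + 3 ∣ χ t s n -[1+ 0 ] → ¬ + 3 ∣ s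
  χ-three-s t s n = Mod3.valid
    (Mod3.n∣ χᴾ t₃ s₃ n₃ (con (+ 0)) Mod3.⇛ Mod3.n∣ χᴾ t₃ s₃ n₃ (con (+ 1)) Mod3.⇛
     Mod3.n∣ χᴾ t₃ s₃ n₃ (con -[1+ 0 ]) Mod3.⇛ Mod3.n∣ s₃ Mod3.⇛ Mod3.⊥ᶠ)
    (t ∷ s ∷ n ∷ [])

  -- The third difference of a monic cubic is 3!.
  χ-divisor : ∀ t s n g → ¬ + 2 ∣ g → (∀ z → g ∣ χ t s n z) → g ∣ + 3
  χ-divisor t s n g g-odd g∣ = divides q′ (ℤ.*-cancelʳ-≡ (+ 3) (q′ * g) (+ 2) (begin
    + 6           ≡⟨ _∣_.equality g∣6 ⟩
    q * g         ≡⟨ cong (_* g) (_∣_.equality 2∣q) ⟩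
    q′ * + 2 * g  ≡⟨ solve 2 (λ q g → q :* con (+ 2) :* g := q :* g :* con (+ 2)) refl q′ g ⟩
    q′ * g * + 2  ∎))
    where
    open ≡-Reasoning
    g∣6 : g ∣ + 6
    g∣6 = subst (g ∣_)
      (solve 3 (λ t s n → χᴾ t s n (con (+ 2)) :- con (+ 3) :* χᴾ t s n (con (+ 1))
          :+ con (+ 3) :* χᴾ t s n (con (+ 0)) :- χᴾ t s n (con -[1+ 0 ])
        := con (+ 6)) refl t s n)
      (ℤ.∣m∣n⇒∣m-n (ℤ.∣m∣n⇒∣m+n (ℤ.∣m∣n⇒∣m-n (g∣ (+ 2)) (ℤ.∣n⇒∣m*n (+ 3) (g∣ (+ 1))))
        (ℤ.∣n⇒∣m*n (+ 3) (g∣ (+ 0)))) (g∣ -[1+ 0 ]))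
    q = _∣_.quotient g∣6
    2∣q : + 2 ∣ q
    2∣q = Mod2.valid (Mod2.n∣ var 0F :* var 1F Mod2.⇛ (Mod2.n∣ var 1F Mod2.⇛ Mod2.⊥ᶠ) Mod2.⇛ Mod2.n∣ var 0F)
      (q ∷ g ∷ []) (subst (+ 2 ∣_) (_∣_.equality g∣6) (divides (+ 3) refl)) g-odd
    q′ = _∣_.quotient 2∣q

  fourth-power-81 : ∀ n → + 3 ∣ n → + 81 ∣ n * n * (n * n)
  fourth-power-81 n (divides q refl) = divides (q * q * (q * q))
    (solve 1 (λ q → let n = q :* con (+ 3) in n :* n :* (n :* n) := q :* q :* (q :* q) :* con (+ 81)) refl q)

  -- The expression is the coefficient s belonging to x⁴, obtained by squaring the roots twice.
  -- Since 3 ∣ n, it is congruent to s⁴.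
  fourth-power-s : ∀ t s n → + 3 ∣ n → ¬ + 3 ∣ s → let s² = s * s - + 2 * n * t in
    ¬ + 3 ∣ s² * s² - + 2 * (n * n) * (t * t - + 2 * s)
  fourth-power-s t s n 3∣n 3∤s 3∣s⁴ = 3∤s (Mod3.valid
    (Mod3.n∣ n₃ Mod3.⇛ Mod3.n∣ s² :* s² :- con (+ 2) :* (n₃ :* n₃) :* (t₃ :* t₃ :- con (+ 2) :* s₃) Mod3.⇛ Mod3.n∣ s₃)
    (t ∷ s ∷ n ∷ []) 3∣n 3∣s⁴)
    where s² = s₃ :* s₃ :- con (+ 2) :* n₃ :* t₃

  -- Here a ≡ 1 modulo 3, so the polynomial is X³ - X modulo 3.
  χ-split : ∀ u z → let a = + 61 + + 243 * u + + 243 * u * u; b = + 1 + + 2 * u in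
    + 3 ∣ χ (+ 0) (- a) (+ 3 * a * b) z
  χ-split u z = Mod3.valid (Mod3.n∣ χᴾ (con (+ 0)) (:- a) (con (+ 3) :* a :* b) (var 1F)) (u ∷ z ∷ [])
    where
    a b : Polynomial 2
    a = con (+ 61) :+ con (+ 243) :* var 0F :+ con (+ 243) :* var 0F :* var 0F
    b = con (+ 1) :+ con (+ 2) :* var 0F

  minus-39 : ∀ {m} u → m - + 39 ≡ u * + 81 → m ≡ + 39 + + 81 * u
  minus-39 {m} u eq = trans (solve 1 (λ m → m := con (+ 39) :+ (m :- con (+ 39))) refl m)
    (cong (λ v → + 39 + v) (trans eq (ℤ.*-comm u (+ 81))))

  -- With n odd, t s is odd, so t and s are both odd. The conclusion says that x - 1 has even norm.
  conjugate-parity : ∀ t s n → + 2 ∣ t * s - + 3 * n → ¬ + 2 ∣ n → + 2 ∣ n - s + t - + 1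
  conjugate-parity t s n = Mod2.valid
    (Mod2.n∣ t₃ :* s₃ :- con (+ 3) :* n₃ Mod2.⇛ (Mod2.n∣ n₃ Mod2.⇛ Mod2.⊥ᶠ) Mod2.⇛ Mod2.n∣ n₃ :- s₃ :+ t₃ :- con (+ 1))
    (t ∷ s ∷ n ∷ [])

  -- Writing a = 1 + 2j gives b = b a - j (2b).
  odd-divisor-of-double : ∀ {g a} b → ¬ + 2 ∣ a → g ∣ a → g ∣ + 2 * b → g ∣ b
  odd-divisor-of-double {g} {a} b a-odd g∣a g∣2b = subst (g ∣_) (begin
      b * a - j * (+ 2 * b)              ≡⟨ cong (λ a → b * a - j * (+ 2 * b)) a≡ ⟩
      b * (+ 1 + j * + 2) - j * (+ 2 * b)
        ≡⟨ solve 2 (λ b j → b :* (con (+ 1) :+ j :* con (+ 2)) :- j :* (con (+ 2) :* b) := b) refl b j ⟩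
      b ∎)
    (ℤ.∣m∣n⇒∣m-n (ℤ.∣n⇒∣m*n b g∣a) (ℤ.∣n⇒∣m*n j g∣2b))
    where
    open ≡-Reasoning
    2∣a-1 = Mod2.valid ((Mod2.n∣ var 0F Mod2.⇛ Mod2.⊥ᶠ) Mod2.⇛ Mod2.n∣ var 0F :- con (+ 1)) (a ∷ []) a-odd
    j = _∣_.quotient 2∣a-1
    a≡ : a ≡ + 1 + j * + 2
    a≡ = trans (solve 1 (λ a → a := con (+ 1) :+ (a :- con (+ 1))) refl a) (cong (λ v → + 1 + v) (_∣_.equality 2∣a-1))

  -- The hypotheses are on the values of a x³ + b x²y + c xy² + d y³ at (1,0), (0,1) and (1,±1).
  form-content : ∀ {g a d} b c → ¬ + 2 ∣ a → g ∣ a → g ∣ d →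
    g ∣ a + c - + 1 * b - + 1 * d → g ∣ a + c - -[1+ 0 ] * b - -[1+ 0 ] * d → g ∣ b × g ∣ c
  form-content {g} {a} {d} b c a-odd g∣a g∣d g∣u g∣v =
      odd-divisor-of-double b a-odd g∣a (subst (g ∣_)
        (solve 4 (λ a b c d → (a :+ c :- con -[1+ 0 ] :* b :- con -[1+ 0 ] :* d) :- (a :+ c :- con (+ 1) :* b :- con (+ 1) :* d) :- con (+ 2) :* d := con (+ 2) :* b) refl a b c d)
        (ℤ.∣m∣n⇒∣m-n (ℤ.∣m∣n⇒∣m-n g∣v g∣u) (ℤ.∣n⇒∣m*n (+ 2) g∣d)))
    , odd-divisor-of-double c a-odd g∣a (subst (g ∣_)
        (solve 4 (λ a b c d → (a :+ c :- con -[1+ 0 ] :* b :- con -[1+ 0 ] :* d) :+ (a :+ c :- con (+ 1) :* b :- con (+ 1) :* d) :- con (+ 2) :* a := con (+ 2) :* c) refl a b c d)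
        (ℤ.∣m∣n⇒∣m-n (ℤ.∣m∣n⇒∣m+n g∣v g∣u) (ℤ.∣n⇒∣m*n (+ 2) g∣a)))

  multiple-below : ∀ {t k} → t ℕ.∣ k → k ℕ.< t → k ≡ 0
  multiple-below {t} {zero}  _   _   = refl
  multiple-below {t} {suc k} t∣k k<t = contradiction t∣k (ℕ.>⇒∤ k<t)

  remainder-unique : ∀ {t} a b → a ℕ.< ℤ.∣ t ∣ → b ℕ.< ℤ.∣ t ∣ → t ∣ + a - + b → a ≡ b
  remainder-unique {t} a b a<t b<t t∣ with ℕ.≤-total a b
  ... | inj₁ a≤b = ℕ.≤-antisym a≤b (ℕ.m∸n≡0⇒m≤n (multiple-below
          (subst (ℤ.∣ t ∣ ℕ.∣_) (trans (cong ℤ.∣_∣ (ℤ.m-n≡m⊖n a b)) (ℤ.∣⊖∣-≤ a≤b)) (ℤ.∣⇒∣ᵤ t∣))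
          (ℕ.≤-<-trans (ℕ.m∸n≤m b a) b<t)))
  ... | inj₂ b≤a = ℕ.≤-antisym (ℕ.m∸n≡0⇒m≤n (multiple-below
          (subst (ℤ.∣ t ∣ ℕ.∣_) (trans (cong ℤ.∣_∣ (ℤ.m-n≡m⊖n a b)) (trans (ℤ.∣m⊖n∣≡∣n⊖m∣ a b) (ℤ.∣⊖∣-≤ b≤a))) (ℤ.∣⇒∣ᵤ t∣))
          (ℕ.≤-<-trans (ℕ.m∸n≤m a b) a<t))) b≤a

  -- P need not be decidable, so a least witness cannot be searched for; its absence is refuted by
  -- well-founded induction.
  minimal : ∀ {P : ℕ → Set} n → Acc ℕ._<_ n → P n → ¬ ¬ (∃ λ k → P k × (∀ j → j ℕ.< k → ¬ P j))
  minimal n (acc rec) Pn none = none (n , Pn , λ j j<n Pj → minimal j (rec j<n) Pj none)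

  a+b-b≡a : ∀ a b → a + b - b ≡ a
  a+b-b≡a = solve 2 (λ a b → a :+ b :- b := a) refl

  a-b+b≡a : ∀ a b → a - b + b ≡ a
  a-b+b≡a = solve 2 (λ a b → a :- b :+ b := a) refl

  1≢2* : ∀ q → + 1 ≢ + 2 * q
  1≢2* q eq = contradiction (ℤ.∣⇒∣ᵤ (divides {+ 2} {+ 1} q (trans eq (ℤ.*-comm (+ 2) q)))) λ d → contradiction (ℕ.∣1⇒≡1 d) λ ()

  mod-243⇒mod-81 : ∀ m j → + 243 ∣ m - (+ 39 + j * + 81) → + 81 ∣ m - + 39
  mod-243⇒mod-81 m j (divides q eq) = divides (q * + 3 + j) (begin
    m - + 39                            ≡⟨ solve 2 (λ m j → m :- con (+ 39) := m :- (con (+ 39) :+ j :* con (+ 81)) :+ j :* con (+ 81)) refl m j ⟩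
    m - (+ 39 + j * + 81) + j * + 81    ≡⟨ cong (λ t → t + j * + 81) eq ⟩
    q * + 243 + j * + 81                ≡⟨ solve 2 (λ q j → q :* con (+ 243) :+ j :* con (+ 81) := (q :* con (+ 3) :+ j) :* con (+ 81)) refl q j ⟩
    (q * + 3 + j) * + 81                ∎)
    where open ≡-Reasoning

  mod-81⇒mod-243 : ∀ m → + 81 ∣ m - + 39 → + 243 ∣ m - + 39 ⊎ + 243 ∣ m - + 120 ⊎ + 243 ∣ m - + 201
  mod-81⇒mod-243 m (divides q eq) = by-residue (q ℤ.%ℕ 3) (ℤ.n%ℕd<d q 3) (ℤ.a≡a%ℕn+[a/ℕn]*n q 3)
    where
    open ≡-Reasoning
    k = q ℤ./ℕ 3
    shifted : ∀ r → q ≡ + r + k * + 3 → + 243 ∣ m - (+ 39 + + r * + 81)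
    shifted r q≡ = divides k (begin
      m - (+ 39 + + r * + 81)          ≡⟨ solve 2 (λ m r → m :- (con (+ 39) :+ r :* con (+ 81)) := m :- con (+ 39) :- r :* con (+ 81)) refl m (+ r) ⟩
      m - + 39 - + r * + 81            ≡⟨ cong (λ t → t - + r * + 81) (trans eq (cong (λ t → t * + 81) q≡)) ⟩
      (+ r + k * + 3) * + 81 - + r * + 81 ≡⟨ solve 2 (λ r k → (r :+ k :* con (+ 3)) :* con (+ 81) :- r :* con (+ 81) := k :* con (+ 243)) refl (+ r) k ⟩
      k * + 243 ∎)
    by-residue : ∀ r → r ℕ.< 3 → q ≡ + r + k * + 3 → + 243 ∣ m - + 39 ⊎ + 243 ∣ m - + 120 ⊎ + 243 ∣ m - + 201
    by-residue 0 _ q≡ = inj₁ (shifted 0 q≡)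
    by-residue 1 _ q≡ = inj₂ (inj₁ (shifted 1 q≡))
    by-residue 2 _ q≡ = inj₂ (inj₂ (shifted 2 q≡))
    by-residue (suc (suc (suc _))) (ℕ.s≤s (ℕ.s≤s (ℕ.s≤s ()))) _

  -- m (m + 3) is even. The number m² + 3m + 9 is a square root of the discriminant of `l m`.
  different-odd : ∀ m → ∃ λ k → m * m + + 3 * m + + 9 ≡ + 1 + k * + 2
  different-odd m = _∣_.quotient 2∣ , trans
    (solve 1 (λ m → m :* m :+ con (+ 3) :* m :+ con (+ 9) := con (+ 1) :+ (m :* m :+ con (+ 3) :* m :+ con (+ 8))) refl m)
    (cong (λ t → + 1 + t) (_∣_.equality 2∣))
    where
    2∣ : + 2 ∣ m * m + + 3 * m + + 8
    2∣ = Mod2.valid (Mod2.n∣ var 0F :* var 0F :+ con (+ 3) :* var 0F :+ con (+ 8)) (m ∷ [])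

open Arithmetic

-- What the argument uses about L m.  The element δ is a square root of the discriminant
-- of ℤ[ρ].
record CyclicCubic (m : ℤ) : Set₁ where
  field
    K : NumberField
  open NumberField K public
    using (Carrier; _≈_; _+_; _*_; -_; _-_; 0#; 1#; ι; ι-hom)
  field
    ≈⇒≡                 : ∀ {x y} → x ≈ y → x ≡ y
    ≡-isCommutativeRing : IsCommutativeRing _≡_ _+_ _*_ -_ 0# 1#

  κ : ℤ → Carrier
  κ z = ι (fromℤ z)

  field
    ρ              : Carrier
    ρ-cubic        : ρ * (ρ * ρ) ≡ κ m * (ρ * ρ) + ((κ m + κ (+ 3)) * ρ + κ (+ 1))
    coordinates    : ∀ x → ∃ λ D → D ≢ + 0 × ∃ λ a → ∃₂ λ b c → κ D * x ≡ κ a + κ b * ρ + κ c * (ρ * ρ)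
    independence   : ∀ a b c → κ a + κ b * ρ + κ c * (ρ * ρ) ≡ κ (+ 0) → a ≡ + 0 × b ≡ + 0 × c ≡ + 0
    σ              : Carrier → Carrier
    σ-+            : ∀ x y → σ (x + y) ≡ σ x + σ y
    σ-*            : ∀ x y → σ (x * y) ≡ σ x * σ y
    σ-ι            : ∀ q → σ (ι q) ≡ ι q
    σ³             : ∀ x → σ (σ (σ x)) ≡ x
    σρ             : σ ρ ≡ κ m + κ (+ 2) + κ m * ρ - ρ * ρ
    ρ-trace        : ρ + σ ρ + σ (σ ρ) ≡ κ m
    ρ-pairs        : ρ * σ ρ + σ ρ * σ (σ ρ) + σ (σ ρ) * ρ ≡ - (κ m + κ (+ 3))
    ρ-norm         : ρ * σ ρ * σ (σ ρ) ≡ κ (+ 1)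
    trace-rational : ∀ x → ∃ λ q → x + σ x + σ (σ x) ≡ ι q
    norm-rational  : ∀ x → ∃ λ q → x * σ x * σ (σ x) ≡ ι q
    F-norm         : ∀ θ x → ι (F K θ (fromℤ x)) ≡ (κ x - θ) * (κ x - σ θ) * (κ x - σ (σ θ))
    δ              : ℤ
    δ-odd          : ∃ λ k → δ ≡ + 1 ℤ.+ k ℤ.* + 2
    different      : (ρ - σ ρ) * (σ ρ - σ (σ ρ)) * (σ (σ ρ) - ρ) ≡ κ δ

-- Integers, the order ℤ[ρ] and integrality in a cyclic cubic field

module Theory {m : ℤ} (C : CyclicCubic m) where
  open CyclicCubic C
  open RingMorphisms.IsRingHomomorphism ι-hom using (+-homo; *-homo; -‿homo; 0#-homo; 1#-homo)

  ≡-ring : CommutativeRing 0ℓ 0ℓ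
  ≡-ring = record { isCommutativeRing = ≡-isCommutativeRing }

  κ-+ : ∀ a b → κ (a ℤ.+ b) ≡ κ a + κ b
  κ-+ a b = trans (cong ι (fromℤ-+ a b)) (≈⇒≡ (+-homo (fromℤ a) (fromℤ b)))

  κ-* : ∀ a b → κ (a ℤ.* b) ≡ κ a * κ b
  κ-* a b = trans (cong ι (fromℤ-* a b)) (≈⇒≡ (*-homo (fromℤ a) (fromℤ b)))

  κ-neg : ∀ a → κ (ℤ.- a) ≡ - κ a
  κ-neg a = trans (cong ι (fromℤ-neg a)) (≈⇒≡ (-‿homo (fromℤ a)))

  κ-- : ∀ a b → κ (a ℤ.- b) ≡ κ a - κ b
  κ-- a b = trans (κ-+ a (ℤ.- b)) (cong (λ t → κ a + t) (κ-neg b))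

  κ0 : κ (+ 0) ≡ 0#
  κ0 = ≈⇒≡ 0#-homo

  κ1 : κ (+ 1) ≡ 1#
  κ1 = ≈⇒≡ 1#-homo

  ℤ-rawRing : RawRing 0ℓ 0ℓ
  ℤ-rawRing = CommutativeRing.rawRing ℤ.+-*-commutativeRing

  κ-morphism : ℤ-rawRing ACR.-Raw-AlmostCommutative⟶ ACR.fromCommutativeRing ≡-ring
  κ-morphism = record
    { ⟦_⟧ = κ ; +-homo = κ-+ ; *-homo = κ-* ; -‿homo = κ-neg ; 0-homo = κ0 ; 1-homo = κ1 }

  -- Coefficients are taken in ℤ, where equality is decidable, and embedded by `κ`.
  module KS = RingSolver ℤ-rawRing (ACR.fromCommutativeRing ≡-ring) κ-morphism
    (λ a b → Maybe.map (cong κ) (dec⇒maybe (a ℤ.≟ b)))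

  open KS

  -- Solver syntax evaluated in ℤ: κ-⟦⟧ moves κ through a whole expression at once.
  ⟦_⟧ᶻ : ∀ {k} → Polynomial k → Vec ℤ k → ℤ
  ⟦ op [+] p q ⟧ᶻ v = ⟦ p ⟧ᶻ v ℤ.+ ⟦ q ⟧ᶻ v
  ⟦ op [*] p q ⟧ᶻ v = ⟦ p ⟧ᶻ v ℤ.* ⟦ q ⟧ᶻ v
  ⟦ con c ⟧ᶻ      v = c
  ⟦ var i ⟧ᶻ      v = lookup v i
  ⟦ p :^ zero ⟧ᶻ  v = + 1
  ⟦ p :^ suc e ⟧ᶻ v = ⟦ p ⟧ᶻ v ℤ.* ⟦ p :^ e ⟧ᶻ v
  ⟦ :- p ⟧ᶻ       v = ℤ.- ⟦ p ⟧ᶻ v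

  κ-⟦⟧ : ∀ {k} (p : Polynomial k) v → κ (⟦ p ⟧ᶻ v) ≡ ⟦ p ⟧ (map κ v)
  κ-⟦⟧ (op [+] p q) v = trans (κ-+ (⟦ p ⟧ᶻ v) (⟦ q ⟧ᶻ v)) (cong₂ _+_ (κ-⟦⟧ p v) (κ-⟦⟧ q v))
  κ-⟦⟧ (op [*] p q) v = trans (κ-* (⟦ p ⟧ᶻ v) (⟦ q ⟧ᶻ v)) (cong₂ _*_ (κ-⟦⟧ p v) (κ-⟦⟧ q v))
  κ-⟦⟧ (con c)      v = refl
  κ-⟦⟧ (var i)      v = sym (lookup-map i κ v)
  κ-⟦⟧ (p :^ zero)  v = κ1
  κ-⟦⟧ (p :^ suc e) v = trans (κ-* (⟦ p ⟧ᶻ v) (⟦ p :^ e ⟧ᶻ v)) (cong₂ _*_ (κ-⟦⟧ p v) (κ-⟦⟧ (p :^ e) v))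
  κ-⟦⟧ (:- p)       v = trans (κ-neg (⟦ p ⟧ᶻ v)) (cong -_ (κ-⟦⟧ p v))

  infixr 8 _^_
  -- The empty power is `κ (+ 1)` because `con (+ 1)` of the solver evaluates to it.
  _^_ : Carrier → ℕ → Carrier
  x ^ zero  = κ (+ 1)
  x ^ suc k = x * x ^ k

  κ-^ : ∀ n j → κ (n ℤ.^ j) ≡ κ n ^ j
  κ-^ n zero    = refl
  κ-^ n (suc j) = trans (κ-* n (n ℤ.^ j)) (cong (κ n *_) (κ-^ n j))

  *-^ : ∀ x y k → (x * y) ^ k ≡ x ^ k * y ^ k
  *-^ x y zero    = solve 0 (con (+ 1) := con (+ 1) :* con (+ 1)) refl
  *-^ x y (suc k) = trans (cong (x * y *_) (*-^ x y k))
    (solve 4 (λ x y u v → x :* y :* (u :* v) := x :* u :* (y :* v)) refl x y (x ^ k) (y ^ k))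

  Z : ℤ → ℤ → ℤ → Carrier
  Z a b c = κ a + κ b * ρ + κ c * (ρ * ρ)

  κ-injective : ∀ {a b} → κ a ≡ κ b → a ≡ b
  κ-injective {a} {b} eq = ℤ.i-j≡0⇒i≡j a b (proj₁ (independence (a ℤ.- b) (+ 0) (+ 0) (begin
    Z (a ℤ.- b) (+ 0) (+ 0)
      ≡⟨ cong (λ t → t + κ (+ 0) * ρ + κ (+ 0) * (ρ * ρ)) (trans (κ-- a b) (cong (_- κ b) eq)) ⟩
    κ b - κ b + κ (+ 0) * ρ + κ (+ 0) * (ρ * ρ)
      ≡⟨ solve 2 (λ b ρ → b :- b :+ con (+ 0) :* ρ :+ con (+ 0) :* (ρ :* ρ) := con (+ 0)) refl (κ b) ρ ⟩
    κ (+ 0) ∎)))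
    where open ≡-Reasoning

  κ≢0 : ∀ {z} → z ≢ + 0 → κ z ≢ κ (+ 0)
  κ≢0 z≢0 eq = z≢0 (κ-injective eq)

  κ-inverse : ∀ {z} → z ≢ + 0 → ∃ λ y → κ z * y ≡ κ (+ 1)
  κ-inverse {z} z≢0 = let y , eq = NumberField.inverse K (κ z) (λ κz≈0 → κ≢0 z≢0 (trans (≈⇒≡ κz≈0) (sym κ0)))
    in y , trans (≈⇒≡ eq) (sym κ1)

  κ-cancelˡ : ∀ z {x y} → z ≢ + 0 → κ z * x ≡ κ z * y → x ≡ y
  κ-cancelˡ z {x} {y} z≢0 eq = begin
    x                     ≡⟨ unscale x ⟨
    proj₁ z⁻¹ * (κ z * x) ≡⟨ cong (proj₁ z⁻¹ *_) eq ⟩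
    proj₁ z⁻¹ * (κ z * y) ≡⟨ unscale y ⟩
    y                     ∎
    where
    open ≡-Reasoning
    z⁻¹ = κ-inverse z≢0
    unscale : ∀ x → proj₁ z⁻¹ * (κ z * x) ≡ x
    unscale x = begin
      proj₁ z⁻¹ * (κ z * x) ≡⟨ solve 3 (λ i z x → i :* (z :* x) := z :* i :* x) refl (proj₁ z⁻¹) (κ z) x ⟩
      κ z * proj₁ z⁻¹ * x   ≡⟨ cong (_* x) (proj₂ z⁻¹) ⟩
      κ (+ 1) * x           ≡⟨ solve 1 (λ x → con (+ 1) :* x := x) refl x ⟩
      x ∎

  σ-neg : ∀ x → σ (- x) ≡ - σ x
  σ-neg x = begin
    σ (- x)            ≡⟨ cong σ (solve 1 (λ x → :- x := con (-[1+ 0 ]) :* x) refl x) ⟩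
    σ (κ -[1+ 0 ] * x) ≡⟨ trans (σ-* _ _) (cong (_* σ x) (σ-ι _)) ⟩
    κ -[1+ 0 ] * σ x   ≡⟨ solve 1 (λ x → con (-[1+ 0 ]) :* x := :- x) refl (σ x) ⟩
    - σ x              ∎
    where open ≡-Reasoning

  σ-- : ∀ x y → σ (x - y) ≡ σ x - σ y
  σ-- x y = trans (σ-+ x (- y)) (cong (λ t → σ x + t) (σ-neg y))

  σ-κ : ∀ n → σ (κ n) ≡ κ n
  σ-κ n = σ-ι (fromℤ n)

  σ-^ : ∀ x k → σ (x ^ k) ≡ σ x ^ k
  σ-^ x zero    = σ-κ (+ 1)
  σ-^ x (suc k) = trans (σ-* x (x ^ k)) (cong (σ x *_) (σ-^ x k))

  -- The order ℤ[ρ].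
  O : Carrier → Set
  O x = ∃ λ a → ∃₂ λ b c → x ≡ Z a b c

  O-+ : ∀ {x y} → O x → O y → O (x + y)
  O-+ (a , b , c , refl) (d , e , f , refl) = a ℤ.+ d , b ℤ.+ e , c ℤ.+ f , eq
    where
    eq : Z a b c + Z d e f ≡ Z (a ℤ.+ d) (b ℤ.+ e) (c ℤ.+ f)
    eq rewrite κ-+ a d | κ-+ b e | κ-+ c f = solve 7 (λ a b c d e f ρ →
      a :+ b :* ρ :+ c :* (ρ :* ρ) :+ (d :+ e :* ρ :+ f :* (ρ :* ρ)) :=
      a :+ d :+ (b :+ e) :* ρ :+ (c :+ f) :* (ρ :* ρ)) refl (κ a) (κ b) (κ c) (κ d) (κ e) (κ f) ρ

  O-κ* : ∀ n {x} → O x → O (κ n * x)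
  O-κ* n (a , b , c , refl) = n ℤ.* a , n ℤ.* b , n ℤ.* c , eq
    where
    eq : κ n * Z a b c ≡ Z (n ℤ.* a) (n ℤ.* b) (n ℤ.* c)
    eq rewrite κ-* n a | κ-* n b | κ-* n c = solve 5 (λ n a b c ρ →
      n :* (a :+ b :* ρ :+ c :* (ρ :* ρ)) := n :* a :+ n :* b :* ρ :+ n :* c :* (ρ :* ρ)) refl
      (κ n) (κ a) (κ b) (κ c) ρ

  O-ρ* : ∀ {x} → O x → O (ρ * x)
  O-ρ* (a , b , c , refl) = c , a ℤ.+ (m ℤ.+ + 3) ℤ.* c , b ℤ.+ m ℤ.* c , eq
    where
    eq : ρ * Z a b c ≡ Z c (a ℤ.+ (m ℤ.+ + 3) ℤ.* c) (b ℤ.+ m ℤ.* c)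
    eq = begin
      ρ * Z a b c
        ≡⟨ solve 4 (λ a b c ρ → ρ :* (a :+ b :* ρ :+ c :* (ρ :* ρ))
             := a :* ρ :+ b :* (ρ :* ρ) :+ c :* (ρ :* (ρ :* ρ))) refl (κ a) (κ b) (κ c) ρ ⟩
      κ a * ρ + κ b * (ρ * ρ) + κ c * (ρ * (ρ * ρ))
        ≡⟨ cong (λ t → κ a * ρ + κ b * (ρ * ρ) + κ c * t) ρ-cubic ⟩
      κ a * ρ + κ b * (ρ * ρ) + κ c * (κ m * (ρ * ρ) + ((κ m + κ (+ 3)) * ρ + κ (+ 1)))
        ≡⟨ solve 5 (λ m a b c ρ → a :* ρ :+ b :* (ρ :* ρ) :+ c :* (m :* (ρ :* ρ) :+ ((m :+ con (+ 3)) :* ρ :+ con (+ 1)))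
             := c :+ (a :+ (m :+ con (+ 3)) :* c) :* ρ :+ (b :+ m :* c) :* (ρ :* ρ)) refl (κ m) (κ a) (κ b) (κ c) ρ ⟩
      κ c + (κ a + (κ m + κ (+ 3)) * κ c) * ρ + (κ b + κ m * κ c) * (ρ * ρ)
        ≡⟨ cong₂ (λ u v → κ c + u * ρ + v * (ρ * ρ))
             (κ-⟦⟧ (var 0F :+ (var 1F :+ con (+ 3)) :* var 2F) (a ∷ m ∷ c ∷ []))
             (κ-⟦⟧ (var 0F :+ var 1F :* var 2F) (b ∷ m ∷ c ∷ [])) ⟨
      Z c (a ℤ.+ (m ℤ.+ + 3) ℤ.* c) (b ℤ.+ m ℤ.* c) ∎
      where open ≡-Reasoning

  -- Multiplication by a + bρ + cρ² is built from integer multiples and repeated multiplication by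
  -- ρ.
  O-* : ∀ {x y} → O x → O y → O (x * y)
  O-* {y = y} (a , b , c , refl) Oy = subst O
    (solve 5 (λ a b c ρ y → a :* y :+ (b :* (ρ :* y) :+ c :* (ρ :* (ρ :* y))) := (a :+ b :* ρ :+ c :* (ρ :* ρ)) :* y) refl
      (κ a) (κ b) (κ c) ρ y)
    (O-+ (O-κ* a Oy) (O-+ (O-κ* b (O-ρ* Oy)) (O-κ* c (O-ρ* (O-ρ* Oy)))))

  O-κ : ∀ n → O (κ n)
  O-κ n = n , + 0 , + 0 , solve 2 (λ n ρ → n := n :+ con (+ 0) :* ρ :+ con (+ 0) :* (ρ :* ρ)) refl (κ n) ρ

  O-ρ : O ρ
  O-ρ = + 0 , + 1 , + 0 , solve 1 (λ ρ → ρ := con (+ 0) :+ con (+ 1) :* ρ :+ con (+ 0) :* (ρ :* ρ)) refl ρ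

  O-neg : ∀ {x} → O x → O (- x)
  O-neg {x} Ox = subst O (solve 1 (λ x → con (-[1+ 0 ]) :* x := :- x) refl x) (O-κ* -[1+ 0 ] Ox)

  O-- : ∀ {x y} → O x → O y → O (x - y)
  O-- Ox Oy = O-+ Ox (O-neg Oy)

  O-σρ : O (σ ρ)
  O-σρ = subst O (sym σρ) (O-- (O-+ (O-+ (O-κ m) (O-κ (+ 2))) (O-κ* m O-ρ)) (O-* O-ρ O-ρ))

  O-σ : ∀ {x} → O x → O (σ x)
  O-σ (a , b , c , refl) = subst O (sym eq)
    (O-+ (O-+ (O-κ a) (O-κ* b O-σρ)) (O-κ* c (O-* O-σρ O-σρ)))
    where
    eq : σ (Z a b c) ≡ κ a + κ b * σ ρ + κ c * (σ ρ * σ ρ)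
    eq rewrite σ-+ (κ a + κ b * ρ) (κ c * (ρ * ρ)) | σ-+ (κ a) (κ b * ρ) | σ-* (κ b) ρ
             | σ-* (κ c) (ρ * ρ) | σ-* ρ ρ | σ-κ a | σ-κ b | σ-κ c = refl

  -- Equivalent to integrality, but visibly stable under addition and multiplication.
  AlmostIntegral : Carrier → Set
  AlmostIntegral x = ∃ λ D → D ≢ + 0 × ∀ k → O (κ D * x ^ k)

  O⇒AI : ∀ {x} → O x → AlmostIntegral x
  O⇒AI {x} Ox = + 1 , (λ ()) , λ k → O-κ* (+ 1) (power k)
    where
    power : ∀ k → O (x ^ k)
    power zero    = O-κ (+ 1)
    power (suc k) = O-* Ox (power k)

  AI-* : ∀ {x y} → AlmostIntegral x → AlmostIntegral y → AlmostIntegral (x * y)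
  AI-* {x} {y} (D , D≢0 , p) (E , E≢0 , q) = D ℤ.* E , *-≢0 D≢0 E≢0 , λ k → subst O
    (trans (solve 4 (λ D E u v → D :* u :* (E :* v) := D :* E :* (u :* v)) refl (κ D) (κ E) (x ^ k) (y ^ k))
      (sym (cong₂ _*_ (κ-* D E) (*-^ x y k))))
    (O-* (p k) (q k))

  -- Induction on k over all products x^i y^j (x + y)^k takes the place of the binomial expansion;
  -- for k = 0 the denominators D and E of the two factors suffice.
  AI-+ : ∀ {x y} → AlmostIntegral x → AlmostIntegral y → AlmostIntegral (x + y)
  AI-+ {x} {y} (D , D≢0 , p) (E , E≢0 , q) = D ℤ.* E , *-≢0 D≢0 E≢0 , λ k → subst O
      (solve 2 (λ D z → D :* (con (+ 1) :* con (+ 1) :* z) := D :* z) refl (κ (D ℤ.* E)) ((x + y) ^ k))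
      (mixed k 0 0)
    where
    mixed : ∀ k i j → O (κ (D ℤ.* E) * (x ^ i * y ^ j * (x + y) ^ k))
    mixed zero i j = subst O
      (trans (solve 4 (λ D E u v → D :* u :* (E :* v) := D :* E :* (u :* v :* con (+ 1))) refl (κ D) (κ E) (x ^ i) (y ^ j))
        (sym (cong (_* (x ^ i * y ^ j * κ (+ 1))) (κ-* D E))))
      (O-* (p i) (q j))
    mixed (suc k) i j = subst O
      (solve 6 (λ D u v x y z → D :* (x :* u :* v :* z) :+ D :* (u :* (y :* v) :* z) := D :* (u :* v :* ((x :+ y) :* z)))
        refl (κ (D ℤ.* E)) (x ^ i) (y ^ j) x y ((x + y) ^ k))
      (O-+ (mixed k (suc i) j) (mixed k i (suc j)))

  AI-κ : ∀ n → AlmostIntegral (κ n)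
  AI-κ n = O⇒AI (O-κ n)

  AI-neg : ∀ {x} → AlmostIntegral x → AlmostIntegral (- x)
  AI-neg {x} p = subst AlmostIntegral (solve 1 (λ x → con (-[1+ 0 ]) :* x := :- x) refl x) (AI-* (AI-κ -[1+ 0 ]) p)

  AI-- : ∀ {x y} → AlmostIntegral x → AlmostIntegral y → AlmostIntegral (x - y)
  AI-- p q = AI-+ p (AI-neg q)

  AI-σ : ∀ {x} → AlmostIntegral x → AlmostIntegral (σ x)
  AI-σ {x} (D , D≢0 , p) = D , D≢0 , λ k → subst O
    (trans (σ-* (κ D) (x ^ k)) (cong₂ _*_ (σ-κ D) (σ-^ x k))) (O-σ (p k))

  -- For every j the element D x^j lies in ℤ[ρ], and k^j times it is D n^j. Comparing constant
  -- coordinates gives k^j ∣ D n^j, and the integers are completely integrally closed.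
  AI-divides : ∀ k n {x} → AlmostIntegral x → k ≢ + 0 → κ n ≡ κ k * x → k ∣ n
  AI-divides k n {x} (D , D≢0 , p) k≢0 n≡kx = powers-divideℤ k n D k≢0 D≢0 divisible
    where
    open ≡-Reasoning
    divisible : ∀ j → k ℤ.^ j ∣ D ℤ.* n ℤ.^ j
    divisible j with p j
    ... | a , b , c , eq = divides a (trans (sym (ℤ.i-j≡0⇒i≡j _ _ (proj₁
      (independence (P ℤ.* a ℤ.- D ℤ.* n ℤ.^ j) (P ℤ.* b) (P ℤ.* c) zero′)))) (ℤ.*-comm P a))
      where
      P = k ℤ.^ j
      scaled : κ P * Z a b c ≡ κ D * κ (n ℤ.^ j)
      scaled = begin
        κ P * Z a b c           ≡⟨ cong₂ _*_ (κ-^ k j) (sym eq) ⟩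
        κ k ^ j * (κ D * x ^ j) ≡⟨ solve 3 (λ u D v → u :* (D :* v) := D :* (u :* v)) refl (κ k ^ j) (κ D) (x ^ j) ⟩
        κ D * (κ k ^ j * x ^ j) ≡⟨ cong (κ D *_) (sym (*-^ (κ k) x j)) ⟩
        κ D * (κ k * x) ^ j     ≡⟨ cong (λ t → κ D * t ^ j) (sym n≡kx) ⟩
        κ D * κ n ^ j           ≡⟨ cong (κ D *_) (sym (κ-^ n j)) ⟩
        κ D * κ (n ℤ.^ j)       ∎
      zero′ : Z (P ℤ.* a ℤ.- D ℤ.* n ℤ.^ j) (P ℤ.* b) (P ℤ.* c) ≡ κ (+ 0)
      zero′ rewrite κ-- (P ℤ.* a) (D ℤ.* n ℤ.^ j) | κ-* P a | κ-* P b | κ-* P c | κ-* D (n ℤ.^ j) = begin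
        κ P * κ a - κ D * κ (n ℤ.^ j) + κ P * κ b * ρ + κ P * κ c * (ρ * ρ)
          ≡⟨ solve 6 (λ P a b c ρ d → P :* a :- d :+ P :* b :* ρ :+ P :* c :* (ρ :* ρ)
                := P :* (a :+ b :* ρ :+ c :* (ρ :* ρ)) :- d) refl (κ P) (κ a) (κ b) (κ c) ρ (κ D * κ (n ℤ.^ j)) ⟩
        κ P * Z a b c - κ D * κ (n ℤ.^ j) ≡⟨ cong (_- κ D * κ (n ℤ.^ j)) scaled ⟩
        κ D * κ (n ℤ.^ j) - κ D * κ (n ℤ.^ j) ≡⟨ solve 1 (λ t → t :- t := con (+ 0)) refl _ ⟩
        κ (+ 0) ∎

  AI-quotient : ∀ k n {x} → AlmostIntegral x → k ≢ + 0 → κ n ≡ κ k * x → ∃ λ z → x ≡ κ z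
  AI-quotient k n {x} p k≢0 eq = z , κ-cancelˡ k k≢0 (begin
    κ k * x      ≡⟨ eq ⟨
    κ n          ≡⟨ cong κ (_∣_.equality k∣n) ⟩
    κ (z ℤ.* k)  ≡⟨ κ-* z k ⟩
    κ z * κ k    ≡⟨ solve 2 (λ z k → z :* k := k :* z) refl (κ z) (κ k) ⟩
    κ k * κ z    ∎)
    where
    open ≡-Reasoning
    k∣n = AI-divides k n p k≢0 eq
    z = _∣_.quotient k∣n

  AI-rational : ∀ {x q} → AlmostIntegral x → x ≡ ι q → ∃ λ z → x ≡ κ z
  AI-rational {x} {q} p refl = AI-quotient (ℚ.↧ q) (ℚ.↥ q) p (denominator≢0 q)
    (trans (cong ι (numerator-denominator m q)) (trans (≈⇒≡ (*-homo q (fromℤ (ℚ.↧ q))))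
      (solve 2 (λ x y → x :* y := y :* x) refl (ι q) (κ (ℚ.↧ q)))))

  tr : Carrier → Carrier
  tr x = x + σ x + σ (σ x)

  tr-κ* : ∀ n x → tr (κ n * x) ≡ κ n * tr x
  tr-κ* n x rewrite σ-* (κ n) x | σ-κ n | σ-* (κ n) (σ x) | σ-κ n =
    solve 4 (λ n x y z → n :* x :+ n :* y :+ n :* z := n :* (x :+ y :+ z)) refl (κ n) x (σ x) (σ (σ x))

  trace-integer : ∀ {x} → AlmostIntegral x → ∃ λ t → tr x ≡ κ t
  trace-integer {x} p = AI-rational (AI-+ (AI-+ p (AI-σ p)) (AI-σ (AI-σ p))) (proj₂ (trace-rational x))

  -- The characteristic polynomial x³ − t x² + s x − n.
  record CharPoly (x : Carrier) : Set where
    field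
      t s n : ℤ
      t≡ : x + σ x + σ (σ x) ≡ κ t
      s≡ : x * σ x + σ x * σ (σ x) + σ (σ x) * x ≡ κ s
      n≡ : x * σ x * σ (σ x) ≡ κ n

  -- The second symmetric function is the trace of x σx: its last term σ²x σ³x is σ²x x.
  charPoly : ∀ {x} → AlmostIntegral x → CharPoly x
  charPoly {x} p = record { t = proj₁ T ; s = proj₁ S ; n = proj₁ N ; t≡ = proj₂ T ; n≡ = proj₂ N
    ; s≡ = trans (sym (cong₂ (λ u v → x * σ x + u + v) (σ-* x (σ x))
             (trans (cong σ (σ-* x (σ x))) (trans (σ-* (σ x) (σ (σ x))) (cong (σ (σ x) *_) (σ³ x)))))) (proj₂ S) }
    where
    T = trace-integer p
    S = trace-integer (AI-* p (AI-σ p))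
    N = AI-rational (AI-* (AI-* p (AI-σ p)) (AI-σ (AI-σ p))) (proj₂ (norm-rational x))

  -- Characteristic polynomials

  -- Division of the homogenised `l m` by the linear form of its root ρ; the remainder is w³ l_m(ρ)
  -- = 0.
  l-factor : ∀ r w → κ (H m r w) ≡ (κ r - κ w * ρ) * (κ r * κ r + κ r * κ w * ρ + κ w * κ w * (ρ * ρ)
    - κ m * κ w * (κ r + κ w * ρ) - (κ m + κ (+ 3)) * κ w * κ w)
  l-factor r w
    = trans (κ-⟦⟧ (h (var 0F) (var 1F) (var 2F)) (m ∷ r ∷ w ∷ [])) (trans
      (solve 4 (λ m r w ρ → h m r w
        := (r :- w :* ρ) :* (r :* r :+ r :* w :* ρ :+ w :* w :* (ρ :* ρ)
           :- m :* w :* (r :+ w :* ρ) :- (m :+ con (+ 3)) :* w :* w)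
        :+ w :* w :* w :* (ρ :* (ρ :* ρ) :- (m :* (ρ :* ρ) :+ ((m :+ con (+ 3)) :* ρ :+ con (+ 1)))))
        refl (κ m) (κ r) (κ w) ρ)
      (trans (cong (λ c → f + κ w * κ w * κ w * (c - g)) ρ-cubic)
        (solve 3 (λ f w g → f :+ w :* w :* w :* (g :- g) := f) refl f (κ w) g)))
    where
    h : ∀ {k} (m r w : Polynomial k) → Polynomial k
    h m r w = r :* r :* r :- m :* r :* r :* w :- (m :+ con (+ 3)) :* r :* w :* w :- w :* w :* w
    g = κ m * (ρ * ρ) + ((κ m + κ (+ 3)) * ρ + κ (+ 1))
    f = (κ r - κ w * ρ) * (κ r * κ r + κ r * κ w * ρ + κ w * κ w * (ρ * ρ)
      - κ m * κ w * (κ r + κ w * ρ) - (κ m + κ (+ 3)) * κ w * κ w)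

  -- The element e = σx·σ²x satisfies e·σe ≡ 0 modulo the norm n, so up to the factor
  -- tr e = s it is an idempotent, on which ρ acts as the scalar tr(eρ)/tr(e) = r/s.
  -- Hence r/s is a root of l m modulo n.
  norm-divides : ∀ {x} → AlmostIntegral x → (c : CharPoly x) → let open CharPoly c in
    ∃ λ r → n ∣ H m r s ℤ.* s
  -- The trace turns the factor e into s. As y Q is almost integral, its trace is an integer q, so
  -- divisibility by n survives.
  norm-divides {x} p c = r , divides q (κ-injective (begin
      κ (H m r s ℤ.* s)    ≡⟨ κ-* (H m r s) s ⟩
      κ (H m r s) * κ s    ≡⟨ cong (κ (H m r s) *_) tr-e ⟨
      κ (H m r s) * tr e   ≡⟨ tr-κ* (H m r s) e ⟨
      tr (κ (H m r s) * e) ≡⟨ cong tr He ⟩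
      tr (κ n * (y * Q))   ≡⟨ tr-κ* n (y * Q) ⟩
      κ n * tr (y * Q)     ≡⟨ cong (κ n *_) (proj₂ T) ⟩
      κ n * κ q            ≡⟨ solve 2 (λ n q → n :* q := q :* n) refl (κ n) (κ q) ⟩
      κ q * κ n            ≡⟨ κ-* q n ⟨
      κ (q ℤ.* n)          ∎))
    where
    open ≡-Reasoning
    open CharPoly c
    x′ = σ x
    x″ = σ (σ x)
    e = x′ * x″
    p′ = AI-σ p
    p″ = AI-σ p′
    R = trace-integer (AI-* (AI-* p′ p″) (O⇒AI O-ρ))
    r = proj₁ R
    Q = κ r * κ r + κ r * κ s * ρ + κ s * κ s * (ρ * ρ)
      - κ m * κ s * (κ r + κ s * ρ) - (κ m + κ (+ 3)) * κ s * κ s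
    OQ : O Q
    OQ = O-- (O-- (O-+ (O-+ (O-* (O-κ r) (O-κ r)) (O-* (O-* (O-κ r) (O-κ s)) O-ρ))
      (O-* (O-* (O-κ s) (O-κ s)) (O-* O-ρ O-ρ)))
      (O-* (O-* (O-κ m) (O-κ s)) (O-+ (O-κ r) (O-* (O-κ s) O-ρ))))
      (O-* (O-* (O-+ (O-κ m) (O-κ (+ 3))) (O-κ s)) (O-κ s))
    y = x″ * σ ρ + x′ * σ (σ ρ) - ρ * (x′ + x″)
    T = trace-integer (AI-* (AI-- (AI-+ (AI-* p″ (O⇒AI O-σρ)) (AI-* p′ (O⇒AI (O-σ O-σρ))))
      (AI-* (O⇒AI O-ρ) (AI-+ p′ p″))) (O⇒AI OQ))
    q = proj₁ T
    σe : σ e ≡ x″ * x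
    σe = trans (σ-* x′ x″) (cong (x″ *_) (σ³ x))
    σσe : σ (σ e) ≡ x * x′
    σσe = trans (cong σ σe) (trans (σ-* x″ x) (cong (_* x′) (σ³ x)))
    tr-e : tr e ≡ κ s
    tr-e = trans (cong₂ (λ u v → e + u + v) σe σσe) (trans
      (solve 3 (λ x y z → y :* z :+ z :* x :+ x :* y := x :* y :+ y :* z :+ z :* x) refl x x′ x″) s≡)
    κr : κ r ≡ e * ρ + x″ * x * σ ρ + x * x′ * σ (σ ρ)
    κr = trans (sym (proj₂ R)) (cong₂ (λ u v → e * ρ + u + v)
      (trans (σ-* e ρ) (cong (_* σ ρ) σe))
      (trans (cong σ (σ-* e ρ)) (trans (σ-* (σ e) (σ ρ)) (cong (_* σ (σ ρ)) σσe))))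
    -- The terms in e² cancel, and e σe = n σ²x, e σ²e = n σx.
    eigen : (κ r - κ s * ρ) * e ≡ κ n * y
    eigen = begin
      (κ r - κ s * ρ) * e ≡⟨ cong₂ (λ r s → (r - s * ρ) * e) κr (sym s≡) ⟩
      (e * ρ + x″ * x * σ ρ + x * x′ * σ (σ ρ) - (x * x′ + x′ * x″ + x″ * x) * ρ) * e
        ≡⟨ solve 6 (λ x y z ρ ρ′ ρ″ →
             (y :* z :* ρ :+ z :* x :* ρ′ :+ x :* y :* ρ″ :- (x :* y :+ y :* z :+ z :* x) :* ρ) :* (y :* z)
             := x :* y :* z :* (z :* ρ′ :+ y :* ρ″ :- ρ :* (y :+ z))) refl x x′ x″ ρ (σ ρ) (σ (σ ρ)) ⟩
      x * x′ * x″ * y ≡⟨ cong (_* y) n≡ ⟩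
      κ n * y ∎
    He : κ (H m r s) * e ≡ κ n * (y * Q)
    He = begin
      κ (H m r s) * e             ≡⟨ cong (_* e) (l-factor r s) ⟩
      (κ r - κ s * ρ) * Q * e     ≡⟨ solve 3 (λ a b c → a :* b :* c := a :* c :* b) refl (κ r - κ s * ρ) Q e ⟩
      (κ r - κ s * ρ) * e * Q     ≡⟨ cong (_* Q) eigen ⟩
      κ n * y * Q                 ≡⟨ solve 3 (λ a b c → a :* b :* c := a :* (b :* c)) refl (κ n) y Q ⟩
      κ n * (y * Q)               ∎

  charPoly-pred : ∀ {x} → CharPoly x → CharPoly (x - κ (+ 1))
  charPoly-pred {x} c = record
    { t = t ℤ.- + 3 ; s = s ℤ.- + 2 ℤ.* t ℤ.+ + 3 ; n = n ℤ.- s ℤ.+ t ℤ.- + 1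
    ; t≡ = begin
        x - κ (+ 1) + σ (x - κ (+ 1)) + σ (σ (x - κ (+ 1)))
          ≡⟨ cong₂ (λ u v → x - κ (+ 1) + u + v) σ-pred σσ-pred ⟩
        x - κ (+ 1) + (x′ - κ (+ 1)) + (x″ - κ (+ 1))
          ≡⟨ solve 3 (λ x y z → x :- con (+ 1) :+ (y :- con (+ 1)) :+ (z :- con (+ 1)) := x :+ y :+ z :- con (+ 3)) refl x x′ x″ ⟩
        x + x′ + x″ - κ (+ 3) ≡⟨ cong (_- κ (+ 3)) t≡ ⟩
        κ t - κ (+ 3)         ≡⟨ κ-⟦⟧ (var 0F :- con (+ 3)) (t ∷ []) ⟨
        κ (t ℤ.- + 3)         ∎
    ; s≡ = begin
        (x - κ (+ 1)) * σ (x - κ (+ 1)) + σ (x - κ (+ 1)) * σ (σ (x - κ (+ 1))) + σ (σ (x - κ (+ 1))) * (x - κ (+ 1))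
          ≡⟨ cong₂ (λ u v → (x - κ (+ 1)) * u + u * v + v * (x - κ (+ 1))) σ-pred σσ-pred ⟩
        (x - κ (+ 1)) * (x′ - κ (+ 1)) + (x′ - κ (+ 1)) * (x″ - κ (+ 1)) + (x″ - κ (+ 1)) * (x - κ (+ 1))
          ≡⟨ solve 3 (λ x y z → (x :- con (+ 1)) :* (y :- con (+ 1)) :+ (y :- con (+ 1)) :* (z :- con (+ 1)) :+ (z :- con (+ 1)) :* (x :- con (+ 1))
               := x :* y :+ y :* z :+ z :* x :- con (+ 2) :* (x :+ y :+ z) :+ con (+ 3)) refl x x′ x″ ⟩
        x * x′ + x′ * x″ + x″ * x - κ (+ 2) * (x + x′ + x″) + κ (+ 3)
          ≡⟨ cong₂ (λ s t → s - κ (+ 2) * t + κ (+ 3)) s≡ t≡ ⟩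
        κ s - κ (+ 2) * κ t + κ (+ 3)
          ≡⟨ κ-⟦⟧ (var 0F :- con (+ 2) :* var 1F :+ con (+ 3)) (s ∷ t ∷ []) ⟨
        κ (s ℤ.- + 2 ℤ.* t ℤ.+ + 3) ∎
    ; n≡ = begin
        (x - κ (+ 1)) * σ (x - κ (+ 1)) * σ (σ (x - κ (+ 1)))
          ≡⟨ cong₂ (λ u v → (x - κ (+ 1)) * u * v) σ-pred σσ-pred ⟩
        (x - κ (+ 1)) * (x′ - κ (+ 1)) * (x″ - κ (+ 1))
          ≡⟨ solve 3 (λ x y z → (x :- con (+ 1)) :* (y :- con (+ 1)) :* (z :- con (+ 1))
               := x :* y :* z :- (x :* y :+ y :* z :+ z :* x) :+ (x :+ y :+ z) :- con (+ 1)) refl x x′ x″ ⟩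
        x * x′ * x″ - (x * x′ + x′ * x″ + x″ * x) + (x + x′ + x″) - κ (+ 1)
          ≡⟨ cong₂ (λ n u → n - u + (x + x′ + x″) - κ (+ 1)) n≡ s≡ ⟩
        κ n - κ s + (x + x′ + x″) - κ (+ 1)
          ≡⟨ cong (λ t → κ n - κ s + t - κ (+ 1)) t≡ ⟩
        κ n - κ s + κ t - κ (+ 1)
          ≡⟨ κ-⟦⟧ (var 0F :- var 1F :+ var 2F :- con (+ 1)) (n ∷ s ∷ t ∷ []) ⟨
        κ (n ℤ.- s ℤ.+ t ℤ.- + 1) ∎
    }
    where
    open ≡-Reasoning
    open CharPoly c
    x′ = σ x
    x″ = σ (σ x)
    σ-pred : σ (x - κ (+ 1)) ≡ x′ - κ (+ 1)
    σ-pred = trans (σ-- x (κ (+ 1))) (cong (λ t → x′ - t) (σ-κ (+ 1)))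
    σσ-pred : σ (σ (x - κ (+ 1))) ≡ x″ - κ (+ 1)
    σσ-pred = trans (cong σ σ-pred) (trans (σ-- x′ (κ (+ 1))) (cong (λ t → x″ - t) (σ-κ (+ 1))))

  -- Graeffe's root-squaring formulas.
  charPoly-square : ∀ {x} → CharPoly x → CharPoly (x * x)
  charPoly-square {x} c = record
    { t = t ℤ.* t ℤ.- + 2 ℤ.* s ; s = s ℤ.* s ℤ.- + 2 ℤ.* n ℤ.* t ; n = n ℤ.* n
    ; t≡ = begin
        x * x + σ (x * x) + σ (σ (x * x))
          ≡⟨ cong₂ (λ u v → x * x + u + v) σ-sq σσ-sq ⟩
        x * x + x′ * x′ + x″ * x″
          ≡⟨ solve 3 (λ x y z → x :* x :+ y :* y :+ z :* z
               := (x :+ y :+ z) :* (x :+ y :+ z) :- con (+ 2) :* (x :* y :+ y :* z :+ z :* x)) refl x x′ x″ ⟩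
        (x + x′ + x″) * (x + x′ + x″) - κ (+ 2) * (x * x′ + x′ * x″ + x″ * x)
          ≡⟨ cong₂ (λ t s → t * t - κ (+ 2) * s) t≡ s≡ ⟩
        κ t * κ t - κ (+ 2) * κ s
          ≡⟨ κ-⟦⟧ (var 0F :* var 0F :- con (+ 2) :* var 1F) (t ∷ s ∷ []) ⟨
        κ (t ℤ.* t ℤ.- + 2 ℤ.* s) ∎
    ; s≡ = begin
        x * x * σ (x * x) + σ (x * x) * σ (σ (x * x)) + σ (σ (x * x)) * (x * x)
          ≡⟨ cong₂ (λ u v → x * x * u + u * v + v * (x * x)) σ-sq σσ-sq ⟩
        x * x * (x′ * x′) + x′ * x′ * (x″ * x″) + x″ * x″ * (x * x)
          ≡⟨ solve 3 (λ x y z → x :* x :* (y :* y) :+ y :* y :* (z :* z) :+ z :* z :* (x :* x)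
               := (x :* y :+ y :* z :+ z :* x) :* (x :* y :+ y :* z :+ z :* x)
                  :- con (+ 2) :* (x :* y :* z) :* (x :+ y :+ z)) refl x x′ x″ ⟩
        (x * x′ + x′ * x″ + x″ * x) * (x * x′ + x′ * x″ + x″ * x) - κ (+ 2) * (x * x′ * x″) * (x + x′ + x″)
          ≡⟨ cong₂ (λ s n → s * s - κ (+ 2) * n * (x + x′ + x″)) s≡ n≡ ⟩
        κ s * κ s - κ (+ 2) * κ n * (x + x′ + x″)
          ≡⟨ cong (λ t → κ s * κ s - κ (+ 2) * κ n * t) t≡ ⟩
        κ s * κ s - κ (+ 2) * κ n * κ t
          ≡⟨ κ-⟦⟧ (var 0F :* var 0F :- con (+ 2) :* var 1F :* var 2F) (s ∷ n ∷ t ∷ []) ⟨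
        κ (s ℤ.* s ℤ.- + 2 ℤ.* n ℤ.* t) ∎
    ; n≡ = begin
        x * x * σ (x * x) * σ (σ (x * x)) ≡⟨ cong₂ (λ u v → x * x * u * v) σ-sq σσ-sq ⟩
        x * x * (x′ * x′) * (x″ * x″)
          ≡⟨ solve 3 (λ x y z → x :* x :* (y :* y) :* (z :* z) := x :* y :* z :* (x :* y :* z)) refl x x′ x″ ⟩
        x * x′ * x″ * (x * x′ * x″) ≡⟨ cong (λ n → n * n) n≡ ⟩
        κ n * κ n                   ≡⟨ κ-* n n ⟨
        κ (n ℤ.* n) ∎
    }
    where
    open ≡-Reasoning
    open CharPoly c
    x′ = σ x
    x″ = σ (σ x)
    σ-sq : σ (x * x) ≡ x′ * x′
    σ-sq = σ-* x x
    σσ-sq : σ (σ (x * x)) ≡ x″ * x″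
    σσ-sq = trans (cong σ σ-sq) (σ-* x′ x′)

  open CharPoly

  -- The even number n divides H(r, s) s, and `l m` has no root modulo 2, so s cannot be odd.
  norm-even⇒s-even : ∀ {x} → AlmostIntegral x → (c : CharPoly x) → + 2 ∣ n c → + 2 ∣ s c
  norm-even⇒s-even p c 2∣n = even-form m (proj₁ divisor) (s c) (ℤ.∣-trans 2∣n (proj₂ divisor))
    where divisor = norm-divides p c

  -- If t were odd, x - 1 would also have even norm, but its coefficient s - 2t + 3 would be odd.
  norm-even⇒t-even : ∀ {x} → AlmostIntegral x → (c : CharPoly x) → + 2 ∣ n c → + 2 ∣ t c
  norm-even⇒t-even p c 2∣n = s-even⇒t-even (t c) (s c) (n c) 2∣n (norm-even⇒s-even p c 2∣n)
    (norm-even⇒s-even (AI-- p (AI-κ (+ 1))) (charPoly-pred c))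

  -- Passing to x⁴ turns the factor 3 of the norm into 81 and keeps s prime to 3.
  three-splits : ∀ {x} → AlmostIntegral x → (c : CharPoly x) → + 3 ∣ n c → ¬ + 3 ∣ s c → + 81 ∣ m ℤ.- + 39
  three-splits {x} p c 3∣n 3∤s = root-mod-81 m (proj₁ divisor) (s c⁴) (fourth-power-s (t c) (s c) (n c) 3∣n 3∤s)
    (ℤ.∣-trans (fourth-power-81 (n c) 3∣n) (proj₂ divisor))
    where
    c⁴ = charPoly-square (charPoly-square c)
    p² = AI-* p p
    divisor = norm-divides (AI-* p² p²) c⁴

  ι-injective : ∀ {p q} → ι p ≡ ι q → p ≡ q
  ι-injective {p} {q} eq with p ℚ.- q ℚ.≟ 0ℚ
  ... | yes p-q≡0 = x∙y⁻¹≈ε⇒x≈y p q p-q≡0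
    where open GroupProperties ℚ.+-0-group
  ... | no p-q≢0 = contradiction (reflexive (begin
      0#                          ≡⟨ κ0 ⟨
      κ (+ 0)                     ≡⟨ solve 2 (λ x y → con (+ 0) := y :* (x :- x)) refl (ι q) (ι d⁻¹) ⟩
      ι d⁻¹ * (ι q - ι q)         ≡⟨ cong (λ t → ι d⁻¹ * (t - ι q)) eq ⟨
      ι d⁻¹ * (ι p - ι q)         ≡⟨ cong (λ t → ι d⁻¹ * (ι p + t)) (≈⇒≡ (-‿homo q)) ⟨
      ι d⁻¹ * (ι p + ι (ℚ.- q))   ≡⟨ cong (ι d⁻¹ *_) (≈⇒≡ (+-homo p (ℚ.- q))) ⟨
      ι d⁻¹ * ι d                 ≡⟨ ≈⇒≡ (*-homo d⁻¹ d) ⟨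
      ι (d⁻¹ ℚ.* d)               ≡⟨ cong ι (ℚ.*-inverseˡ d) ⟩
      ι 1ℚ                        ≡⟨ ≈⇒≡ 1#-homo ⟩
      1#                          ∎)) 0≉1
    where
    open ≡-Reasoning
    open NumberField K using (0≉1; reflexive)
    d = p ℚ.- q
    instance _ = ℚ.≢-nonZero p-q≢0
    d⁻¹ = ℚ.1/ d

  F-value : ∀ {θ} (c : CharPoly θ) z →
    F K θ (fromℤ z) ≡ fromℤ (χ (t c) (s c) (n c) z)
  F-value {θ} c z = ι-injective (begin
    ι (F K θ (fromℤ z)) ≡⟨ F-norm θ z ⟩
    (κ z - θ) * (κ z - σ θ) * (κ z - σ (σ θ))
      ≡⟨ solve 4 (λ X x y z → (X :- x) :* (X :- y) :* (X :- z)
           := X :* X :* X :- (x :+ y :+ z) :* X :* X :+ (x :* y :+ y :* z :+ z :* x) :* X :- x :* y :* z) refl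
           (κ z) θ (σ θ) (σ (σ θ)) ⟩
    κ z * κ z * κ z - (θ + σ θ + σ (σ θ)) * κ z * κ z + (θ * σ θ + σ θ * σ (σ θ) + σ (σ θ) * θ) * κ z - θ * σ θ * σ (σ θ)
      ≡⟨ cong₂ (λ t s → κ z * κ z * κ z - t * κ z * κ z + s * κ z - θ * σ θ * σ (σ θ)) (t≡ c) (s≡ c) ⟩
    κ z * κ z * κ z - κ (t c) * κ z * κ z + κ (s c) * κ z - θ * σ θ * σ (σ θ)
      ≡⟨ cong (λ n → κ z * κ z * κ z - κ (t c) * κ z * κ z + κ (s c) * κ z - n) (n≡ c) ⟩
    κ z * κ z * κ z - κ (t c) * κ z * κ z + κ (s c) * κ z - κ (n c)
      ≡⟨ κ-⟦⟧ (let X = var 0F; t = var 1F; s = var 2F; n = var 3F in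
           X :* X :* X :- t :* X :* X :+ s :* X :- n) (z ∷ t c ∷ s c ∷ n c ∷ []) ⟨
    κ (z ℤ.* z ℤ.* z ℤ.- t c ℤ.* z ℤ.* z ℤ.+ s c ℤ.* z ℤ.- n c) ∎)
    where open ≡-Reasoning

  root-of-charPoly : ∀ {x} (c : CharPoly x) →
    x * x * x - κ (t c) * (x * x) + κ (s c) * x - κ (n c) ≡ κ (+ 0)
  root-of-charPoly {x} c = begin
    x * x * x - κ (t c) * (x * x) + κ (s c) * x - κ (n c)
      ≡⟨ cong₂ (λ t s → x * x * x - t * (x * x) + s * x - κ (n c)) (t≡ c) (s≡ c) ⟨
    x * x * x - (x + σ x + σ (σ x)) * (x * x) + (x * σ x + σ x * σ (σ x) + σ (σ x) * x) * x - κ (n c)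
      ≡⟨ cong (λ n → x * x * x - (x + σ x + σ (σ x)) * (x * x) + (x * σ x + σ x * σ (σ x) + σ (σ x) * x) * x - n) (n≡ c) ⟨
    x * x * x - (x + σ x + σ (σ x)) * (x * x) + (x * σ x + σ x * σ (σ x) + σ (σ x) * x) * x - x * σ x * σ (σ x)
      ≡⟨ solve 3 (λ x y z → x :* x :* x :- (x :+ y :+ z) :* (x :* x) :+ (x :* y :+ y :* z :+ z :* x) :* x :- x :* y :* z := con (+ 0))
           refl x (σ x) (σ (σ x)) ⟩
    κ (+ 0) ∎
    where open ≡-Reasoning

  cubic-integral : ∀ {x} a b c → x * x * x + κ a * (x * x) + κ b * x + κ c ≡ κ (+ 0) → Integral K x
  cubic-integral {x} a b c eq = c ∷ b ∷ a ∷ [] , reflexive (begin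
    κ c + x * (κ b + x * (κ a + x * (κ (+ 1) + x * 0#)))
      ≡⟨ cong (λ z → κ c + x * (κ b + x * (κ a + x * (κ (+ 1) + x * z)))) κ0 ⟨
    κ c + x * (κ b + x * (κ a + x * (κ (+ 1) + x * κ (+ 0))))
      ≡⟨ solve 4 (λ x a b c → c :+ x :* (b :+ x :* (a :+ x :* (con (+ 1) :+ x :* con (+ 0))))
           := x :* x :* x :+ a :* (x :* x) :+ b :* x :+ c) refl x (κ a) (κ b) (κ c) ⟩
    x * x * x + κ a * (x * x) + κ b * x + κ c ≡⟨ eq ⟩
    κ (+ 0) ≡⟨ κ0 ⟩
    0# ∎)
    where
    open ≡-Reasoning
    open NumberField K using (reflexive)

  CharPoly⇒Integral : ∀ {x} → CharPoly x → Integral K x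
  CharPoly⇒Integral {x} c = cubic-integral (ℤ.- t c) (s c) (ℤ.- n c) (begin
    x * x * x + κ (ℤ.- t c) * (x * x) + κ (s c) * x + κ (ℤ.- n c)
      ≡⟨ cong₂ (λ t n → x * x * x + t * (x * x) + κ (s c) * x + n) (κ-neg (t c)) (κ-neg (n c)) ⟩
    x * x * x + (- κ (t c)) * (x * x) + κ (s c) * x - κ (n c)
      ≡⟨ solve 4 (λ x t s n → x :* x :* x :+ :- t :* (x :* x) :+ s :* x :- n := x :* x :* x :- t :* (x :* x) :+ s :* x :- n) refl x (κ (t c)) (κ (s c)) (κ (n c)) ⟩
    x * x * x - κ (t c) * (x * x) + κ (s c) * x - κ (n c) ≡⟨ root-of-charPoly c ⟩
    κ (+ 0) ∎)
    where open ≡-Reasoning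

  AI⇒Integral : ∀ {x} → AlmostIntegral x → Integral K x
  AI⇒Integral p = CharPoly⇒Integral (charPoly p)

  -- The values at x of the tails of a monic polynomial p with p(x) = 0 span a
  -- finitely generated module that is stable under multiplication by x.
  module _ {x : Carrier} where
    private
      ev : List ℤ → Carrier
      ev p = evalℤ K p x

    Tails : ℤ → ℕ → List ℤ → Set
    Tails D k []      = ⊤
    Tails D k (c ∷ p) = O (κ D * (x ^ k * ev (c ∷ p))) × Tails D k p

    tails-scale : ∀ e D k p → Tails D k p → Tails (e ℤ.* D) k p
    tails-scale e D k []      _        = tt
    tails-scale e D k (c ∷ p) (h , hs) = subst O
      (trans (solve 3 (λ e D v → e :* (D :* v) := e :* D :* v) refl (κ e) (κ D) (x ^ k * ev (c ∷ p)))
        (cong (_* (x ^ k * ev (c ∷ p))) (sym (κ-* e D)))) (O-κ* e h) , tails-scale e D k p hs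

    tails-denominator : ∀ p → ∃ λ D → D ≢ + 0 × Tails D 0 p
    tails-denominator [] = + 1 , (λ ()) , tt
    tails-denominator (c ∷ p) = E ℤ.* D , *-≢0 E≢0 D≢0 ,
      subst O (trans (solve 3 (λ D E v → D :* (E :* v) := E :* D :* (con (+ 1) :* v)) refl (κ D) (κ E) (ev (c ∷ p)))
          (cong (_* (κ (+ 1) * ev (c ∷ p))) (sym (κ-* E D))))
        (O-κ* D (proj₂ (proj₂ coords))) ,
      tails-scale E D 0 p (proj₂ (proj₂ tails))
      where
      tails = tails-denominator p
      D = proj₁ tails
      D≢0 = proj₁ (proj₂ tails)
      coords = coordinates (ev (c ∷ p))
      E = proj₁ coords
      E≢0 = proj₁ (proj₂ coords)

    -- The last nonempty tail of a monic polynomial is the constant 1.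
    last : ∀ D k p → Tails D k (p ∷ʳ + 1) → O (κ D * x ^ k)
    last D k [] (h , _) = subst O (trans
      (cong (λ z → κ D * (x ^ k * (κ (+ 1) + x * z))) (sym κ0))
      (solve 3 (λ D v x → D :* (v :* (con (+ 1) :+ x :* con (+ 0))) := D :* v) refl (κ D) (x ^ k) x)) h
    last D k (c ∷ p) (_ , hs) = last D k p hs

    -- A tail has the value c + x e, where e is the value of the next one; hence x^(k+1) e is a
    -- combination of elements already known.
    shift : ∀ D k c p → O (κ D * x ^ k) → O (κ D * (x ^ k * ev (c ∷ p))) → O (κ D * (x ^ suc k * ev p))
    shift D k c p u h = subst O
      (solve 5 (λ D v c x e → D :* (v :* (c :+ x :* e)) :- c :* (D :* v) := D :* (x :* v :* e)) refl
        (κ D) (x ^ k) (κ c) x (ev p))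
      (O-- h (O-κ* c u))

    -- Each tail receives its membership for x^(k+1) from the preceding tail for x^k; only the first
    -- one must be supplied.
    shift-tails : ∀ D k p → O (κ D * x ^ k) → O (κ D * (x ^ suc k * ev p)) → Tails D k p → Tails D (suc k) p
    shift-tails D k []      u h _          = tt
    shift-tails D k (c ∷ p) u h (h₀ , hs) = h , shift-tails D k p u (shift D k c p u h₀) hs

    Integral⇒AI : Integral K x → AlmostIntegral x
    Integral⇒AI (p , root) = D , proj₁ (proj₂ start) , λ k → last D k p (tails k)
      where
      start = tails-denominator (p ∷ʳ + 1)
      D = proj₁ start
      tails : ∀ k → Tails D k (p ∷ʳ + 1)
      tails zero    = proj₂ (proj₂ start)
      -- The first tail is the whole polynomial, whose value is 0.
      tails (suc k) = shift-tails D k (p ∷ʳ + 1) (last D k p (tails k))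
        (subst O (sym (trans (cong (λ e → κ D * (x ^ suc k * e)) (trans (≈⇒≡ root) (sym κ0)))
          (solve 2 (λ D v → D :* (v :* con (+ 0)) := con (+ 0)) refl (κ D) (x ^ suc k)))) (O-κ (+ 0)))
        (tails k)

  -- The values i(θ)

  value : ∀ {θ} → CharPoly θ → ℤ → ℤ
  value c = χ (t c) (s c) (n c)

  divisor-of-values : ∀ {θ} → AlmostIntegral θ → (c : CharPoly θ) → ∀ g → (∀ z → g ∣ value c z) → g ∣ + 3
  divisor-of-values p c g g∣ = χ-divisor (t c) (s c) (n c) g
    (λ 2∣g → χ-even (t c) (s c) (n c) (norm-even⇒s-even p c) (norm-even⇒t-even p c)
      (ℤ.∣-trans 2∣g (g∣ (+ 0))) (ℤ.∣-trans 2∣g (g∣ (+ 1)))) g∣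

  valueGcd-divides : ∀ {θ g} (c : CharPoly θ) → ValueGcd K θ g → ∀ z → + g ∣ value c z
  valueGcd-divides {g = g} c isGcd z = ℤ.∣ᵤ⇒∣ (IsGcd.divides-all isGcd _ (z , value c z , F-value c z , refl))

  valueGcd-3 : ∀ {θ g} → Integral K θ → ValueGcd K θ g → g ℕ.∣ 3
  valueGcd-3 int isGcd = ℤ.∣⇒∣ᵤ (divisor-of-values p c _ (valueGcd-divides c isGcd))
    where
    p = Integral⇒AI int
    c = charPoly p

  valueGcd-1 : ∀ {θ g} → ¬ + 81 ∣ m ℤ.- + 39 → Integral K θ → ValueGcd K θ g → g ≡ 1
  valueGcd-1 {g = g} 81∤ int isGcd = [ (λ g≡1 → g≡1) , (λ g≡3 → contradiction (81∣ g≡3) 81∤) ]′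
    (prime⇒irreducible (from-yes (prime? 3)) (valueGcd-3 int isGcd))
    where
    p = Integral⇒AI int
    c = charPoly p
    g∣ = valueGcd-divides c isGcd
    81∣ : g ≡ 3 → + 81 ∣ m ℤ.- + 39
    81∣ refl = three-splits p c (χ-three-n (t c) (s c) (n c) (g∣ (+ 0)))
      (χ-three-s (t c) (s c) (n c) (g∣ (+ 0)) (g∣ (+ 1)) (g∣ -[1+ 0 ]))

  fieldValueLcm-1 : ¬ + 81 ∣ m ℤ.- + 39 → FieldValueLcm K 1
  fieldValueLcm-1 81∤ = record
    { multiple-of-all = λ { g (θ , (int , _) , isGcd) → ℕ.∣-reflexive (valueGcd-1 81∤ int isGcd) }
    ; least = λ c _ → ℕ.1∣ c
    }

  quadratic⇒primitive : ∀ {θ} → (∀ x → ∃ λ D → D ≢ + 0 × ∃ λ a → ∃₂ λ b c →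
    κ D * x ≡ κ a + κ b * θ + κ c * (θ * θ)) → Primitive K θ
  quadratic⇒primitive {θ} quadratic x = fromℤ a ∷ fromℤ b ∷ fromℤ c ∷ [] , fromℤ D ∷ []
    , (λ eq → κ≢0 D≢0 (trans (sym constant) (trans (≈⇒≡ eq) (sym κ0))))
    , reflexive (begin
        x * (κ D + θ * 0#)  ≡⟨ cong (x *_) constant ⟩
        x * κ D             ≡⟨ solve 2 (λ x D → x :* D := D :* x) refl x (κ D) ⟩
        κ D * x             ≡⟨ eq ⟩
        κ a + κ b * θ + κ c * (θ * θ)
          ≡⟨ solve 4 (λ a b c θ → a :+ b :* θ :+ c :* (θ :* θ)
               := a :+ θ :* (b :+ θ :* (c :+ θ :* con (+ 0)))) refl (κ a) (κ b) (κ c) θ ⟩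
        κ a + θ * (κ b + θ * (κ c + θ * κ (+ 0)))
          ≡⟨ cong (λ z → κ a + θ * (κ b + θ * (κ c + θ * z))) κ0 ⟩
        κ a + θ * (κ b + θ * (κ c + θ * 0#)) ∎)
    where
    open ≡-Reasoning
    open NumberField K using (reflexive)
    coords = quadratic x
    D = proj₁ coords
    D≢0 = proj₁ (proj₂ coords)
    a = proj₁ (proj₂ (proj₂ coords))
    b = proj₁ (proj₂ (proj₂ (proj₂ coords)))
    c = proj₁ (proj₂ (proj₂ (proj₂ (proj₂ coords))))
    eq = proj₂ (proj₂ (proj₂ (proj₂ (proj₂ coords))))
    constant : κ D + θ * 0# ≡ κ D
    constant = trans (cong (λ z → κ D + θ * z) (sym κ0))
      (solve 2 (λ D θ → D :+ θ :* con (+ 0) := D) refl (κ D) θ)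

  -- The integer θ = (ρ − k)/3 with k = m/3 has F_θ(x) = x³ − a x − 3ab.
  module Split (u : ℤ) (m≡ : m ≡ + 39 ℤ.+ + 81 ℤ.* u) where
    private
      k a b : ℤ
      -- These are k = m/3, a = (k² + k + 1)/3 and b = (2k + 1)/27. The last is an integer exactly
      -- when k ≡ 13 modulo 27, that is, m ≡ 39 modulo 81.
      k = + 13 ℤ.+ + 27 ℤ.* u
      a = + 61 ℤ.+ + 243 ℤ.* u ℤ.+ + 243 ℤ.* u ℤ.* u
      b = + 1 ℤ.+ + 2 ℤ.* u

      kᴾ aᴾ bᴾ mᴾ : Polynomial 1
      kᴾ = con (+ 13) :+ con (+ 27) :* var 0F
      aᴾ = con (+ 61) :+ con (+ 243) :* var 0F :+ con (+ 243) :* var 0F :* var 0F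
      bᴾ = con (+ 1) :+ con (+ 2) :* var 0F
      mᴾ = con (+ 39) :+ con (+ 81) :* var 0F

      U = κ u

    θ : Carrier
    θ = ι (+ 1 ℚ./ 3) * (ρ - κ k)

    3θ≡ : κ (+ 3) * θ ≡ ρ - κ k
    3θ≡ = begin
      κ (+ 3) * (ι (+ 1 ℚ./ 3) * (ρ - κ k)) ≡⟨ solve 3 (λ a b c → a :* (b :* c) := (a :* b) :* c) refl (κ (+ 3)) (ι (+ 1 ℚ./ 3)) (ρ - κ k) ⟩
      κ (+ 3) * ι (+ 1 ℚ./ 3) * (ρ - κ k)   ≡⟨ cong (_* (ρ - κ k)) (≈⇒≡ (*-homo (fromℤ (+ 3)) (+ 1 ℚ./ 3))) ⟨
      κ (+ 1) * (ρ - κ k)                   ≡⟨ solve 1 (λ a → con (+ 1) :* a := a) refl (ρ - κ k) ⟩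
      ρ - κ k ∎
      where open ≡-Reasoning

    3σ≡ : ∀ {x y} → κ (+ 3) * x ≡ y - κ k → κ (+ 3) * σ x ≡ σ y - κ k
    3σ≡ {x} {y} eq = trans (sym (trans (σ-* (κ (+ 3)) x) (cong (_* σ x) (σ-κ (+ 3)))))
      (trans (cong σ eq) (trans (σ-- y (κ k)) (cong (λ t → σ y - t) (σ-κ k))))

    private
      x₀ x₁ x₂ y₀ y₁ y₂ : Carrier
      x₀ = θ
      x₁ = σ θ
      x₂ = σ (σ θ)
      y₀ = κ (+ 3) * x₀
      y₁ = κ (+ 3) * x₁
      y₂ = κ (+ 3) * x₂
      eq₀ : y₀ ≡ ρ - κ k
      eq₀ = 3θ≡
      eq₁ : y₁ ≡ σ ρ - κ k
      eq₁ = 3σ≡ eq₀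
      eq₂ : y₂ ≡ σ (σ ρ) - κ k
      eq₂ = 3σ≡ eq₁
      κk≡ : κ k ≡ ⟦ kᴾ ⟧ (U ∷ [])
      κk≡ = κ-⟦⟧ kᴾ (u ∷ [])
      κm≡ : κ m ≡ ⟦ mᴾ ⟧ (U ∷ [])
      κm≡ = trans (cong κ m≡) (κ-⟦⟧ mᴾ (u ∷ []))

    -- Multiplied by 3, 9 and 27, the coefficients become symmetric functions of the conjugates of ρ
    -- - k, free of denominators. The norm of ρ - k is (k² + k + 1)(2k + 1) = 81 a b.
    θ-charPoly : CharPoly θ
    θ-charPoly = record
      { t = + 0 ; s = ℤ.- a ; n = + 3 ℤ.* a ℤ.* b
      ; t≡ = κ-cancelˡ (+ 3) (λ ()) (begin
          κ (+ 3) * (x₀ + x₁ + x₂)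
            ≡⟨ solve 3 (λ x y z → con (+ 3) :* (x :+ y :+ z) := con (+ 3) :* x :+ con (+ 3) :* y :+ con (+ 3) :* z) refl x₀ x₁ x₂ ⟩
          y₀ + y₁ + y₂
            ≡⟨ cong₂ (λ z w → z + w + y₂) eq₀ eq₁ ⟩
          ρ - κ k + (σ ρ - κ k) + y₂
            ≡⟨ cong (λ w → ρ - κ k + (σ ρ - κ k) + w) eq₂ ⟩
          ρ - κ k + (σ ρ - κ k) + (σ (σ ρ) - κ k)
            ≡⟨ solve 4 (λ x y z k → x :- k :+ (y :- k) :+ (z :- k) := x :+ y :+ z :- con (+ 3) :* k) refl ρ (σ ρ) (σ (σ ρ)) (κ k) ⟩
          ρ + σ ρ + σ (σ ρ) - κ (+ 3) * κ k
            ≡⟨ cong₂ (λ t k → t - κ (+ 3) * k) (trans ρ-trace κm≡) κk≡ ⟩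
          ⟦ mᴾ ⟧ (U ∷ []) - κ (+ 3) * ⟦ kᴾ ⟧ (U ∷ [])
            ≡⟨ solve 1 (λ u → (con (+ 39) :+ con (+ 81) :* u) :- con (+ 3) :* (con (+ 13) :+ con (+ 27) :* u) := con (+ 3) :* con (+ 0)) refl U ⟩
          κ (+ 3) * κ (+ 0) ∎)
      ; s≡ = κ-cancelˡ (+ 9) (λ ()) (begin
          κ (+ 9) * (x₀ * x₁ + x₁ * x₂ + x₂ * x₀)
            ≡⟨ solve 3 (λ x y z → con (+ 9) :* (x :* y :+ y :* z :+ z :* x) := (con (+ 3) :* x) :* (con (+ 3) :* y)
                 :+ (con (+ 3) :* y) :* (con (+ 3) :* z) :+ (con (+ 3) :* z) :* (con (+ 3) :* x)) refl x₀ x₁ x₂ ⟩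
          y₀ * y₁ + y₁ * y₂ + y₂ * y₀
            ≡⟨ cong₂ (λ z w → z * w + w * y₂ + y₂ * z) eq₀ eq₁ ⟩
          (ρ - κ k) * (σ ρ - κ k) + (σ ρ - κ k) * y₂ + y₂ * (ρ - κ k)
            ≡⟨ cong (λ w → (ρ - κ k) * (σ ρ - κ k) + (σ ρ - κ k) * w + w * (ρ - κ k)) eq₂ ⟩
          (ρ - κ k) * (σ ρ - κ k) + (σ ρ - κ k) * (σ (σ ρ) - κ k) + (σ (σ ρ) - κ k) * (ρ - κ k)
            ≡⟨ solve 4 (λ x y z k → (x :- k) :* (y :- k) :+ (y :- k) :* (z :- k) :+ (z :- k) :* (x :- k)
                 := x :* y :+ y :* z :+ z :* x :- con (+ 2) :* k :* (x :+ y :+ z) :+ con (+ 3) :* k :* k)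
                 refl ρ (σ ρ) (σ (σ ρ)) (κ k) ⟩
          ρ * σ ρ + σ ρ * σ (σ ρ) + σ (σ ρ) * ρ - κ (+ 2) * κ k * (ρ + σ ρ + σ (σ ρ)) + κ (+ 3) * κ k * κ k
            ≡⟨ cong₂ (λ s t → s - κ (+ 2) * κ k * t + κ (+ 3) * κ k * κ k) ρ-pairs ρ-trace ⟩
          - (κ m + κ (+ 3)) - κ (+ 2) * κ k * κ m + κ (+ 3) * κ k * κ k
            ≡⟨ cong₂ (λ m k → - (m + κ (+ 3)) - κ (+ 2) * k * m + κ (+ 3) * k * k) κm≡ κk≡ ⟩
          - (⟦ mᴾ ⟧ (U ∷ []) + κ (+ 3)) - κ (+ 2) * ⟦ kᴾ ⟧ (U ∷ []) * ⟦ mᴾ ⟧ (U ∷ []) + κ (+ 3) * ⟦ kᴾ ⟧ (U ∷ []) * ⟦ kᴾ ⟧ (U ∷ [])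
            ≡⟨ solve 1 (λ u → let m = con (+ 39) :+ con (+ 81) :* u ; k = con (+ 13) :+ con (+ 27) :* u in
                 :- (m :+ con (+ 3)) :- con (+ 2) :* k :* m :+ con (+ 3) :* k :* k
                 := con (+ 9) :* (:- (con (+ 61) :+ con (+ 243) :* u :+ con (+ 243) :* u :* u))) refl U ⟩
          κ (+ 9) * (- ⟦ aᴾ ⟧ (U ∷ [])) ≡⟨ cong (κ (+ 9) *_) (κ-⟦⟧ (:- aᴾ) (u ∷ [])) ⟨
          κ (+ 9) * κ (ℤ.- a) ∎)
      ; n≡ = κ-cancelˡ (+ 27) (λ ()) (begin
          κ (+ 27) * (x₀ * x₁ * x₂)
            ≡⟨ solve 3 (λ x y z → con (+ 27) :* (x :* y :* z) := (con (+ 3) :* x) :* (con (+ 3) :* y) :* (con (+ 3) :* z))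
                 refl x₀ x₁ x₂ ⟩
          y₀ * y₁ * y₂
            ≡⟨ cong₂ (λ z w → z * w * y₂) eq₀ eq₁ ⟩
          (ρ - κ k) * (σ ρ - κ k) * y₂
            ≡⟨ cong (λ w → (ρ - κ k) * (σ ρ - κ k) * w) eq₂ ⟩
          (ρ - κ k) * (σ ρ - κ k) * (σ (σ ρ) - κ k)
            ≡⟨ solve 4 (λ x y z k → (x :- k) :* (y :- k) :* (z :- k)
                 := x :* y :* z :- k :* (x :* y :+ y :* z :+ z :* x) :+ k :* k :* (x :+ y :+ z) :- k :* k :* k)
                 refl ρ (σ ρ) (σ (σ ρ)) (κ k) ⟩
          ρ * σ ρ * σ (σ ρ) - κ k * (ρ * σ ρ + σ ρ * σ (σ ρ) + σ (σ ρ) * ρ) + κ k * κ k * (ρ + σ ρ + σ (σ ρ)) - κ k * κ k * κ k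
            ≡⟨ cong₂ (λ s t → ρ * σ ρ * σ (σ ρ) - κ k * s + κ k * κ k * t - κ k * κ k * κ k) ρ-pairs ρ-trace ⟩
          ρ * σ ρ * σ (σ ρ) - κ k * (- (κ m + κ (+ 3))) + κ k * κ k * κ m - κ k * κ k * κ k
            ≡⟨ cong (λ n → n - κ k * (- (κ m + κ (+ 3))) + κ k * κ k * κ m - κ k * κ k * κ k) ρ-norm ⟩
          κ (+ 1) - κ k * (- (κ m + κ (+ 3))) + κ k * κ k * κ m - κ k * κ k * κ k
            ≡⟨ cong₂ (λ m k → κ (+ 1) - k * (- (m + κ (+ 3))) + k * k * m - k * k * k) κm≡ κk≡ ⟩
          κ (+ 1) - ⟦ kᴾ ⟧ (U ∷ []) * (- (⟦ mᴾ ⟧ (U ∷ []) + κ (+ 3))) + ⟦ kᴾ ⟧ (U ∷ []) * ⟦ kᴾ ⟧ (U ∷ []) * ⟦ mᴾ ⟧ (U ∷ [])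
            - ⟦ kᴾ ⟧ (U ∷ []) * ⟦ kᴾ ⟧ (U ∷ []) * ⟦ kᴾ ⟧ (U ∷ [])
            ≡⟨ solve 1 (λ u → let m = con (+ 39) :+ con (+ 81) :* u ; k = con (+ 13) :+ con (+ 27) :* u in
                 con (+ 1) :- k :* (:- (m :+ con (+ 3))) :+ k :* k :* m :- k :* k :* k
                 := con (+ 27) :* (con (+ 3) :* (con (+ 61) :+ con (+ 243) :* u :+ con (+ 243) :* u :* u) :* (con (+ 1) :+ con (+ 2) :* u))) refl U ⟩
          κ (+ 27) * (κ (+ 3) * ⟦ aᴾ ⟧ (U ∷ []) * ⟦ bᴾ ⟧ (U ∷ [])) ≡⟨ cong (κ (+ 27) *_) (κ-⟦⟧ (con (+ 3) :* aᴾ :* bᴾ) (u ∷ [])) ⟨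
          κ (+ 27) * κ (+ 3 ℤ.* a ℤ.* b) ∎)
      }
      where open ≡-Reasoning

    θ-integral : Integral K θ
    θ-integral = CharPoly⇒Integral θ-charPoly

    -- Coordinates with respect to ρ are rewritten by ρ = 3θ + k.
    θ-primitive : Primitive K θ
    θ-primitive = quadratic⇒primitive λ x → let D , D≢0 , a , b , c , eq = coordinates x in
      D , D≢0 , a ℤ.+ b ℤ.* k ℤ.+ c ℤ.* k ℤ.* k , + 3 ℤ.* b ℤ.+ + 6 ℤ.* c ℤ.* k , + 9 ℤ.* c , trans eq (begin
        κ a + κ b * ρ + κ c * (ρ * ρ)
          ≡⟨ cong (λ r → κ a + κ b * r + κ c * (r * r)) (trans (solve 2 (λ r k → r := r :- k :+ k) refl ρ (κ k)) (cong (_+ κ k) (sym 3θ≡))) ⟩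
        κ a + κ b * (κ (+ 3) * θ + κ k) + κ c * ((κ (+ 3) * θ + κ k) * (κ (+ 3) * θ + κ k))
          ≡⟨ solve 5 (λ a b c k θ → a :+ b :* (con (+ 3) :* θ :+ k) :+ c :* ((con (+ 3) :* θ :+ k) :* (con (+ 3) :* θ :+ k))
               := a :+ b :* k :+ c :* k :* k :+ (con (+ 3) :* b :+ con (+ 6) :* c :* k) :* θ :+ con (+ 9) :* c :* (θ :* θ))
               refl (κ a) (κ b) (κ c) (κ k) θ ⟩
        κ a + κ b * κ k + κ c * κ k * κ k + (κ (+ 3) * κ b + κ (+ 6) * κ c * κ k) * θ + κ (+ 9) * κ c * (θ * θ)
          ≡⟨ cong₂ (λ u v → u + v * θ + κ (+ 9) * κ c * (θ * θ))
               (κ-⟦⟧ (var 0F :+ var 1F :* var 3F :+ var 2F :* var 3F :* var 3F) (a ∷ b ∷ c ∷ k ∷ []))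
               (κ-⟦⟧ (con (+ 3) :* var 0F :+ con (+ 6) :* var 1F :* var 2F) (b ∷ c ∷ k ∷ [])) ⟨
        κ (a ℤ.+ b ℤ.* k ℤ.+ c ℤ.* k ℤ.* k) + κ (+ 3 ℤ.* b ℤ.+ + 6 ℤ.* c ℤ.* k) * θ + κ (+ 9) * κ c * (θ * θ)
          ≡⟨ cong (λ w → κ (a ℤ.+ b ℤ.* k ℤ.+ c ℤ.* k ℤ.* k) + κ (+ 3 ℤ.* b ℤ.+ + 6 ℤ.* c ℤ.* k) * θ + w * (θ * θ)) (κ-* (+ 9) c) ⟨
        κ (a ℤ.+ b ℤ.* k ℤ.+ c ℤ.* k ℤ.* k) + κ (+ 3 ℤ.* b ℤ.+ + 6 ℤ.* c ℤ.* k) * θ + κ (+ 9 ℤ.* c) * (θ * θ) ∎)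
      where open ≡-Reasoning

    θ-valueGcd : ValueGcd K θ 3
    θ-valueGcd = record
      { divides-all = λ { _ (x , z , F≡z , refl) → subst (λ z → 3 ℕ.∣ ℤ.∣ z ∣)
          (fromℤ-injective {value θ-charPoly x} {z} (trans (sym (F-value θ-charPoly x)) F≡z)) (ℤ.∣⇒∣ᵤ {+ 3} {value θ-charPoly x} (χ-split u x)) }
      ; greatest = λ g g∣ → ℤ.∣⇒∣ᵤ (divisor-of-values (Integral⇒AI θ-integral) θ-charPoly (+ g)
          λ z → ℤ.∣ᵤ⇒∣ (g∣ _ (z , value θ-charPoly z , F-value θ-charPoly z , refl)))
      }

  fieldValueLcm-3 : + 81 ∣ m ℤ.- + 39 → FieldValueLcm K 3
  fieldValueLcm-3 (divides u eq) = record
    { multiple-of-all = λ { g (θ , (int , _) , isGcd) → valueGcd-3 int isGcd }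
    ; least = λ c all∣c → all∣c 3 (θ , (θ-integral , θ-primitive) , θ-valueGcd)
    }
    where open Split u (minus-39 u eq)

  -- An integral basis

  -- Lagrange interpolation: Σⱼ xⱼ (ρⱼ − ρ′)(ρⱼ − ρ″) keeps only the term of x.
  different-* : ∀ x → κ δ * x ≡ (σ (σ ρ) - σ ρ) *
    (tr (ρ * (ρ * x)) - (σ ρ + σ (σ ρ)) * tr (ρ * x) + σ ρ * σ (σ ρ) * tr x)
  different-* x = trans (cong (_* x) (sym different)) (trans
    (solve 6 (λ r r′ r″ x x′ x″ → (r :- r′) :* (r′ :- r″) :* (r″ :- r) :* x := (r″ :- r′) :*
        ((r :* (r :* x) :+ r′ :* (r′ :* x′) :+ r″ :* (r″ :* x″))
          :- (r′ :+ r″) :* (r :* x :+ r′ :* x′ :+ r″ :* x″) :+ r′ :* r″ :* (x :+ x′ :+ x″)))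
      refl ρ (σ ρ) (σ (σ ρ)) x (σ x) (σ (σ x)))
    (cong₂ (λ u v → (σ (σ ρ) - σ ρ) * (u - (σ ρ + σ (σ ρ)) * v + σ ρ * σ (σ ρ) * tr x))
      (sym tr-ρρx) (sym (tr-ρ* x))))
    where
    tr-ρ* : ∀ x → tr (ρ * x) ≡ ρ * x + σ ρ * σ x + σ (σ ρ) * σ (σ x)
    tr-ρ* x = cong₂ (λ u v → ρ * x + u + v) (σ-* ρ x) (trans (cong σ (σ-* ρ x)) (σ-* (σ ρ) (σ x)))
    tr-ρρx : tr (ρ * (ρ * x)) ≡ ρ * (ρ * x) + σ ρ * (σ ρ * σ x) + σ (σ ρ) * (σ (σ ρ) * σ (σ x))
    tr-ρρx = trans (tr-ρ* (ρ * x)) (cong₂ (λ u v → ρ * (ρ * x) + σ ρ * u + σ (σ ρ) * v) (σ-* ρ x)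
      (trans (cong σ (σ-* ρ x)) (σ-* (σ ρ) (σ x))))

  private
    O-ρ′ = O-σρ
    O-ρ″ = O-σ O-σρ
    AI-ρ = O⇒AI O-ρ

    -- The right-hand side of `different-*`, with the three traces replaced by arbitrary elements of
    -- ℤ[ρ].
    O-dual : ∀ {u v w} → O u → O v → O w → O ((σ (σ ρ) - σ ρ) * (u - (σ ρ + σ (σ ρ)) * v + σ ρ * σ (σ ρ) * w))
    O-dual Ou Ov Ow = O-* (O-- O-ρ″ O-ρ′)
      (O-+ (O-- Ou (O-* (O-+ O-ρ′ O-ρ″) Ov)) (O-* (O-* O-ρ′ O-ρ″) Ow))

    O-tr : ∀ {x} → AlmostIntegral x → O (tr x)
    O-tr p = subst O (sym (proj₂ T)) (O-κ (proj₁ T))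
      where T = trace-integer p

  -- The traces in `different-*` are integers and its other factors lie in ℤ[ρ]. So δ is a common
  -- denominator for all of 𝔸.
  δ-O : ∀ {x} → AlmostIntegral x → O (κ δ * x)
  δ-O {x} p = subst O (sym (different-* x))
    (O-dual (O-tr (AI-* AI-ρ (AI-* AI-ρ p))) (O-tr (AI-* AI-ρ p)) (O-tr p))

  δ≢0 : δ ≢ + 0
  δ≢0 = odd≢0 m (proj₁ δ-odd) (proj₂ δ-odd)

  Norm : Carrier → ℤ → Set
  Norm x n = x * σ x * σ (σ x) ≡ κ n

  -- ρ is a unit of norm 1.
  norm-ρ* : ∀ {x n} → Norm x n → Norm (ρ * x) n
  norm-ρ* {x} {n} eq = begin
    ρ * x * σ (ρ * x) * σ (σ (ρ * x))
      ≡⟨ cong₂ (λ u v → ρ * x * u * v) (σ-* ρ x) (trans (cong σ (σ-* ρ x)) (σ-* (σ ρ) (σ x))) ⟩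
    ρ * x * (σ ρ * σ x) * (σ (σ ρ) * σ (σ x))
      ≡⟨ solve 6 (λ r r′ r″ x x′ x″ → r :* x :* (r′ :* x′) :* (r″ :* x″) := r :* r′ :* r″ :* (x :* x′ :* x″)) refl
           ρ (σ ρ) (σ (σ ρ)) x (σ x) (σ (σ x)) ⟩
    ρ * σ ρ * σ (σ ρ) * (x * σ x * σ (σ x)) ≡⟨ cong₂ _*_ ρ-norm eq ⟩
    κ (+ 1) * κ n                           ≡⟨ solve 1 (λ n → con (+ 1) :* n := n) refl (κ n) ⟩
    κ n ∎
    where open ≡-Reasoning

  trace-even : ∀ {x n} → AlmostIntegral x → Norm x n → + 2 ∣ n → ∃ λ h → tr x ≡ κ (+ 2) * κ h
  trace-even {x} {n′} p Nx 2∣n = _∣_.quotient 2∣t , (begin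
    tr x                          ≡⟨ t≡ c ⟩
    κ (t c)                       ≡⟨ cong κ (_∣_.equality 2∣t) ⟩
    κ (_∣_.quotient 2∣t ℤ.* + 2)  ≡⟨ cong κ (ℤ.*-comm (_∣_.quotient 2∣t) (+ 2)) ⟩
    κ (+ 2 ℤ.* _∣_.quotient 2∣t)  ≡⟨ κ-* (+ 2) (_∣_.quotient 2∣t) ⟩
    κ (+ 2) * κ (_∣_.quotient 2∣t) ∎)
    where
    open ≡-Reasoning
    c = charPoly p
    2∣t : + 2 ∣ t c
    2∣t = norm-even⇒t-even p c (subst (+ 2 ∣_) (κ-injective {n′} {n c} (trans (sym Nx) (n≡ c))) 2∣n)

  -- The norms of x, ρx and ρ²x are even, hence so are their traces; and δ is odd.
  norm-even⇒half : ∀ {x n} → AlmostIntegral x → Norm x n → + 2 ∣ n → ∃ λ y → AlmostIntegral y × x ≡ κ (+ 2) * y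
  -- With δ = 1 + 2k one has x = δx - 2kx, and δx = 2W.
  norm-even⇒half {x} {n} p Nx 2∣n = W - κ k * x , AI-- (O⇒AI OW) (AI-* (AI-κ k) p) , (begin
      x ≡⟨ solve 2 (λ x k → x := (con (+ 1) :+ k :* con (+ 2)) :* x :- con (+ 2) :* (k :* x)) refl x (κ k) ⟩
      (κ (+ 1) + κ k * κ (+ 2)) * x - κ (+ 2) * (κ k * x)
        ≡⟨ cong (λ d → d * x - κ (+ 2) * (κ k * x)) (trans (cong κ (proj₂ δ-odd)) (κ-⟦⟧ (con (+ 1) :+ var 0F :* con (+ 2)) (k ∷ []))) ⟨
      κ δ * x - κ (+ 2) * (κ k * x) ≡⟨ cong (_- κ (+ 2) * (κ k * x)) δx ⟩
      κ (+ 2) * W - κ (+ 2) * (κ k * x)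
        ≡⟨ solve 3 (λ W k x → con (+ 2) :* W :- con (+ 2) :* (k :* x) := con (+ 2) :* (W :- k :* x)) refl W (κ k) x ⟩
      κ (+ 2) * (W - κ k * x) ∎)
    where
    open ≡-Reasoning
    k = proj₁ δ-odd
    T₀ = trace-even p Nx 2∣n
    T₁ = trace-even (AI-* AI-ρ p) (norm-ρ* {n = n} Nx) 2∣n
    T₂ = trace-even (AI-* AI-ρ (AI-* AI-ρ p)) (norm-ρ* {n = n} (norm-ρ* {n = n} Nx)) 2∣n
    h₀ = proj₁ T₀
    h₁ = proj₁ T₁
    h₂ = proj₁ T₂
    W = (σ (σ ρ) - σ ρ) * (κ h₂ - (σ ρ + σ (σ ρ)) * κ h₁ + σ ρ * σ (σ ρ) * κ h₀)
    OW : O W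
    OW = O-dual (O-κ h₂) (O-κ h₁) (O-κ h₀)
    δx : κ δ * x ≡ κ (+ 2) * W
    δx = begin
      κ δ * x ≡⟨ different-* x ⟩
      (σ (σ ρ) - σ ρ) * (tr (ρ * (ρ * x)) - (σ ρ + σ (σ ρ)) * tr (ρ * x) + σ ρ * σ (σ ρ) * tr x)
        ≡⟨ cong₂ (λ u v → (σ (σ ρ) - σ ρ) * (u - (σ ρ + σ (σ ρ)) * v + σ ρ * σ (σ ρ) * tr x)) (proj₂ T₂) (proj₂ T₁) ⟩
      (σ (σ ρ) - σ ρ) * (κ (+ 2) * κ h₂ - (σ ρ + σ (σ ρ)) * (κ (+ 2) * κ h₁) + σ ρ * σ (σ ρ) * tr x)
        ≡⟨ cong (λ w → (σ (σ ρ) - σ ρ) * (κ (+ 2) * κ h₂ - (σ ρ + σ (σ ρ)) * (κ (+ 2) * κ h₁) + σ ρ * σ (σ ρ) * w)) (proj₂ T₀) ⟩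
      (σ (σ ρ) - σ ρ) * (κ (+ 2) * κ h₂ - (σ ρ + σ (σ ρ)) * (κ (+ 2) * κ h₁) + σ ρ * σ (σ ρ) * (κ (+ 2) * κ h₀))
        ≡⟨ solve 5 (λ r′ r″ a b c → (r″ :- r′) :* (con (+ 2) :* a :- (r′ :+ r″) :* (con (+ 2) :* b) :+ r′ :* r″ :* (con (+ 2) :* c))
             := con (+ 2) :* ((r″ :- r′) :* (a :- (r′ :+ r″) :* b :+ r′ :* r″ :* c))) refl (σ ρ) (σ (σ ρ)) (κ h₂) (κ h₁) (κ h₀) ⟩
      κ (+ 2) * W ∎

  lin : (α β : Carrier) → ℤ → ℤ → ℤ → Carrier
  lin α β p q w = κ p + κ q * α + κ w * β

  -- The ℤ-basis is 1, α, β; the element 1 is built into `lin`.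
  record Basis (α β : Carrier) : Set where
    field
      α∈     : AlmostIntegral α
      β∈     : AlmostIntegral β
      span   : ∀ x → AlmostIntegral x → ∃ λ p → ∃₂ λ q w → x ≡ lin α β p q w
      indep  : ∀ p q w → lin α β p q w ≡ κ (+ 0) → p ≡ + 0 × q ≡ + 0 × w ≡ + 0

  module _ (α β : Carrier) where
    lin-- : ∀ p q w p′ q′ w′ → lin α β p q w - lin α β p′ q′ w′ ≡ lin α β (p ℤ.- p′) (q ℤ.- q′) (w ℤ.- w′)
    lin-- p q w p′ q′ w′ rewrite κ-- p p′ | κ-- q q′ | κ-- w w′ =
      solve 8 (λ α β p q w p′ q′ w′ → (p :+ q :* α :+ w :* β) :- (p′ :+ q′ :* α :+ w′ :* β)
        := p :- p′ :+ (q :- q′) :* α :+ (w :- w′) :* β) refl α β (κ p) (κ q) (κ w) (κ p′) (κ q′) (κ w′)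

    κ*lin : ∀ k p q w → κ k * lin α β p q w ≡ lin α β (k ℤ.* p) (k ℤ.* q) (k ℤ.* w)
    κ*lin k p q w rewrite κ-* k p | κ-* k q | κ-* k w =
      solve 6 (λ α β k p q w → k :* (p :+ q :* α :+ w :* β) := k :* p :+ k :* q :* α :+ k :* w :* β) refl
        α β (κ k) (κ p) (κ q) (κ w)

  lin-injective : ∀ {α β} → Basis α β → ∀ p q w p′ q′ w′ → lin α β p q w ≡ lin α β p′ q′ w′ → p ≡ p′ × q ≡ q′ × w ≡ w′
  lin-injective {α} {β} B p q w p′ q′ w′ eq =
    ℤ.i-j≡0⇒i≡j p p′ (proj₁ zeros) , ℤ.i-j≡0⇒i≡j q q′ (proj₁ (proj₂ zeros)) , ℤ.i-j≡0⇒i≡j w w′ (proj₂ (proj₂ zeros))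
    where
    zeros = Basis.indep B (p ℤ.- p′) (q ℤ.- q′) (w ℤ.- w′) (trans (sym (lin-- α β p q w p′ q′ w′))
      (trans (cong (_- lin α β p′ q′ w′) eq) (solve 1 (λ t → t :- t := con (+ 0)) refl (lin α β p′ q′ w′))))

  -- A basis in Hermite form is obtained from elements with minimal leading coefficients.
  Leading₂ Leading₁ : ℕ → Set
  Leading₂ k = ∃ λ x → ∃ λ a → ∃₂ λ b c → ℤ.∣ c ∣ ≡ k × c ≢ + 0 × AlmostIntegral x × κ δ * x ≡ Z a b c
  Leading₁ k = ∃ λ x → ∃₂ λ a b → ℤ.∣ b ∣ ≡ k × b ≢ + 0 × AlmostIntegral x × κ δ * x ≡ Z a b (+ 0)

  module Hermite
    {α : Carrier} {a₁ b₁ : ℤ} (b₁≢0 : b₁ ≢ + 0) (α∈ : AlmostIntegral α) (δα : κ δ * α ≡ Z a₁ b₁ (+ 0))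
    (min₁ : ∀ j → j ℕ.< ℤ.∣ b₁ ∣ → ¬ Leading₁ j)
    {β : Carrier} {a₂ b₂ c₂ : ℤ} (c₂≢0 : c₂ ≢ + 0) (β∈ : AlmostIntegral β) (δβ : κ δ * β ≡ Z a₂ b₂ c₂)
    (min₂ : ∀ j → j ℕ.< ℤ.∣ c₂ ∣ → ¬ Leading₂ j)
    where
    private instance
      nz₁ = ℤ.≢-nonZero b₁≢0
      nz₂ = ℤ.≢-nonZero c₂≢0

    subtract : ∀ {x y} q a b c a′ b′ c′ → κ δ * x ≡ Z a b c → κ δ * y ≡ Z a′ b′ c′ →
      κ δ * (x - κ q * y) ≡ Z (a ℤ.- q ℤ.* a′) (b ℤ.- q ℤ.* b′) (c ℤ.- q ℤ.* c′)
    subtract {x} {y} q a b c a′ b′ c′ eq eq′ = begin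
      κ δ * (x - κ q * y)       ≡⟨ solve 4 (λ d x q y → d :* (x :- q :* y) := d :* x :- q :* (d :* y)) refl (κ δ) x (κ q) y ⟩
      κ δ * x - κ q * (κ δ * y) ≡⟨ cong₂ (λ u v → u - κ q * v) eq eq′ ⟩
      Z a b c - κ q * Z a′ b′ c′ ≡⟨ cong (λ t → Z a b c - t) (κ*lin ρ (ρ * ρ) q a′ b′ c′) ⟩
      Z a b c - Z (q ℤ.* a′) (q ℤ.* b′) (q ℤ.* c′) ≡⟨ lin-- ρ (ρ * ρ) a b c (q ℤ.* a′) (q ℤ.* b′) (q ℤ.* c′) ⟩
      Z (a ℤ.- q ℤ.* a′) (b ℤ.- q ℤ.* b′) (c ℤ.- q ℤ.* c′) ∎
      where open ≡-Reasoning

    remainder≡ : ∀ a d .{{_ : ℤ.NonZero d}} → a ℤ.- (a ℤ./ d) ℤ.* d ≡ + (a ℤ.% d)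
    remainder≡ a d = trans (cong (ℤ._- (a ℤ./ d) ℤ.* d) (ℤ.a≡a%n+[a/n]*n a d))
      (a+b-b≡a (+ (a ℤ.% d)) ((a ℤ./ d) ℤ.* d))

    -- A nonzero remainder modulo c₂ would be the leading coefficient of an integer and smaller than
    -- the least one.
    reduce₂ : ∀ {x} a b c → AlmostIntegral x → κ δ * x ≡ Z a b c →
      let y = x - κ (c ℤ./ c₂) * β in AlmostIntegral y × ∃₂ λ a′ b′ → κ δ * y ≡ Z a′ b′ (+ 0)
    reduce₂ {x} a b c p eq = y∈ , a′ , b′ , trans δy (cong (Z a′ b′) r≡0)
      where
      q = c ℤ./ c₂
      a′ = a ℤ.- q ℤ.* a₂
      b′ = b ℤ.- q ℤ.* b₂
      r = c ℤ.- q ℤ.* c₂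
      y∈ = AI-- p (AI-* (AI-κ q) β∈)
      δy = subtract q a b c a₂ b₂ c₂ eq δβ
      r≡0 : r ≡ + 0
      r≡0 = decidable-stable (r ℤ.≟ + 0) λ r≢0 → min₂ (c ℤ.% c₂) (ℤ.n%d<d c c₂)
        (_ , a′ , b′ , r , cong ℤ.∣_∣ (remainder≡ c c₂) , r≢0 , y∈ , δy)

    reduce₁ : ∀ {x} a b → AlmostIntegral x → κ δ * x ≡ Z a b (+ 0) →
      let y = x - κ (b ℤ./ b₁) * α in AlmostIntegral y × ∃ λ a′ → κ δ * y ≡ Z a′ (+ 0) (+ 0)
    reduce₁ {x} a b p eq = y∈ , a′ , trans δy (cong (λ r → Z a′ r (+ 0)) r≡0)
      where
      q = b ℤ./ b₁
      a′ = a ℤ.- q ℤ.* a₁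
      r = b ℤ.- q ℤ.* b₁
      y∈ = AI-- p (AI-* (AI-κ q) α∈)
      δy = trans (subtract q a b (+ 0) a₁ b₁ (+ 0) eq δα)
        (cong (Z a′ r) (cong (λ t → + 0 ℤ.- t) (ℤ.*-zeroʳ q)))
      r≡0 : r ≡ + 0
      r≡0 = decidable-stable (r ℤ.≟ + 0) λ r≢0 → min₁ (b ℤ.% b₁) (ℤ.n%d<d b b₁)
        (_ , a′ , r , cong ℤ.∣_∣ (remainder≡ b b₁) , r≢0 , y∈ , δy)

    -- What remains is rational and almost integral.
    reduce₀ : ∀ {x} a → AlmostIntegral x → κ δ * x ≡ Z a (+ 0) (+ 0) → ∃ λ z → x ≡ κ z
    reduce₀ {x} a p eq = AI-quotient δ a p δ≢0 (sym (trans eq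
      (solve 2 (λ a ρ → a :+ con (+ 0) :* ρ :+ con (+ 0) :* (ρ :* ρ) := a) refl (κ a) ρ)))

    hermite-basis : Basis α β
    hermite-basis = record
      { α∈ = α∈ ; β∈ = β∈
      ; span = λ x p →
          let a , b , c , eq = δ-O p
              p₂ , a′ , b′ , eq₂ = reduce₂ a b c p eq
              p₁ , a″ , eq₁ = reduce₁ a′ b′ p₂ eq₂
              z , eq₀ = reduce₀ a″ p₁ eq₁
          in z , b′ ℤ./ b₁ , c ℤ./ c₂ , trans
            (solve 5 (λ x α β q w → x := x :- w :* β :- q :* α :+ q :* α :+ w :* β) refl x α β (κ (b′ ℤ./ b₁)) (κ (c ℤ./ c₂)))
            (cong (λ z → z + κ (b′ ℤ./ b₁) * α + κ (c ℤ./ c₂) * β) eq₀)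
      ; indep = independent
      }
      where
      expand-δ : ∀ p q w → κ δ * lin α β p q w ≡
        Z (p ℤ.* δ ℤ.+ q ℤ.* a₁ ℤ.+ w ℤ.* a₂) (q ℤ.* b₁ ℤ.+ w ℤ.* b₂) (w ℤ.* c₂)
      expand-δ p q w = begin
        κ δ * lin α β p q w
          ≡⟨ solve 6 (λ d α β p q w → d :* (p :+ q :* α :+ w :* β) := p :* d :+ q :* (d :* α) :+ w :* (d :* β)) refl
               (κ δ) α β (κ p) (κ q) (κ w) ⟩
        κ p * κ δ + κ q * (κ δ * α) + κ w * (κ δ * β)
          ≡⟨ cong₂ (λ u v → κ p * κ δ + κ q * u + κ w * v) δα δβ ⟩
        κ p * κ δ + κ q * Z a₁ b₁ (+ 0) + κ w * Z a₂ b₂ c₂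
          ≡⟨ solve 10 (λ d ρ p q w a₁ b₁ a₂ b₂ c₂ →
               p :* d :+ q :* (a₁ :+ b₁ :* ρ :+ con (+ 0) :* (ρ :* ρ)) :+ w :* (a₂ :+ b₂ :* ρ :+ c₂ :* (ρ :* ρ))
               := p :* d :+ q :* a₁ :+ w :* a₂ :+ (q :* b₁ :+ w :* b₂) :* ρ :+ w :* c₂ :* (ρ :* ρ)) refl
               (κ δ) ρ (κ p) (κ q) (κ w) (κ a₁) (κ b₁) (κ a₂) (κ b₂) (κ c₂) ⟩
        κ p * κ δ + κ q * κ a₁ + κ w * κ a₂ + (κ q * κ b₁ + κ w * κ b₂) * ρ + κ w * κ c₂ * (ρ * ρ)
          ≡⟨ cong₂ (λ u v → u + v * ρ + κ w * κ c₂ * (ρ * ρ))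
               (κ-⟦⟧ (var 0F :* var 1F :+ var 2F :* var 3F :+ var 4F :* var 5F) (p ∷ δ ∷ q ∷ a₁ ∷ w ∷ a₂ ∷ []))
               (κ-⟦⟧ (var 0F :* var 1F :+ var 2F :* var 3F) (q ∷ b₁ ∷ w ∷ b₂ ∷ [])) ⟨
        κ (p ℤ.* δ ℤ.+ q ℤ.* a₁ ℤ.+ w ℤ.* a₂) + κ (q ℤ.* b₁ ℤ.+ w ℤ.* b₂) * ρ + κ w * κ c₂ * (ρ * ρ)
          ≡⟨ cong (λ u → κ (p ℤ.* δ ℤ.+ q ℤ.* a₁ ℤ.+ w ℤ.* a₂) + κ (q ℤ.* b₁ ℤ.+ w ℤ.* b₂) * ρ + u * (ρ * ρ)) (κ-* w c₂) ⟨
        Z (p ℤ.* δ ℤ.+ q ℤ.* a₁ ℤ.+ w ℤ.* a₂) (q ℤ.* b₁ ℤ.+ w ℤ.* b₂) (w ℤ.* c₂) ∎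
        where open ≡-Reasoning

      factor≡0 : ∀ x y → y ≢ + 0 → x ℤ.* y ≡ + 0 → x ≡ + 0
      factor≡0 x y y≢0 eq = [ (λ x≡0 → x≡0) , (λ y≡0 → contradiction y≡0 y≢0) ]′ (ℤ.i*j≡0⇒i≡0∨j≡0 x eq)

      independent : ∀ p q w → lin α β p q w ≡ κ (+ 0) → p ≡ + 0 × q ≡ + 0 × w ≡ + 0
      independent p q w eq = p≡0 , q≡0 , w≡0
        where
        zeros = independence (p ℤ.* δ ℤ.+ q ℤ.* a₁ ℤ.+ w ℤ.* a₂) (q ℤ.* b₁ ℤ.+ w ℤ.* b₂) (w ℤ.* c₂) (trans (sym (expand-δ p q w)) (trans (cong (κ δ *_) eq)
          (solve 1 (λ d → d :* con (+ 0) := con (+ 0)) refl (κ δ))))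
        w≡0 : w ≡ + 0
        w≡0 = factor≡0 w c₂ c₂≢0 (proj₂ (proj₂ zeros))
        q≡0 : q ≡ + 0
        q≡0 = factor≡0 q b₁ b₁≢0 (trans (sym (ℤ.+-identityʳ (q ℤ.* b₁)))
          (trans (cong (λ w → q ℤ.* b₁ ℤ.+ w ℤ.* b₂) (sym w≡0)) (proj₁ (proj₂ zeros))))
        p≡0 : p ≡ + 0
        p≡0 = κ-injective {p} {+ 0} (begin
          κ p ≡⟨ solve 3 (λ p α β → p := p :+ con (+ 0) :* α :+ con (+ 0) :* β) refl (κ p) α β ⟩
          lin α β p (+ 0) (+ 0) ≡⟨ cong₂ (lin α β p) (sym q≡0) (sym w≡0) ⟩
          lin α β p q w ≡⟨ eq ⟩
          κ (+ 0) ∎)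
          where open ≡-Reasoning

  -- Both descents start at the leading coefficient δ, since δρ and δρ² have it.
  basis-exists : ¬ ¬ (∃₂ λ α β → Basis α β)
  basis-exists none =
    minimal {Leading₁} ℤ.∣ δ ∣ (ℕ.<-wellFounded _) start₁ λ { (_ , (α , a₁ , b₁ , refl , b₁≢0 , α∈ , δα) , min₁) →
    minimal {Leading₂} ℤ.∣ δ ∣ (ℕ.<-wellFounded _) start₂ λ { (_ , (β , a₂ , b₂ , c₂ , refl , c₂≢0 , β∈ , δβ) , min₂) →
    none (α , β , Hermite.hermite-basis {a₁ = a₁} {b₁ = b₁} b₁≢0 α∈ δα min₁ {a₂ = a₂} {b₂ = b₂} {c₂ = c₂} c₂≢0 β∈ δβ min₂) }}
    where
    start₁ : Leading₁ ℤ.∣ δ ∣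
    start₁ = ρ , + 0 , δ , refl , δ≢0 , AI-ρ ,
      solve 2 (λ d ρ → d :* ρ := con (+ 0) :+ d :* ρ :+ con (+ 0) :* (ρ :* ρ)) refl (κ δ) ρ
    start₂ : Leading₂ ℤ.∣ δ ∣
    start₂ = ρ * ρ , + 0 , + 0 , δ , refl , δ≢0 , AI-* AI-ρ AI-ρ ,
      solve 2 (λ d ρ → d :* (ρ :* ρ) := con (+ 0) :+ con (+ 0) :* ρ :+ d :* (ρ :* ρ)) refl (κ δ) ρ

  -- The index of ℤ[α]

  module _ {α β : Carrier} (B : Basis α β) where
    open Basis B

    basis-swap : Basis β α
    basis-swap = record
      { α∈ = β∈ ; β∈ = α∈
      ; span = λ x x∈ → let p , q , w , eq = span x x∈ in p , w , q , trans eq (swap p q w)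
      ; indep = λ p q w eq → let p≡0 , w≡0 , q≡0 = indep p w q (trans (swap p w q) eq) in p≡0 , q≡0 , w≡0
      }
      where
      swap : ∀ p q w → lin α β p q w ≡ lin β α p w q
      swap p q w = solve 5 (λ α β p q w → p :+ q :* α :+ w :* β := p :+ w :* β :+ q :* α) refl α β (κ p) (κ q) (κ w)

    -- The translation by x serves the normalisation αβ ∈ ℤ; the multiple y of β gives access to the
    -- index form at (1, y).
    basis-shear : ∀ x y → Basis (α + κ x + κ y * β) β
    basis-shear x y = record
      { α∈ = AI-+ (AI-+ α∈ (AI-κ x)) (AI-* (AI-κ y) β∈) ; β∈ = β∈
      ; span = λ v v∈ → let p , q , w , eq = span v v∈ in
          p ℤ.- q ℤ.* x , q , w ℤ.- q ℤ.* y , trans eq (backward p q w)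
      ; indep = λ p q w eq →
          let p′≡0 , q≡0 , w′≡0 = indep (p ℤ.+ q ℤ.* x) q (w ℤ.+ q ℤ.* y) (trans (sym (forward p q w)) eq)
          in trans (drop p q x q≡0) p′≡0 , q≡0 , trans (drop w q y q≡0) w′≡0
      }
      where
      open ≡-Reasoning
      drop : ∀ p q x → q ≡ + 0 → p ≡ p ℤ.+ q ℤ.* x
      drop p q x refl = sym (ℤ.+-identityʳ p)
      forward : ∀ p q w → lin (α + κ x + κ y * β) β p q w ≡ lin α β (p ℤ.+ q ℤ.* x) q (w ℤ.+ q ℤ.* y)
      forward p q w = begin
        κ p + κ q * (α + κ x + κ y * β) + κ w * β
          ≡⟨ solve 7 (λ α β x y p q w → p :+ q :* (α :+ x :+ y :* β) :+ w :* β := p :+ q :* x :+ q :* α :+ (w :+ q :* y) :* β)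
               refl α β (κ x) (κ y) (κ p) (κ q) (κ w) ⟩
        κ p + κ q * κ x + κ q * α + (κ w + κ q * κ y) * β
          ≡⟨ cong₂ (λ u v → u + κ q * α + v * β) (κ-⟦⟧ (var 0F :+ var 1F :* var 2F) (p ∷ q ∷ x ∷ []))
               (κ-⟦⟧ (var 0F :+ var 1F :* var 2F) (w ∷ q ∷ y ∷ [])) ⟨
        lin α β (p ℤ.+ q ℤ.* x) q (w ℤ.+ q ℤ.* y) ∎
      backward : ∀ p q w → lin α β p q w ≡ lin (α + κ x + κ y * β) β (p ℤ.- q ℤ.* x) q (w ℤ.- q ℤ.* y)
      backward p q w = begin
        κ p + κ q * α + κ w * β
          ≡⟨ solve 7 (λ α β x y p q w → p :+ q :* α :+ w :* β := p :- q :* x :+ q :* (α :+ x :+ y :* β) :+ (w :- q :* y) :* β)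
               refl α β (κ x) (κ y) (κ p) (κ q) (κ w) ⟩
        κ p - κ q * κ x + κ q * (α + κ x + κ y * β) + (κ w - κ q * κ y) * β
          ≡⟨ cong₂ (λ u v → u + κ q * (α + κ x + κ y * β) + v * β) (κ-⟦⟧ (var 0F :- var 1F :* var 2F) (p ∷ q ∷ x ∷ []))
               (κ-⟦⟧ (var 0F :- var 1F :* var 2F) (w ∷ q ∷ y ∷ [])) ⟨
        lin (α + κ x + κ y * β) β (p ℤ.- q ℤ.* x) q (w ℤ.- q ℤ.* y) ∎

    -- The coordinate of α - z at α is 1, while elements of 2𝔸 have even coordinates.
    basis-not-even : ∀ {y} → AlmostIntegral y → ∀ z → α - κ z ≢ κ (+ 2) * y
    basis-not-even {y} y∈ z eq = 1≢2* q q-eq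
      where
      coords = span y y∈
      p = proj₁ coords
      q = proj₁ (proj₂ coords)
      w = proj₁ (proj₂ (proj₂ coords))
      α≡ : lin α β (+ 0) (+ 1) (+ 0) ≡ lin α β (z ℤ.+ + 2 ℤ.* p) (+ 2 ℤ.* q) (+ 2 ℤ.* w)
      α≡ = begin
        lin α β (+ 0) (+ 1) (+ 0) ≡⟨ solve 3 (λ α β z → con (+ 0) :+ con (+ 1) :* α :+ con (+ 0) :* β := z :+ (α :- z)) refl α β (κ z) ⟩
        κ z + (α - κ z)           ≡⟨ cong (λ t → κ z + t) (trans eq (cong (κ (+ 2) *_) (proj₂ (proj₂ (proj₂ coords))))) ⟩
        κ z + κ (+ 2) * lin α β p q w ≡⟨ cong (λ t → κ z + t) (κ*lin α β (+ 2) p q w) ⟩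
        κ z + lin α β (+ 2 ℤ.* p) (+ 2 ℤ.* q) (+ 2 ℤ.* w)
          ≡⟨ solve 4 (λ z p q w → z :+ (p :+ q :+ w) := z :+ p :+ q :+ w) refl (κ z) (κ (+ 2 ℤ.* p)) (κ (+ 2 ℤ.* q) * α) (κ (+ 2 ℤ.* w) * β) ⟩
        κ z + κ (+ 2 ℤ.* p) + κ (+ 2 ℤ.* q) * α + κ (+ 2 ℤ.* w) * β
          ≡⟨ cong (λ t → t + κ (+ 2 ℤ.* q) * α + κ (+ 2 ℤ.* w) * β) (κ-+ z (+ 2 ℤ.* p)) ⟨
        lin α β (z ℤ.+ + 2 ℤ.* p) (+ 2 ℤ.* q) (+ 2 ℤ.* w) ∎
        where open ≡-Reasoning
      q-eq : + 1 ≡ + 2 ℤ.* q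
      q-eq = proj₁ (proj₂ (lin-injective B (+ 0) (+ 1) (+ 0) (z ℤ.+ + 2 ℤ.* p) (+ 2 ℤ.* q) (+ 2 ℤ.* w) α≡))

    module _ (r s t : ℤ) (α² : α * α ≡ lin α β r s t) where
      private
        α′ = σ α
        α″ = σ (σ α)
        β′ = σ β
        β″ = σ (σ β)
        σ-lin : ∀ x y → σ (κ r + κ s * x + κ t * y) ≡ κ r + κ s * σ x + κ t * σ y
        σ-lin x y rewrite σ-+ (κ r + κ s * x) (κ t * y) | σ-+ (κ r) (κ s * x) | σ-* (κ s) x | σ-* (κ t) y
          | σ-κ r | σ-κ s | σ-κ t = refl
        α′² : α′ * α′ ≡ lin α′ β′ r s t
        α′² = trans (sym (σ-* α α)) (trans (cong σ α²) (σ-lin α β))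
        α″² : α″ * α″ ≡ lin α″ β″ r s t
        α″² = trans (sym (σ-* α′ α′)) (trans (cong σ α′²) (σ-lin α′ β′))
        c = charPoly α∈
        α′∈ = AI-σ α∈
        α″∈ = AI-σ α′∈
        β′∈ = AI-σ β∈
        β″∈ = AI-σ β′∈

      -- T S − 3 N = P + Q for the two cyclic sums P = Σ αⱼ² αⱼ₊₁ and Q = Σ αⱼ² αⱼ₊₂,
      -- and P − Q = ± det (1, α, α²) is a multiple of t.
      index-form-odd : ¬ + 2 ∣ t
      index-form-odd (divides e t≡2e) = by-parity (+ 2 ∣? N)
        where
        open ≡-Reasoning
        T = CharPoly.t c
        S = CharPoly.s c
        N = CharPoly.n c
        D = (β * α′ + β′ * α″ + β″ * α) - (β * α″ + β′ * α + β″ * α′)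
        Q = α * α * α″ + α′ * α′ * α + α″ * α″ * α′
        D∈ : AlmostIntegral D
        D∈ = AI-- (AI-+ (AI-+ (AI-* β∈ α′∈) (AI-* β′∈ α″∈)) (AI-* β″∈ α∈)) (AI-+ (AI-+ (AI-* β∈ α″∈) (AI-* β′∈ α∈)) (AI-* β″∈ α′∈))
        Q∈ : AlmostIntegral Q
        Q∈ = AI-+ (AI-+ (AI-* (AI-* α∈ α∈) α″∈) (AI-* (AI-* α′∈ α′∈) α∈)) (AI-* (AI-* α″∈ α″∈) α′∈)
        P-Q : α * α * α′ + α′ * α′ * α″ + α″ * α″ * α - Q ≡ κ t * D
        P-Q = begin
          α * α * α′ + α′ * α′ * α″ + α″ * α″ * α - Q
            ≡⟨ solve 6 (λ u v w x y z → u :* y :+ v :* z :+ w :* x :- (u :* z :+ v :* x :+ w :* y)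
                 := u :* (y :- z) :+ v :* (z :- x) :+ w :* (x :- y)) refl (α * α) (α′ * α′) (α″ * α″) α α′ α″ ⟩
          α * α * (α′ - α″) + α′ * α′ * (α″ - α) + α″ * α″ * (α - α′)
            ≡⟨ cong₂ (λ u v → u * (α′ - α″) + v * (α″ - α) + α″ * α″ * (α - α′)) α² α′² ⟩
          lin α β r s t * (α′ - α″) + lin α′ β′ r s t * (α″ - α) + α″ * α″ * (α - α′)
            ≡⟨ cong (λ w → lin α β r s t * (α′ - α″) + lin α′ β′ r s t * (α″ - α) + w * (α - α′)) α″² ⟩
          lin α β r s t * (α′ - α″) + lin α′ β′ r s t * (α″ - α) + lin α″ β″ r s t * (α - α′)
            ≡⟨ solve 9 (λ x y z u v w r s t →
                 (r :+ s :* x :+ t :* u) :* (y :- z) :+ (r :+ s :* y :+ t :* v) :* (z :- x) :+ (r :+ s :* z :+ t :* w) :* (x :- y)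
                 := t :* ((u :* y :+ v :* z :+ w :* x) :- (u :* z :+ v :* x :+ w :* y)))
                 refl α α′ α″ β β′ β″ (κ r) (κ s) (κ t) ⟩
          κ t * D ∎
        TS-3N : κ (T ℤ.* S ℤ.- + 3 ℤ.* N) ≡ κ (+ 2) * (κ e * D + Q)
        TS-3N = begin
          κ (T ℤ.* S ℤ.- + 3 ℤ.* N) ≡⟨ κ-⟦⟧ (var 0F :* var 1F :- con (+ 3) :* var 2F) (T ∷ S ∷ N ∷ []) ⟩
          κ T * κ S - κ (+ 3) * κ N ≡⟨ cong₂ (λ u v → u * v - κ (+ 3) * κ N) (t≡ c) (s≡ c) ⟨
          (α + α′ + α″) * (α * α′ + α′ * α″ + α″ * α) - κ (+ 3) * κ N ≡⟨ cong (λ u → (α + α′ + α″) * (α * α′ + α′ * α″ + α″ * α) - κ (+ 3) * u) (n≡ c) ⟨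
          (α + α′ + α″) * (α * α′ + α′ * α″ + α″ * α) - κ (+ 3) * (α * α′ * α″)
            ≡⟨ solve 3 (λ x y z → (x :+ y :+ z) :* (x :* y :+ y :* z :+ z :* x) :- con (+ 3) :* (x :* y :* z)
                 := (x :* x :* y :+ y :* y :* z :+ z :* z :* x :- (x :* x :* z :+ y :* y :* x :+ z :* z :* y))
                    :+ con (+ 2) :* (x :* x :* z :+ y :* y :* x :+ z :* z :* y)) refl α α′ α″ ⟩
          (α * α * α′ + α′ * α′ * α″ + α″ * α″ * α - Q) + κ (+ 2) * Q ≡⟨ cong (_+ κ (+ 2) * Q) P-Q ⟩
          κ t * D + κ (+ 2) * Q ≡⟨ cong (λ u → u * D + κ (+ 2) * Q) (trans (cong κ t≡2e) (κ-* e (+ 2))) ⟩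
          κ e * κ (+ 2) * D + κ (+ 2) * Q ≡⟨ solve 3 (λ e D Q → e :* con (+ 2) :* D :+ con (+ 2) :* Q := con (+ 2) :* (e :* D :+ Q)) refl (κ e) D Q ⟩
          κ (+ 2) * (κ e * D + Q) ∎
        even : + 2 ∣ T ℤ.* S ℤ.- + 3 ℤ.* N
        even = AI-divides (+ 2) (T ℤ.* S ℤ.- + 3 ℤ.* N) (AI-+ (AI-* (AI-κ e) D∈) Q∈) (λ ()) TS-3N
        -- If N is even, α lies in 2𝔸. If N is odd, the evenness of T S - 3 N gives α - 1 an even
        -- norm, so α - 1 lies in 2𝔸. Both contradict that α belongs to a basis.
        by-parity : Dec (+ 2 ∣ N) → _
        by-parity (yes 2∣N) = let y , y∈ , eq = norm-even⇒half {n = N} α∈ (n≡ c) 2∣N in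
          basis-not-even y∈ (+ 0) (trans (solve 1 (λ α → α :- con (+ 0) := α) refl α) eq)
        by-parity (no 2∤N) = let y , y∈ , eq = norm-even⇒half {n = N ℤ.- S ℤ.+ T ℤ.- + 1} (AI-- α∈ (AI-κ (+ 1)))
                                   (n≡ (charPoly-pred c)) (conjugate-parity T S N even 2∤N) in
          basis-not-even y∈ (+ 1) eq

      private
        t≢0 : t ≢ + 0
        t≢0 refl = index-form-odd (divides (+ 0) refl)
        instance nz = ℤ.≢-nonZero t≢0

        quad : ℤ → ℤ → ℤ → Carrier
        quad x y z = lin α (α * α) x y z

      quad∈ℤ[α] : ∀ x y z → ℤ[_] K α (quad x y z)
      quad∈ℤ[α] x y z = x ∷ y ∷ z ∷ [] , reflexive (begin
        quad x y z ≡⟨ solve 4 (λ α x y z → x :+ y :* α :+ z :* (α :* α) := x :+ α :* (y :+ α :* (z :+ α :* con (+ 0)))) refl α (κ x) (κ y) (κ z) ⟩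
        κ x + α * (κ y + α * (κ z + α * κ (+ 0))) ≡⟨ cong (λ u → κ x + α * (κ y + α * (κ z + α * u))) κ0 ⟩
        κ x + α * (κ y + α * (κ z + α * 0#)) ∎)
        where
        open ≡-Reasoning
        open NumberField K using (reflexive)

      -- Horner's rule, with α³ reduced by the characteristic polynomial at every multiplication by
      -- α.
      ℤ[α]⇒quad : ∀ p → ∃ λ x → ∃₂ λ y z → evalℤ K p α ≡ quad x y z
      ℤ[α]⇒quad [] = + 0 , + 0 , + 0 , trans (sym κ0)
        (solve 1 (λ α → con (+ 0) := con (+ 0) :+ con (+ 0) :* α :+ con (+ 0) :* (α :* α)) refl α)
      ℤ[α]⇒quad (v ∷ p) = v ℤ.+ z ℤ.* N , x ℤ.- z ℤ.* S , y ℤ.+ z ℤ.* T , (begin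
          κ v + α * evalℤ K p α   ≡⟨ cong (λ u → κ v + α * u) eq ⟩
          κ v + α * quad x y z
            ≡⟨ solve 8 (λ α x y z T S N v → v :+ α :* (x :+ y :* α :+ z :* (α :* α)) :=
                 v :+ z :* N :+ (x :- z :* S) :* α :+ (y :+ z :* T) :* (α :* α)
                 :+ z :* (α :* α :* α :- T :* (α :* α) :+ S :* α :- N))
                 refl α (κ x) (κ y) (κ z) (κ T) (κ S) (κ N) (κ v) ⟩
          κ v + κ z * κ N + (κ x - κ z * κ S) * α + (κ y + κ z * κ T) * (α * α) + κ z * (α * α * α - κ T * (α * α) + κ S * α - κ N)
            ≡⟨ cong (λ u → κ v + κ z * κ N + (κ x - κ z * κ S) * α + (κ y + κ z * κ T) * (α * α) + κ z * u) (root-of-charPoly c) ⟩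
          κ v + κ z * κ N + (κ x - κ z * κ S) * α + (κ y + κ z * κ T) * (α * α) + κ z * κ (+ 0)
            ≡⟨ solve 2 (λ u z → u :+ z :* con (+ 0) := u) refl (κ v + κ z * κ N + (κ x - κ z * κ S) * α + (κ y + κ z * κ T) * (α * α)) (κ z) ⟩
          κ v + κ z * κ N + (κ x - κ z * κ S) * α + (κ y + κ z * κ T) * (α * α)
            ≡⟨ cong₂ (λ u w → u + w * α + (κ y + κ z * κ T) * (α * α)) (κ-⟦⟧ (var 0F :+ var 1F :* var 2F) (v ∷ z ∷ N ∷ []))
                 (κ-⟦⟧ (var 0F :- var 1F :* var 2F) (x ∷ z ∷ S ∷ [])) ⟨
          κ (v ℤ.+ z ℤ.* N) + κ (x ℤ.- z ℤ.* S) * α + (κ y + κ z * κ T) * (α * α)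
            ≡⟨ cong (λ w → κ (v ℤ.+ z ℤ.* N) + κ (x ℤ.- z ℤ.* S) * α + w * (α * α)) (κ-⟦⟧ (var 0F :+ var 1F :* var 2F) (y ∷ z ∷ T ∷ [])) ⟨
          quad (v ℤ.+ z ℤ.* N) (x ℤ.- z ℤ.* S) (y ℤ.+ z ℤ.* T) ∎)
        where
        open ≡-Reasoning
        T = CharPoly.t c
        S = CharPoly.s c
        N = CharPoly.n c
        rec = ℤ[α]⇒quad p
        x = proj₁ rec
        y = proj₁ (proj₂ rec)
        z = proj₁ (proj₂ (proj₂ rec))
        eq = proj₂ (proj₂ (proj₂ rec))

      -- The matrix of 1, α, α² over 1, α, β is triangular with diagonal 1, 1, t, which is why t
      -- measures the index.
      quad≡lin : ∀ x y z → quad x y z ≡ lin α β (x ℤ.+ z ℤ.* r) (y ℤ.+ z ℤ.* s) (z ℤ.* t)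
      quad≡lin x y z = begin
        κ x + κ y * α + κ z * (α * α) ≡⟨ cong (λ u → κ x + κ y * α + κ z * u) α² ⟩
        κ x + κ y * α + κ z * (κ r + κ s * α + κ t * β)
          ≡⟨ solve 8 (λ α β x y z r s t → x :+ y :* α :+ z :* (r :+ s :* α :+ t :* β)
               := x :+ z :* r :+ (y :+ z :* s) :* α :+ z :* t :* β) refl α β (κ x) (κ y) (κ z) (κ r) (κ s) (κ t) ⟩
        κ x + κ z * κ r + (κ y + κ z * κ s) * α + κ z * κ t * β
          ≡⟨ cong₂ (λ u v → u + v * α + κ z * κ t * β) (κ-⟦⟧ (var 0F :+ var 1F :* var 2F) (x ∷ z ∷ r ∷ []))
               (κ-⟦⟧ (var 0F :+ var 1F :* var 2F) (y ∷ z ∷ s ∷ [])) ⟨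
        κ (x ℤ.+ z ℤ.* r) + κ (y ℤ.+ z ℤ.* s) * α + κ z * κ t * β
          ≡⟨ cong (λ u → κ (x ℤ.+ z ℤ.* r) + κ (y ℤ.+ z ℤ.* s) * α + u * β) (κ-* z t) ⟨
        lin α β (x ℤ.+ z ℤ.* r) (y ℤ.+ z ℤ.* s) (z ℤ.* t) ∎
        where open ≡-Reasoning

      lin≡quad : ∀ p q z → lin α β p q (z ℤ.* t) ≡ quad (p ℤ.- z ℤ.* r) (q ℤ.- z ℤ.* s) z
      lin≡quad p q z = sym (trans (quad≡lin (p ℤ.- z ℤ.* r) (q ℤ.- z ℤ.* s) z)
        (cong₂ (λ u v → lin α β u v (z ℤ.* t)) (a-b+b≡a p (z ℤ.* r)) (a-b+b≡a q (z ℤ.* s))))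

      -- An integer lies in ℤ[α] exactly when t divides its β-coordinate, so cosets correspond to
      -- residues of that coordinate modulo t.
      ℤ[α]-index : Index K (Integral K) (ℤ[_] K α) ℤ.∣ t ∣
      ℤ[α]-index = record
        { rep      = λ i → κ (+ toℕ i) * β
        ; rep∈A    = λ i → AI⇒Integral (AI-* (AI-κ (+ toℕ i)) β∈)
        ; covers   = covers
        ; distinct = distinct
        }
        where
        open ≡-Reasoning
        open NumberField K using (reflexive) renaming (trans to ≈-trans)
        covers : ∀ x → Integral K x → ∃ λ (i : Fin ℤ.∣ t ∣) → ℤ[_] K α (x - κ (+ toℕ i) * β)
        covers x x∈ = i , proj₁ member , ≈-trans (reflexive x≡) (proj₂ member)
          where
          coords = span x (Integral⇒AI x∈)
          p = proj₁ coords
          q = proj₁ (proj₂ coords)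
          w = proj₁ (proj₂ (proj₂ coords))
          i = fromℕ< (ℤ.n%d<d w t)
          z = w ℤ./ t
          member = quad∈ℤ[α] (p ℤ.- z ℤ.* r) (q ℤ.- z ℤ.* s) z
          i≡ : + toℕ i ≡ + (w ℤ.% t)
          i≡ = cong +_ (Fin.toℕ-fromℕ< (ℤ.n%d<d w t))
          w≡ : κ w ≡ κ (+ toℕ i) + κ (z ℤ.* t)
          w≡ = trans (cong κ (trans (ℤ.a≡a%n+[a/n]*n w t) (cong (ℤ._+ z ℤ.* t) (sym i≡)))) (κ-+ (+ toℕ i) (z ℤ.* t))
          x≡ : x - κ (+ toℕ i) * β ≡ quad (p ℤ.- z ℤ.* r) (q ℤ.- z ℤ.* s) z
          x≡ = begin
            x - κ (+ toℕ i) * β ≡⟨ cong (_- κ (+ toℕ i) * β) (proj₂ (proj₂ (proj₂ coords))) ⟩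
            κ p + κ q * α + κ w * β - κ (+ toℕ i) * β ≡⟨ cong (λ w → κ p + κ q * α + w * β - κ (+ toℕ i) * β) w≡ ⟩
            κ p + κ q * α + (κ (+ toℕ i) + κ (z ℤ.* t)) * β - κ (+ toℕ i) * β
              ≡⟨ solve 4 (λ u i w β → u :+ (i :+ w) :* β :- i :* β := u :+ w :* β) refl (κ p + κ q * α) (κ (+ toℕ i)) (κ (z ℤ.* t)) β ⟩
            lin α β p q (z ℤ.* t) ≡⟨ lin≡quad p q z ⟩
            quad (p ℤ.- z ℤ.* r) (q ℤ.- z ℤ.* s) z ∎
        distinct : ∀ (i j : Fin ℤ.∣ t ∣) → ℤ[_] K α (κ (+ toℕ i) * β - κ (+ toℕ j) * β) → i ≡ j
        distinct i j (p , eq) = Fin.toℕ-injective (remainder-unique (toℕ i) (toℕ j) (Fin.toℕ<n i) (Fin.toℕ<n j)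
          (divides z (proj₂ (proj₂ (lin-injective B (+ 0) (+ 0) (+ toℕ i ℤ.- + toℕ j) (x ℤ.+ z ℤ.* r) (y ℤ.+ z ℤ.* s) (z ℤ.* t) equal)))))
          where
          form = ℤ[α]⇒quad p
          x = proj₁ form
          y = proj₁ (proj₂ form)
          z = proj₁ (proj₂ (proj₂ form))
          equal : lin α β (+ 0) (+ 0) (+ toℕ i ℤ.- + toℕ j) ≡ lin α β (x ℤ.+ z ℤ.* r) (y ℤ.+ z ℤ.* s) (z ℤ.* t)
          equal = begin
            κ (+ 0) + κ (+ 0) * α + κ (+ toℕ i ℤ.- + toℕ j) * β ≡⟨ cong (λ u → κ (+ 0) + κ (+ 0) * α + u * β) (κ-- (+ toℕ i) (+ toℕ j)) ⟩
            κ (+ 0) + κ (+ 0) * α + (κ (+ toℕ i) - κ (+ toℕ j)) * β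
              ≡⟨ solve 4 (λ α β i j → con (+ 0) :+ con (+ 0) :* α :+ (i :- j) :* β := i :* β :- j :* β) refl α β (κ (+ toℕ i)) (κ (+ toℕ j)) ⟩
            κ (+ toℕ i) * β - κ (+ toℕ j) * β ≡⟨ ≈⇒≡ eq ⟩
            evalℤ K p α ≡⟨ proj₂ (proj₂ (proj₂ form)) ⟩
            quad x y z ≡⟨ quad≡lin x y z ⟩
            lin α β (x ℤ.+ z ℤ.* r) (y ℤ.+ z ℤ.* s) (z ℤ.* t) ∎

      α-primitive : Primitive K α
      α-primitive = quadratic⇒primitive λ x →
        let D , D≢0 , Dx∈O = coordinates x
            p , q , w , eq = span (κ D * x) (O⇒AI Dx∈O)
        -- Multiplication by t makes the β-coordinate a multiple of t, so that t β can be replaced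
        -- by α² - r - s α.
        in t ℤ.* D , *-≢0 t≢0 D≢0 , t ℤ.* p ℤ.- w ℤ.* r , t ℤ.* q ℤ.- w ℤ.* s , w , (begin
          κ (t ℤ.* D) * x       ≡⟨ cong (_* x) (κ-* t D) ⟩
          κ t * κ D * x         ≡⟨ solve 3 (λ t D x → t :* D :* x := t :* (D :* x)) refl (κ t) (κ D) x ⟩
          κ t * (κ D * x)       ≡⟨ cong (κ t *_) eq ⟩
          κ t * lin α β p q w   ≡⟨ κ*lin α β t p q w ⟩
          lin α β (t ℤ.* p) (t ℤ.* q) (t ℤ.* w) ≡⟨ cong (lin α β (t ℤ.* p) (t ℤ.* q)) (ℤ.*-comm t w) ⟩
          lin α β (t ℤ.* p) (t ℤ.* q) (w ℤ.* t) ≡⟨ lin≡quad (t ℤ.* p) (t ℤ.* q) w ⟩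
          quad (t ℤ.* p ℤ.- w ℤ.* r) (t ℤ.* q ℤ.- w ℤ.* s) w ∎)
        where open ≡-Reasoning

      α-has-index : ∃ λ θ → Â K θ × Index K (Integral K) (ℤ[_] K θ) ℤ.∣ t ∣
      α-has-index = α , (AI⇒Integral α∈ , α-primitive) , ℤ[α]-index

  -- The gcd of the indices

  -- If αβ = p + qα + wβ, then (α - w)(β - q) = p + wq.
  basis-normalise : ∀ {α β} → Basis α β → ∃₂ λ α₁ β₁ → Basis α₁ β₁ × ∃ λ n → α₁ * β₁ ≡ κ n
  basis-normalise {α} {β} B = α₁ , β₁ , B₁ , p ℤ.+ w ℤ.* q , (begin
      α₁ * β₁ ≡⟨ cong₂ (λ u v → (α + u + κ (+ 0) * β) * (β + v + κ (+ 0) * α₁)) (κ-neg w) (κ-neg q) ⟩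
      (α - κ w + κ (+ 0) * β) * (β - κ q + κ (+ 0) * α₁)
        ≡⟨ solve 5 (λ α β γ w q → (α :- w :+ con (+ 0) :* β) :* (β :- q :+ con (+ 0) :* γ) := α :* β :- q :* α :- w :* β :+ w :* q) refl α β α₁ (κ w) (κ q) ⟩
      α * β - κ q * α - κ w * β + κ w * κ q ≡⟨ cong (λ u → u - κ q * α - κ w * β + κ w * κ q) αβ ⟩
      κ p + κ q * α + κ w * β - κ q * α - κ w * β + κ w * κ q
        ≡⟨ solve 5 (λ p x y w q → p :+ x :+ y :- x :- y :+ w :* q := p :+ w :* q) refl (κ p) (κ q * α) (κ w * β) (κ w) (κ q) ⟩
      κ p + κ w * κ q ≡⟨ κ-⟦⟧ (var 0F :+ var 1F :* var 2F) (p ∷ w ∷ q ∷ []) ⟨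
      κ (p ℤ.+ w ℤ.* q) ∎)
    where
    open ≡-Reasoning
    open Basis B
    coords = span (α * β) (AI-* α∈ β∈)
    p = proj₁ coords
    q = proj₁ (proj₂ coords)
    w = proj₁ (proj₂ (proj₂ coords))
    αβ : α * β ≡ lin α β p q w
    αβ = proj₂ (proj₂ (proj₂ coords))
    α₁ = α + κ (ℤ.- w) + κ (+ 0) * β
    β₁ = β + κ (ℤ.- q) + κ (+ 0) * α₁
    B₁ : Basis α₁ β₁
    B₁ = basis-swap (basis-shear (basis-swap (basis-shear B (ℤ.- w) (+ 0))) (ℤ.- q) (+ 0))

  -- For a basis with α β = n ∈ ℤ the index of x α + y β is ± (a x³ − b x²y + c xy² − d y³),
  -- and a common divisor g of the coefficients would make α/g integral.
  module Normalised {α β : Carrier} (B : Basis α β) {n : ℤ} (αβ : α * β ≡ κ n)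
    {r b a s d c : ℤ} (α² : α * α ≡ lin α β r b a) (β² : β * β ≡ lin α β s d c) where
    open Basis B
    open ≡-Reasoning

    -- Expanding (α α) β and α (α β) and comparing coordinates yields ad = n and r = -ac. These are
    -- relations of the Delone-Faddeev correspondence between cubic rings and binary cubic forms.
    associativity : lin α β (b ℤ.* n ℤ.+ a ℤ.* s) (a ℤ.* d) (r ℤ.+ a ℤ.* c) ≡ lin α β (+ 0) n (+ 0)
    associativity = begin
      κ (b ℤ.* n ℤ.+ a ℤ.* s) + κ (a ℤ.* d) * α + κ (r ℤ.+ a ℤ.* c) * β
        ≡⟨ cong₂ (λ u v → u + κ (a ℤ.* d) * α + v * β) (κ-⟦⟧ (var 0F :* var 1F :+ var 2F :* var 3F) (b ∷ n ∷ a ∷ s ∷ []))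
             (κ-⟦⟧ (var 0F :+ var 1F :* var 2F) (r ∷ a ∷ c ∷ [])) ⟩
      κ b * κ n + κ a * κ s + κ (a ℤ.* d) * α + (κ r + κ a * κ c) * β
        ≡⟨ cong (λ u → κ b * κ n + κ a * κ s + u * α + (κ r + κ a * κ c) * β) (κ-* a d) ⟩
      κ b * κ n + κ a * κ s + κ a * κ d * α + (κ r + κ a * κ c) * β
        ≡⟨ solve 9 (λ α β n r b a s d c → b :* n :+ a :* s :+ a :* d :* α :+ (r :+ a :* c) :* β
             := r :* β :+ b :* n :+ a :* (s :+ d :* α :+ c :* β)) refl α β (κ n) (κ r) (κ b) (κ a) (κ s) (κ d) (κ c) ⟩
      κ r * β + κ b * κ n + κ a * lin α β s d c
        ≡⟨ cong₂ (λ u v → κ r * β + κ b * u + κ a * v) (sym αβ) (sym β²) ⟩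
      κ r * β + κ b * (α * β) + κ a * (β * β)
        ≡⟨ solve 5 (λ α β r b a → r :* β :+ b :* (α :* β) :+ a :* (β :* β) := (r :+ b :* α :+ a :* β) :* β) refl α β (κ r) (κ b) (κ a) ⟩
      lin α β r b a * β ≡⟨ cong (_* β) α² ⟨
      α * α * β         ≡⟨ solve 2 (λ α β → α :* α :* β := α :* (α :* β)) refl α β ⟩
      α * (α * β)       ≡⟨ cong (α *_) αβ ⟩
      α * κ n           ≡⟨ solve 3 (λ α β n → α :* n := con (+ 0) :+ n :* α :+ con (+ 0) :* β) refl α β (κ n) ⟩
      lin α β (+ 0) n (+ 0) ∎

    constants : a ℤ.* d ≡ n × r ℤ.+ a ℤ.* c ≡ + 0
    constants = proj₂ (lin-injective B (b ℤ.* n ℤ.+ a ℤ.* s) (a ℤ.* d) (r ℤ.+ a ℤ.* c) (+ 0) n (+ 0) associativity)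

    -- The coefficients b, ac and a²d are homogeneous of degrees 1, 2 and 3 in a, b, c, d; this is
    -- what allows a common divisor g to be cancelled from α.
    cubic-equation : α * α * α - κ b * (α * α) + κ a * κ c * α - κ a * κ a * κ d ≡ κ (+ 0)
    cubic-equation = begin
      α * α * α - κ b * (α * α) + κ a * κ c * α - κ a * κ a * κ d
        ≡⟨ cong (λ u → u * α - κ b * (α * α) + κ a * κ c * α - κ a * κ a * κ d) α² ⟩
      lin α β r b a * α - κ b * (α * α) + κ a * κ c * α - κ a * κ a * κ d
        ≡⟨ solve 7 (λ α β r b a c d → (r :+ b :* α :+ a :* β) :* α :- b :* (α :* α) :+ a :* c :* α :- a :* a :* d
             := (r :+ a :* c) :* α :+ a :* (α :* β :- a :* d)) refl α β (κ r) (κ b) (κ a) (κ c) (κ d) ⟩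
      (κ r + κ a * κ c) * α + κ a * (α * β - κ a * κ d)
        ≡⟨ cong₂ (λ u v → u * α + κ a * (v - κ a * κ d))
             (trans (sym (κ-⟦⟧ (var 0F :+ var 1F :* var 2F) (r ∷ a ∷ c ∷ []))) (cong κ (proj₂ constants)))
             (trans αβ (trans (cong κ (sym (proj₁ constants))) (κ-* a d))) ⟩
      κ (+ 0) * α + κ a * (κ a * κ d - κ a * κ d)
        ≡⟨ solve 3 (λ α a d → con (+ 0) :* α :+ a :* (a :* d :- a :* d) := con (+ 0)) refl α (κ a) (κ d) ⟩
      κ (+ 0) ∎

    a-odd : ¬ + 2 ∣ a
    a-odd = index-form-odd B r b a α²

    -- Once α/g is integral, g divides all coordinates of α, and one of them is 1. Oddness of a
    -- excludes g = 0.
    content≡1 : ∀ {g} → g ∣ a → g ∣ b → g ∣ c → g ∣ d → g ∣ + 1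
    content≡1 {g} g∣a@(divides a′ a≡) (divides b′ b≡) (divides c′ c≡) (divides d′ d≡) =
      divides q (trans (proj₁ (proj₂ (lin-injective B (+ 0) (+ 1) (+ 0) (g ℤ.* p) (g ℤ.* q) (g ℤ.* w) α≡))) (ℤ.*-comm g q))
      where
      g≢0 : g ≢ + 0
      g≢0 refl = a-odd (subst (+ 2 ∣_) (sym (ℤ.0∣⇒≡0 g∣a)) (divides (+ 0) refl))
      g⁻¹ = κ-inverse g≢0
      x = proj₁ g⁻¹ * α
      gx : κ g * x ≡ α
      gx = begin
        κ g * (proj₁ g⁻¹ * α) ≡⟨ solve 3 (λ g i α → g :* (i :* α) := g :* i :* α) refl (κ g) (proj₁ g⁻¹) α ⟩
        κ g * proj₁ g⁻¹ * α   ≡⟨ cong (_* α) (proj₂ g⁻¹) ⟩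
        κ (+ 1) * α           ≡⟨ solve 1 (λ α → con (+ 1) :* α := α) refl α ⟩
        α ∎
      split : ∀ {z} z′ → z ≡ z′ ℤ.* g → κ z ≡ κ z′ * κ g
      split z′ refl = κ-* z′ g
      x-cubic : x * x * x - κ b′ * (x * x) + κ a′ * κ c′ * x - κ a′ * κ a′ * κ d′ ≡ κ (+ 0)
      x-cubic = κ-cancelˡ (g ℤ.* g ℤ.* g) (*-≢0 (*-≢0 g≢0 g≢0) g≢0) (begin
        κ (g ℤ.* g ℤ.* g) * (x * x * x - κ b′ * (x * x) + κ a′ * κ c′ * x - κ a′ * κ a′ * κ d′)
          ≡⟨ cong (_* (x * x * x - κ b′ * (x * x) + κ a′ * κ c′ * x - κ a′ * κ a′ * κ d′)) (κ-⟦⟧ (var 0F :* var 0F :* var 0F) (g ∷ [])) ⟩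
        κ g * κ g * κ g * (x * x * x - κ b′ * (x * x) + κ a′ * κ c′ * x - κ a′ * κ a′ * κ d′)
          ≡⟨ solve 6 (λ g x a b c d → g :* g :* g :* (x :* x :* x :- b :* (x :* x) :+ a :* c :* x :- a :* a :* d)
               := (g :* x) :* (g :* x) :* (g :* x) :- b :* g :* ((g :* x) :* (g :* x)) :+ (a :* g) :* (c :* g) :* (g :* x)
                  :- (a :* g) :* (a :* g) :* (d :* g)) refl (κ g) x (κ a′) (κ b′) (κ c′) (κ d′) ⟩
        (κ g * x) * (κ g * x) * (κ g * x) - κ b′ * κ g * ((κ g * x) * (κ g * x)) + (κ a′ * κ g) * (κ c′ * κ g) * (κ g * x)
          - (κ a′ * κ g) * (κ a′ * κ g) * (κ d′ * κ g)
          ≡⟨ cong (λ y → y * y * y - κ b′ * κ g * (y * y) + (κ a′ * κ g) * (κ c′ * κ g) * y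
               - (κ a′ * κ g) * (κ a′ * κ g) * (κ d′ * κ g)) gx ⟩
        α * α * α - κ b′ * κ g * (α * α) + (κ a′ * κ g) * (κ c′ * κ g) * α - (κ a′ * κ g) * (κ a′ * κ g) * (κ d′ * κ g)
          ≡⟨ cong₂ (λ a b → α * α * α - b * (α * α) + a * (κ c′ * κ g) * α - a * a * (κ d′ * κ g)) (split a′ a≡) (split b′ b≡) ⟨
        α * α * α - κ b * (α * α) + κ a * (κ c′ * κ g) * α - κ a * κ a * (κ d′ * κ g)
          ≡⟨ cong₂ (λ c d → α * α * α - κ b * (α * α) + κ a * c * α - κ a * κ a * d) (split c′ c≡) (split d′ d≡) ⟨
        α * α * α - κ b * (α * α) + κ a * κ c * α - κ a * κ a * κ d ≡⟨ cubic-equation ⟩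
        κ (+ 0) ≡⟨ solve 1 (λ g → con (+ 0) := g :* con (+ 0)) refl (κ (g ℤ.* g ℤ.* g)) ⟩
        κ (g ℤ.* g ℤ.* g) * κ (+ 0) ∎)
      x-integral : Integral K x
      x-integral = cubic-integral (ℤ.- b′) (a′ ℤ.* c′) (ℤ.- (a′ ℤ.* a′ ℤ.* d′)) (begin
        x * x * x + κ (ℤ.- b′) * (x * x) + κ (a′ ℤ.* c′) * x + κ (ℤ.- (a′ ℤ.* a′ ℤ.* d′))
          ≡⟨ cong₂ (λ u v → x * x * x + u * (x * x) + κ (a′ ℤ.* c′) * x + v) (κ-neg b′) (κ-⟦⟧ (:- (var 0F :* var 0F :* var 1F)) (a′ ∷ d′ ∷ [])) ⟩
        x * x * x + (- κ b′) * (x * x) + κ (a′ ℤ.* c′) * x + (- (κ a′ * κ a′ * κ d′))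
          ≡⟨ cong (λ u → x * x * x + (- κ b′) * (x * x) + u * x + (- (κ a′ * κ a′ * κ d′))) (κ-* a′ c′) ⟩
        x * x * x + (- κ b′) * (x * x) + κ a′ * κ c′ * x + (- (κ a′ * κ a′ * κ d′))
          ≡⟨ solve 4 (λ x b ac aad → x :* x :* x :+ :- b :* (x :* x) :+ ac :* x :+ :- aad
               := x :* x :* x :- b :* (x :* x) :+ ac :* x :- aad) refl x (κ b′) (κ a′ * κ c′) (κ a′ * κ a′ * κ d′) ⟩
        x * x * x - κ b′ * (x * x) + κ a′ * κ c′ * x - κ a′ * κ a′ * κ d′ ≡⟨ x-cubic ⟩
        κ (+ 0) ∎)
      coords = span x (Integral⇒AI x-integral)
      p = proj₁ coords
      q = proj₁ (proj₂ coords)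
      w = proj₁ (proj₂ (proj₂ coords))
      α≡ : lin α β (+ 0) (+ 1) (+ 0) ≡ lin α β (g ℤ.* p) (g ℤ.* q) (g ℤ.* w)
      α≡ = begin
        lin α β (+ 0) (+ 1) (+ 0) ≡⟨ solve 2 (λ α β → con (+ 0) :+ con (+ 1) :* α :+ con (+ 0) :* β := α) refl α β ⟩
        α                         ≡⟨ gx ⟨
        κ g * x                   ≡⟨ cong (κ g *_) (proj₂ (proj₂ (proj₂ coords))) ⟩
        κ g * lin α β p q w       ≡⟨ κ*lin α β g p q w ⟩
        lin α β (g ℤ.* p) (g ℤ.* q) (g ℤ.* w) ∎

    module _ (g : ℕ) (g∣ : ∀ k → (∃ λ θ → Â K θ × Index K (Integral K) (ℤ[_] K θ) k) → g ℕ.∣ k) where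
      g∣index : ∀ {α β} → Basis α β → ∀ r s t → α * α ≡ lin α β r s t → + g ∣ t
      g∣index B r s t α² = ℤ.∣ᵤ⇒∣ {+ g} {t} (g∣ ℤ.∣ t ∣ (α-has-index B r s t α²))

      β²-swapped : β * β ≡ lin β α s c d
      β²-swapped = trans β² (solve 5 (λ α β s d c → s :+ d :* α :+ c :* β := s :+ c :* β :+ d :* α) refl α β (κ s) (κ d) (κ c))

      -- The last coordinate is the index form at (1, y), namely a - by + cy² - dy³, simplified by
      -- y² = 1.
      sheared² : ∀ y → y ℤ.* y ≡ + 1 → let α₁ = α + κ (+ 0) + κ y * β in
        α₁ * α₁ ≡ lin α₁ β (r ℤ.+ s ℤ.+ + 2 ℤ.* y ℤ.* n) (b ℤ.+ d) (a ℤ.+ c ℤ.- y ℤ.* b ℤ.- y ℤ.* d)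
      sheared² y y²≡1 = begin
        α₁ * α₁
          ≡⟨ solve 3 (λ α β y → (α :+ con (+ 0) :+ y :* β) :* (α :+ con (+ 0) :+ y :* β)
               := α :* α :+ con (+ 2) :* y :* (α :* β) :+ y :* y :* (β :* β)) refl α β (κ y) ⟩
        α * α + κ (+ 2) * κ y * (α * β) + κ y * κ y * (β * β)
          ≡⟨ cong₂ (λ u v → α * α + κ (+ 2) * κ y * u + v * (β * β)) αβ (trans (sym (κ-* y y)) (cong κ y²≡1)) ⟩
        α * α + κ (+ 2) * κ y * κ n + κ (+ 1) * (β * β)
          ≡⟨ cong₂ (λ u v → u + κ (+ 2) * κ y * κ n + κ (+ 1) * v) α² β² ⟩
        lin α β r b a + κ (+ 2) * κ y * κ n + κ (+ 1) * lin α β s d c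
          ≡⟨ solve 10 (λ α β n y r b a s d c → r :+ b :* α :+ a :* β :+ con (+ 2) :* y :* n :+ con (+ 1) :* (s :+ d :* α :+ c :* β)
               := r :+ s :+ con (+ 2) :* y :* n :+ (b :+ d) :* (α :+ con (+ 0) :+ y :* β) :+ (a :+ c :- y :* b :- y :* d) :* β)
               refl α β (κ n) (κ y) (κ r) (κ b) (κ a) (κ s) (κ d) (κ c) ⟩
        κ r + κ s + κ (+ 2) * κ y * κ n + (κ b + κ d) * α₁ + (κ a + κ c - κ y * κ b - κ y * κ d) * β
          ≡⟨ cong₂ (λ u v → u + v * α₁ + (κ a + κ c - κ y * κ b - κ y * κ d) * β)
               (κ-⟦⟧ (var 0F :+ var 1F :+ con (+ 2) :* var 2F :* var 3F) (r ∷ s ∷ y ∷ n ∷ [])) (κ-+ b d) ⟨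
        κ (r ℤ.+ s ℤ.+ + 2 ℤ.* y ℤ.* n) + κ (b ℤ.+ d) * α₁ + (κ a + κ c - κ y * κ b - κ y * κ d) * β
          ≡⟨ cong (λ u → κ (r ℤ.+ s ℤ.+ + 2 ℤ.* y ℤ.* n) + κ (b ℤ.+ d) * α₁ + u * β)
               (κ-⟦⟧ (var 0F :+ var 1F :- var 4F :* var 2F :- var 4F :* var 3F) (a ∷ c ∷ b ∷ d ∷ y ∷ [])) ⟨
        lin α₁ β (r ℤ.+ s ℤ.+ + 2 ℤ.* y ℤ.* n) (b ℤ.+ d) (a ℤ.+ c ℤ.- y ℤ.* b ℤ.- y ℤ.* d) ∎
        where α₁ = α + κ (+ 0) + κ y * β

      common-divisor∣1 : g ℕ.∣ 1
      common-divisor∣1 = ℤ.∣⇒∣ᵤ (content≡1 g∣a (proj₁ g∣bc) (proj₂ g∣bc) g∣d)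
        where
        g∣a : + g ∣ a
        g∣a = g∣index B r b a α²
        g∣d : + g ∣ d
        g∣d = g∣index (basis-swap B) s c d β²-swapped
        g∣form : ∀ y → y ℤ.* y ≡ + 1 → + g ∣ a ℤ.+ c ℤ.- y ℤ.* b ℤ.- y ℤ.* d
        g∣form y y²≡1 = g∣index (basis-shear B (+ 0) y) (r ℤ.+ s ℤ.+ + 2 ℤ.* y ℤ.* n) (b ℤ.+ d)
          (a ℤ.+ c ℤ.- y ℤ.* b ℤ.- y ℤ.* d) (sheared² y y²≡1)
        g∣bc = form-content b c a-odd g∣a g∣d (g∣form (+ 1) refl) (g∣form -[1+ 0 ] refl)

  fieldIndex : FieldIndex K 1
  fieldIndex = record
    { divides-all = λ n _ → ℕ.1∣ n
    ; greatest = λ g g∣ → decidable-stable (g ℕ.∣? 1) λ g∤1 → basis-exists λ { (_ , _ , B₀) →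
        let α , β , B , n , αβ = basis-normalise B₀
            open Basis B
            r , b , a , α² = span (α * α) (AI-* α∈ α∈)
            s , d , c , β² = span (β * β) (AI-* β∈ β∈)
        in g∤1 (Normalised.common-divisor∣1 B {n} αβ {r} {b} {a} {s} {d} {c} α² β² g g∣) }
    }

-- The field L m

module Concrete (m : ℤ) where
  open ℚSolver.+-*-Solver

  μ : ℚ
  μ = fromℤ m
  open CubicRing μ
  open import Data.Rational.Base using (_+_; _*_; -_)

  2ℚ : ℚ
  2ℚ = fromℤ (+ 2)

  -- The automorphism with σρ = − 1 − 1/ρ.
  σ-L : Cubic → Cubic
  σ-L ⟨ a , b , c ⟩ =
    ⟨ a + (μ + 2ℚ) * b + (μ * μ + 3ℚ * μ + (3ℚ + 1ℚ)) * c
    , μ * b + (μ * μ + μ + 1ℚ) * c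
    , - b + - ((μ + 1ℚ) * c) ⟩

  record Cubicᴾ (n : ℕ) : Set where
    constructor ⟪_,_,_⟫
    field p₀ p₁ p₂ : Polynomial n
  open Cubicᴾ

  infixl 6 _⊕ᴾ_ _⊖ᴾ_
  _⊕ᴾ_ _⊖ᴾ_ : ∀ {n} → Cubicᴾ n → Cubicᴾ n → Cubicᴾ n
  ⟪ a , b , c ⟫ ⊕ᴾ ⟪ d , e , f ⟫ = ⟪ a :+ d , b :+ e , c :+ f ⟫
  ⟪ a , b , c ⟫ ⊖ᴾ ⟪ d , e , f ⟫ = ⟪ a :+ :- d , b :+ :- e , c :+ :- f ⟫

  constᴾ : ∀ {n} → Polynomial n → Cubicᴾ n
  constᴾ a = ⟪ a , con 0ℚ , con 0ℚ ⟫

  module Syntax {n : ℕ} (m : Polynomial n) where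
    infixr 8 x·ᴾ_
    x·ᴾ_ : Cubicᴾ n → Cubicᴾ n
    x·ᴾ ⟪ a , b , c ⟫ = ⟪ c , a :+ (m :+ con 3ℚ) :* c , b :+ m :* c ⟫
    infixl 7 _·ᴾ_ _⊗ᴾ_
    _·ᴾ_ : Polynomial n → Cubicᴾ n → Cubicᴾ n
    k ·ᴾ ⟪ a , b , c ⟫ = ⟪ k :* a , k :* b , k :* c ⟫
    _⊗ᴾ_ : Cubicᴾ n → Cubicᴾ n → Cubicᴾ n
    ⟪ a , b , c ⟫ ⊗ᴾ y = a ·ᴾ y ⊕ᴾ (b ·ᴾ x·ᴾ y ⊕ᴾ c ·ᴾ x·ᴾ (x·ᴾ y))
    σᴾ : Cubicᴾ n → Cubicᴾ n
    σᴾ ⟪ a , b , c ⟫ =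
      ⟪ a :+ (m :+ con 2ℚ) :* b :+ (m :* m :+ con 3ℚ :* m :+ (con 3ℚ :+ con 1ℚ)) :* c
      , m :* b :+ (m :* m :+ m :+ con 1ℚ) :* c
      , :- b :+ :- ((m :+ con 1ℚ) :* c) ⟫
    ρᴾ : Cubicᴾ n
    ρᴾ = ⟪ con 0ℚ , con 1ℚ , con 0ℚ ⟫

  σ-⊗ : ∀ u v → σ-L (u ⊗ v) ≡ σ-L u ⊗ σ-L v
  σ-⊗ ⟨ a , b , c ⟩ ⟨ d , e , f ⟩ = cong₃
    (solve 7 (λ m a b c d e f → let open Syntax m in p₀ (σᴾ (⟪ a , b , c ⟫ ⊗ᴾ ⟪ d , e , f ⟫)) := p₀ (σᴾ ⟪ a , b , c ⟫ ⊗ᴾ σᴾ ⟪ d , e , f ⟫)) refl μ a b c d e f)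
    (solve 7 (λ m a b c d e f → let open Syntax m in p₁ (σᴾ (⟪ a , b , c ⟫ ⊗ᴾ ⟪ d , e , f ⟫)) := p₁ (σᴾ ⟪ a , b , c ⟫ ⊗ᴾ σᴾ ⟪ d , e , f ⟫)) refl μ a b c d e f)
    (solve 7 (λ m a b c d e f → let open Syntax m in p₂ (σᴾ (⟪ a , b , c ⟫ ⊗ᴾ ⟪ d , e , f ⟫)) := p₂ (σᴾ ⟪ a , b , c ⟫ ⊗ᴾ σᴾ ⟪ d , e , f ⟫)) refl μ a b c d e f)

  σσ-L : Cubic → Cubic
  σσ-L u = σ-L (σ-L u)

  σ-⊕ : ∀ u v → σ-L (u ⊕ v) ≡ σ-L u ⊕ σ-L v
  σ-⊕ ⟨ a , b , c ⟩ ⟨ d , e , f ⟩ = cong₃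
    (solve 7 (λ m a b c d e f → let open Syntax m in p₀ (σᴾ (⟪ a , b , c ⟫ ⊕ᴾ ⟪ d , e , f ⟫)) := p₀ (σᴾ ⟪ a , b , c ⟫ ⊕ᴾ σᴾ ⟪ d , e , f ⟫)) refl μ a b c d e f)
    (solve 7 (λ m a b c d e f → let open Syntax m in p₁ (σᴾ (⟪ a , b , c ⟫ ⊕ᴾ ⟪ d , e , f ⟫)) := p₁ (σᴾ ⟪ a , b , c ⟫ ⊕ᴾ σᴾ ⟪ d , e , f ⟫)) refl μ a b c d e f)
    (solve 7 (λ m a b c d e f → let open Syntax m in p₂ (σᴾ (⟪ a , b , c ⟫ ⊕ᴾ ⟪ d , e , f ⟫)) := p₂ (σᴾ ⟪ a , b , c ⟫ ⊕ᴾ σᴾ ⟪ d , e , f ⟫)) refl μ a b c d e f)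

  σ-const : ∀ q → σ-L (const q) ≡ const q
  σ-const q = cong₃
    (solve 2 (λ m q → p₀ (Syntax.σᴾ m (constᴾ q)) := q) refl μ q)
    (solve 2 (λ m q → p₁ (Syntax.σᴾ m (constᴾ q)) := con 0ℚ) refl μ q)
    (solve 2 (λ m q → p₂ (Syntax.σᴾ m (constᴾ q)) := con 0ℚ) refl μ q)

  σ-σ-σ : ∀ u → σ-L (σ-L (σ-L u)) ≡ u
  σ-σ-σ ⟨ a , b , c ⟩ = cong₃
    (solve 4 (λ m a b c → let open Syntax m in p₀ (σᴾ (σᴾ (σᴾ ⟪ a , b , c ⟫))) := a) refl μ a b c)
    (solve 4 (λ m a b c → let open Syntax m in p₁ (σᴾ (σᴾ (σᴾ ⟪ a , b , c ⟫))) := b) refl μ a b c)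
    (solve 4 (λ m a b c → let open Syntax m in p₂ (σᴾ (σᴾ (σᴾ ⟪ a , b , c ⟫))) := c) refl μ a b c)

  open SemiringExp (CommutativeRing.semiring ℚ.+-*-commutativeRing) using (_^_)

  sumᴾ : ∀ {k n} → (Fin n → Polynomial k) → Polynomial k
  sumᴾ {n = zero}  f = con 0ℚ
  sumᴾ {n = suc n} f = f 0F :+ sumᴾ (λ i → f (suc i))

  detᴾ : ∀ {k} n → (Fin n → Fin n → Polynomial k) → Polynomial k
  detᴾ zero    M = con 1ℚ
  detᴾ (suc n) M = sumᴾ λ j → con ((- 1ℚ) ^ toℕ j) :* M 0F j :* detᴾ n (λ i k → M (suc i) (punchIn j k))

  -- A copy of the determinant and of the multiplication matrix in solver syntax, arranged so that
  -- it evaluates definitionally to `F (L m) θ x`.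
  Fᴾ : ∀ {k} → Polynomial k → Cubicᴾ k → Polynomial k → Polynomial k
  Fᴾ {k} m θ x = detᴾ 3 λ i j → (if does (i Fin.≟ j) then x else con 0ℚ) :+ :- coord i (θ ⊗ᴾ power j)
    where
    open Syntax m
    power : Fin 3 → Cubicᴾ k
    power 0F = ⟪ con 1ℚ , con 0ℚ , con 0ℚ ⟫
    power 1F = ⟪ con 0ℚ , con 1ℚ , con 0ℚ ⟫
    power 2F = ⟪ con 0ℚ , con 0ℚ , con 1ℚ ⟫
    coord : Fin 3 → Cubicᴾ k → Polynomial k
    coord 0F = p₀
    coord 1F = p₁
    coord 2F = p₂

  -- A polynomial identity in μ, x and the coordinates of θ; the coordinates of the product at ρ and
  -- ρ² vanish identically.
  F-conjugates : ∀ θ x → const (F (L m) θ x) ≡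
    (const x ⊕ ⊖ θ) ⊗ (const x ⊕ ⊖ σ-L θ) ⊗ (const x ⊕ ⊖ σσ-L θ)
  F-conjugates ⟨ a , b , c ⟩ x = cong₃
    (solve 5 (λ m a b c x → let open Syntax m; θ = ⟪ a , b , c ⟫ in
      Fᴾ m θ x := p₀ ((constᴾ x ⊖ᴾ θ) ⊗ᴾ (constᴾ x ⊖ᴾ σᴾ θ) ⊗ᴾ (constᴾ x ⊖ᴾ σᴾ (σᴾ θ)))) refl μ a b c x)
    (solve 5 (λ m a b c x → let open Syntax m; θ = ⟪ a , b , c ⟫ in
      con 0ℚ := p₁ ((constᴾ x ⊖ᴾ θ) ⊗ᴾ (constᴾ x ⊖ᴾ σᴾ θ) ⊗ᴾ (constᴾ x ⊖ᴾ σᴾ (σᴾ θ)))) refl μ a b c x)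
    (solve 5 (λ m a b c x → let open Syntax m; θ = ⟪ a , b , c ⟫ in
      con 0ℚ := p₂ ((constᴾ x ⊖ᴾ θ) ⊗ᴾ (constᴾ x ⊖ᴾ σᴾ θ) ⊗ᴾ (constᴾ x ⊖ᴾ σᴾ (σᴾ θ)))) refl μ a b c x)

  quadratic : ∀ a b c → const a ⊕ const b ⊗ ρ ⊕ const c ⊗ (ρ ⊗ ρ) ≡ ⟨ a , b , c ⟩
  quadratic a b c = cong₃
    (solve 4 (λ m a b c → let open Syntax m in p₀ (constᴾ a ⊕ᴾ constᴾ b ⊗ᴾ ρᴾ ⊕ᴾ constᴾ c ⊗ᴾ (ρᴾ ⊗ᴾ ρᴾ)) := a) refl μ a b c)
    (solve 4 (λ m a b c → let open Syntax m in p₁ (constᴾ a ⊕ᴾ constᴾ b ⊗ᴾ ρᴾ ⊕ᴾ constᴾ c ⊗ᴾ (ρᴾ ⊗ᴾ ρᴾ)) := b) refl μ a b c)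
    (solve 4 (λ m a b c → let open Syntax m in p₂ (constᴾ a ⊕ᴾ constᴾ b ⊗ᴾ ρᴾ ⊕ᴾ constᴾ c ⊗ᴾ (ρᴾ ⊗ᴾ ρᴾ)) := c) refl μ a b c)

  const-* : ∀ k a b c → const k ⊗ ⟨ a , b , c ⟩ ≡ ⟨ k * a , k * b , k * c ⟩
  const-* k a b c = cong₃
    (solve 5 (λ m k a b c → let open Syntax m in p₀ (constᴾ k ⊗ᴾ ⟪ a , b , c ⟫) := k :* a) refl μ k a b c)
    (solve 5 (λ m k a b c → let open Syntax m in p₁ (constᴾ k ⊗ᴾ ⟪ a , b , c ⟫) := k :* b) refl μ k a b c)
    (solve 5 (λ m k a b c → let open Syntax m in p₂ (constᴾ k ⊗ᴾ ⟪ a , b , c ⟫) := k :* c) refl μ k a b c)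

  κ-L : ℤ → Cubic
  κ-L z = const (fromℤ z)

  -- The common denominator D is the product of the denominators of the three coordinates.
  coordinates-L : ∀ x → ∃ λ D → D ≢ + 0 × ∃ λ a → ∃₂ λ b c →
    κ-L D ⊗ x ≡ κ-L a ⊕ κ-L b ⊗ ρ ⊕ κ-L c ⊗ (ρ ⊗ ρ)
  coordinates-L ⟨ a , b , c ⟩ = ℚ.↧ a ℤ.* ℚ.↧ b ℤ.* ℚ.↧ c
    , *-≢0 (*-≢0 (denominator≢0 a) (denominator≢0 b)) (denominator≢0 c)
    , ℚ.↥ a ℤ.* ℚ.↧ b ℤ.* ℚ.↧ c , ℚ.↥ b ℤ.* ℚ.↧ a ℤ.* ℚ.↧ c , ℚ.↥ c ℤ.* ℚ.↧ a ℤ.* ℚ.↧ b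
    , trans (const-* (fromℤ D) a b c) (trans
        (cong₃ (cleared a y z D refl)
          (cleared b x z D (cong (ℤ._* z) (ℤ.*-comm x y)))
          (cleared c x y D (trans (ℤ.*-comm (x ℤ.* y) z) (sym (ℤ.*-assoc z x y)))))
        (sym (quadratic (fromℤ (ℚ.↥ a ℤ.* y ℤ.* z)) (fromℤ (ℚ.↥ b ℤ.* x ℤ.* z)) (fromℤ (ℚ.↥ c ℤ.* x ℤ.* y)))))
    where
    x = ℚ.↧ a
    y = ℚ.↧ b
    z = ℚ.↧ c
    D = x ℤ.* y ℤ.* z
    fromℤ-*₃ : ∀ x y z → fromℤ (x ℤ.* y ℤ.* z) ≡ fromℤ x * fromℤ y * fromℤ z
    fromℤ-*₃ x y z = trans (fromℤ-* (x ℤ.* y) z) (cong (_* fromℤ z) (fromℤ-* x y))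
    cleared : ∀ q y z D → D ≡ ℚ.↧ q ℤ.* y ℤ.* z → fromℤ D * q ≡ fromℤ (ℚ.↥ q ℤ.* y ℤ.* z)
    cleared q y z D refl = begin
      fromℤ (ℚ.↧ q ℤ.* y ℤ.* z) * q             ≡⟨ cong (_* q) (fromℤ-*₃ (ℚ.↧ q) y z) ⟩
      fromℤ (ℚ.↧ q) * fromℤ y * fromℤ z * q     ≡⟨ solve 4 (λ x y z q → x :* y :* z :* q := q :* x :* y :* z) refl (fromℤ (ℚ.↧ q)) (fromℤ y) (fromℤ z) q ⟩
      q * fromℤ (ℚ.↧ q) * fromℤ y * fromℤ z     ≡⟨ cong (λ t → t * fromℤ y * fromℤ z) (numerator-denominator m q) ⟨
      fromℤ (ℚ.↥ q) * fromℤ y * fromℤ z         ≡⟨ fromℤ-*₃ (ℚ.↥ q) y z ⟨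
      fromℤ (ℚ.↥ q ℤ.* y ℤ.* z)                 ∎
      where open ≡-Reasoning

  independence-L : ∀ a b c → κ-L a ⊕ κ-L b ⊗ ρ ⊕ κ-L c ⊗ (ρ ⊗ ρ) ≡ κ-L (+ 0) → a ≡ + 0 × b ≡ + 0 × c ≡ + 0
  independence-L a b c eq = injective (cong Cubic.c₀ eq′) , injective (cong Cubic.c₁ eq′) , injective (cong Cubic.c₂ eq′)
    where
    eq′ : ⟨ fromℤ a , fromℤ b , fromℤ c ⟩ ≡ κ-L (+ 0)
    eq′ = trans (sym (quadratic (fromℤ a) (fromℤ b) (fromℤ c))) eq
    injective : ∀ {z} → fromℤ z ≡ fromℤ (+ 0) → z ≡ + 0
    injective {z} = fromℤ-injective {z} {+ 0}

  ρ-cubic-L : ρ ⊗ (ρ ⊗ ρ) ≡ const μ ⊗ (ρ ⊗ ρ) ⊕ ((const μ ⊕ const 3ℚ) ⊗ ρ ⊕ const 1ℚ)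
  ρ-cubic-L = cong₃
    (solve 1 (λ m → p₀ (lhs m) := p₀ (rhs m)) refl μ)
    (solve 1 (λ m → p₁ (lhs m) := p₁ (rhs m)) refl μ)
    (solve 1 (λ m → p₂ (lhs m) := p₂ (rhs m)) refl μ)
    where
    lhs rhs : ∀ {n} → Polynomial n → Cubicᴾ n
    lhs m = let open Syntax m in ρᴾ ⊗ᴾ (ρᴾ ⊗ᴾ ρᴾ)
    rhs m = let open Syntax m in constᴾ m ⊗ᴾ (ρᴾ ⊗ᴾ ρᴾ) ⊕ᴾ ((constᴾ m ⊕ᴾ constᴾ (con 3ℚ)) ⊗ᴾ ρᴾ ⊕ᴾ constᴾ (con 1ℚ))

  σρ-L : σ-L ρ ≡ const μ ⊕ const 2ℚ ⊕ const μ ⊗ ρ ⊕ ⊖ (ρ ⊗ ρ)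
  σρ-L = cong₃
    (solve 1 (λ m → p₀ (lhs m) := p₀ (rhs m)) refl μ)
    (solve 1 (λ m → p₁ (lhs m) := p₁ (rhs m)) refl μ)
    (solve 1 (λ m → p₂ (lhs m) := p₂ (rhs m)) refl μ)
    where
    lhs rhs : ∀ {n} → Polynomial n → Cubicᴾ n
    lhs m = let open Syntax m in σᴾ ρᴾ
    rhs m = let open Syntax m in constᴾ m ⊕ᴾ constᴾ (con 2ℚ) ⊕ᴾ constᴾ m ⊗ᴾ ρᴾ ⊖ᴾ ρᴾ ⊗ᴾ ρᴾ

  ρ-trace-L : ρ ⊕ σ-L ρ ⊕ σσ-L ρ ≡ const μ
  ρ-trace-L = cong₃
    (solve 1 (λ m → p₀ (lhs m) := m) refl μ)
    (solve 1 (λ m → p₁ (lhs m) := con 0ℚ) refl μ)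
    (solve 1 (λ m → p₂ (lhs m) := con 0ℚ) refl μ)
    where
    lhs : ∀ {n} → Polynomial n → Cubicᴾ n
    lhs m = let open Syntax m in ρᴾ ⊕ᴾ σᴾ ρᴾ ⊕ᴾ σᴾ (σᴾ ρᴾ)

  ρ-pairs-L : ρ ⊗ σ-L ρ ⊕ σ-L ρ ⊗ σσ-L ρ ⊕ σσ-L ρ ⊗ ρ ≡ ⊖ (const μ ⊕ const 3ℚ)
  ρ-pairs-L = cong₃
    (solve 1 (λ m → p₀ (lhs m) := :- (m :+ con 3ℚ)) refl μ)
    (solve 1 (λ m → p₁ (lhs m) := con 0ℚ) refl μ)
    (solve 1 (λ m → p₂ (lhs m) := con 0ℚ) refl μ)
    where
    lhs : ∀ {n} → Polynomial n → Cubicᴾ n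
    lhs m = let open Syntax m in ρᴾ ⊗ᴾ σᴾ ρᴾ ⊕ᴾ σᴾ ρᴾ ⊗ᴾ σᴾ (σᴾ ρᴾ) ⊕ᴾ σᴾ (σᴾ ρᴾ) ⊗ᴾ ρᴾ

  ρ-norm-L : ρ ⊗ σ-L ρ ⊗ σσ-L ρ ≡ const 1ℚ
  ρ-norm-L = cong₃
    (solve 1 (λ m → p₀ (lhs m) := con 1ℚ) refl μ)
    (solve 1 (λ m → p₁ (lhs m) := con 0ℚ) refl μ)
    (solve 1 (λ m → p₂ (lhs m) := con 0ℚ) refl μ)
    where
    lhs : ∀ {n} → Polynomial n → Cubicᴾ n
    lhs m = let open Syntax m in ρᴾ ⊗ᴾ σᴾ ρᴾ ⊗ᴾ σᴾ (σᴾ ρᴾ)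

  different-L : (ρ ⊕ ⊖ σ-L ρ) ⊗ (σ-L ρ ⊕ ⊖ σσ-L ρ) ⊗ (σσ-L ρ ⊕ ⊖ ρ) ≡ const (μ * μ + 3ℚ * μ + fromℤ (+ 9))
  different-L = cong₃
    (solve 1 (λ m → p₀ (lhs m) := m :* m :+ con 3ℚ :* m :+ con (fromℤ (+ 9))) refl μ)
    (solve 1 (λ m → p₁ (lhs m) := con 0ℚ) refl μ)
    (solve 1 (λ m → p₂ (lhs m) := con 0ℚ) refl μ)
    where
    lhs : ∀ {n} → Polynomial n → Cubicᴾ n
    lhs m = let open Syntax m in (ρᴾ ⊖ᴾ σᴾ ρᴾ) ⊗ᴾ (σᴾ ρᴾ ⊖ᴾ σᴾ (σᴾ ρᴾ)) ⊗ᴾ (σᴾ (σᴾ ρᴾ) ⊖ᴾ ρᴾ)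

  fromℤ-different : fromℤ (m ℤ.* m ℤ.+ + 3 ℤ.* m ℤ.+ + 9) ≡ μ * μ + 3ℚ * μ + fromℤ (+ 9)
  fromℤ-different = trans (fromℤ-+ (m ℤ.* m ℤ.+ + 3 ℤ.* m) (+ 9)) (cong (_+ fromℤ (+ 9))
    (trans (fromℤ-+ (m ℤ.* m) (+ 3 ℤ.* m)) (cong₂ _+_ (fromℤ-* m m) (fromℤ-* (+ 3) m))))

  trace-L : ∀ u → ∃ λ q → u ⊕ σ-L u ⊕ σσ-L u ≡ const q
  trace-L u@(⟨ a , b , c ⟩) = Cubic.c₀ (u ⊕ σ-L u ⊕ σσ-L u) , cong₃ refl
    (solve 4 (λ m a b c → p₁ (lhs m ⟪ a , b , c ⟫) := con 0ℚ) refl μ a b c)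
    (solve 4 (λ m a b c → p₂ (lhs m ⟪ a , b , c ⟫) := con 0ℚ) refl μ a b c)
    where
    lhs : ∀ {n} → Polynomial n → Cubicᴾ n → Cubicᴾ n
    lhs m u = let open Syntax m in u ⊕ᴾ σᴾ u ⊕ᴾ σᴾ (σᴾ u)

  norm-L : ∀ u → ∃ λ q → u ⊗ σ-L u ⊗ σσ-L u ≡ const q
  norm-L u@(⟨ a , b , c ⟩) = Cubic.c₀ (u ⊗ σ-L u ⊗ σσ-L u) , cong₃ refl
    (solve 4 (λ m a b c → p₁ (lhs m ⟪ a , b , c ⟫) := con 0ℚ) refl μ a b c)
    (solve 4 (λ m a b c → p₂ (lhs m ⟪ a , b , c ⟫) := con 0ℚ) refl μ a b c)
    where
    lhs : ∀ {n} → Polynomial n → Cubicᴾ n → Cubicᴾ n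
    lhs m u = let open Syntax m in u ⊗ᴾ σᴾ u ⊗ᴾ σᴾ (σᴾ u)

  simplestCubic : CyclicCubic m
  simplestCubic = record
    { K = L m
    ; ≈⇒≡ = λ eq → eq
    ; ≡-isCommutativeRing = CommutativeRing.isCommutativeRing commutativeRing
    ; ρ = ρ
    ; ρ-cubic = ρ-cubic-L
    ; coordinates = coordinates-L
    ; independence = independence-L
    ; σ = σ-L
    ; σ-+ = σ-⊕
    ; σ-* = σ-⊗
    ; σ-ι = σ-const
    ; σ³ = σ-σ-σ
    ; σρ = σρ-L
    ; ρ-trace = ρ-trace-L
    ; ρ-pairs = ρ-pairs-L
    ; ρ-norm = ρ-norm-L
    ; trace-rational = trace-L
    ; norm-rational = norm-L
    ; F-norm = λ θ x → F-conjugates θ (fromℤ x)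
    ; δ = m ℤ.* m ℤ.+ + 3 ℤ.* m ℤ.+ + 9
    ; δ-odd = different-odd m
    ; different = trans different-L (cong const (sym fromℤ-different))
    }

theorem1p3 : (m : ℤ) →
    FieldIndex (L m) 1
    × (m ≡ + 39 [mod 243 ] ⊎ m ≡ + 120 [mod 243 ] ⊎ m ≡ + 201 [mod 243 ] →
    FieldValueLcm (L m) 3)
    × (¬ (m ≡ + 39 [mod 243 ] ⊎ m ≡ + 120 [mod 243 ] ⊎ m ≡ + 201 [mod 243 ]) →
    FieldValueLcm (L m) 1)
theorem1p3 m = fieldIndex
  , (λ cases → fieldValueLcm-3 (forward cases))
  , (λ no-case → fieldValueLcm-1 (λ 81∣ → no-case (backward 81∣)))
  where
  open Theory (Concrete.simplestCubic m)
  forward : m ≡ + 39 [mod 243 ] ⊎ m ≡ + 120 [mod 243 ] ⊎ m ≡ + 201 [mod 243 ] → + 81 ∣ m ℤ.- + 39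
  forward (inj₁ p)        = mod-243⇒mod-81 m (+ 0) (ℤ.∣ᵤ⇒∣ {+ 243} {m ℤ.- + 39} p)
  forward (inj₂ (inj₁ p)) = mod-243⇒mod-81 m (+ 1) (ℤ.∣ᵤ⇒∣ {+ 243} {m ℤ.- + 120} p)
  forward (inj₂ (inj₂ p)) = mod-243⇒mod-81 m (+ 2) (ℤ.∣ᵤ⇒∣ {+ 243} {m ℤ.- + 201} p)
  backward : + 81 ∣ m ℤ.- + 39 → m ≡ + 39 [mod 243 ] ⊎ m ≡ + 120 [mod 243 ] ⊎ m ≡ + 201 [mod 243 ]
  backward 81∣ = Sum.map (ℤ.∣⇒∣ᵤ {+ 243} {m ℤ.- + 39})
    (Sum.map (ℤ.∣⇒∣ᵤ {+ 243} {m ℤ.- + 120}) (ℤ.∣⇒∣ᵤ {+ 243} {m ℤ.- + 201}))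
    (mod-81⇒mod-243 m 81∣)
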